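{- For every $\eta\in(0,1)$ and every $c\in\mathbb N$ there is $n_0\in\mathbb N$ such that for every $n\ge n_0$ and every $k\ge\eta n$, every oriented graph $D$ on $n$ vertices with more than $(1+\eta)(k-1)n$ edges contains every balanced antidirected tree $T$ with $k$ edges and $\Delta(T)\le(\log n)^c$.
   Context: An oriented graph is a digraph with no loops and at most one edge between any pair of vertices. An oriented graph is antidirected if it contains no directed path with 2 edges. An antidirected tree is an antidirected oriented graph whose underlying undirected graph is a tree; it is balanced if the number of vertices with no outgoing edges equals the number of vertices with no incoming edges. $\Delta(T)$ denotes the maximum degree of the underlying undirected tree of $T$. -}

module Defs where

open import Data.Nat using (ℕ; zero; suc; _≤_; _<_)
open import Data.Bool using (Bool; true; false; _∨_; not)
open import Data.Fin using (Fin)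
open import Data.List using (List; []; _∷_; length; filter; allFin; concatMap; map)
open import Data.Product using (_×_; _,_; ∃-syntax; Σ-syntax)
open import Relation.Binary.PropositionalEquality using (_≡_; _≢_)
open import Relation.Nullary using (¬_)
open import Function.Definitions using (Injective)
open import Data.Bool using (T)
import Data.Bool.Properties
import Data.Bool.ListAction
open import Relation.Nullary.Decidable using (Dec)

-- A digraph on vertex set Fin n, given by a Boolean adjacency matrix:
-- adj u v = true  means there is an edge u → v.
Digraph : ℕ → Set
Digraph n = Fin n → Fin n → Bool

-- Oriented graph: no loops, and at most one edge between any pair of
-- vertices (no pair of opposite edges; parallel edges are impossible
-- in an adjacency-matrix representation).
IsOriented : ∀ {n} → Digraph n → Set
IsOriented {n} D =
  (∀ (u : Fin n) → D u u ≡ false) ×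
  (∀ (u v : Fin n) → D u v ≡ true → D v u ≡ false)

edgeCount : ∀ {n} → Digraph n → ℕ
edgeCount {n} D =
  length (filter (λ p → Data.Bool.Properties.T? (D (Data.Product.proj₁ p) (Data.Product.proj₂ p)))
    (concatMap (λ u → map (λ v → (u , v)) (allFin n)) (allFin n)))

uadj : ∀ {n} → Digraph n → Fin n → Fin n → Bool
uadj D u v = D u v ∨ D v u

degree : ∀ {n} → Digraph n → Fin n → ℕ
degree {n} D u = length (filter (λ v → Data.Bool.Properties.T? (uadj D u v)) (allFin n))

MaxDegree≤ : ∀ {n} → Digraph n → ℕ → Set
MaxDegree≤ {n} D d = ∀ (u : Fin n) → degree D u ≤ d

data Walk {n} (D : Digraph n) : Fin n → Fin n → Set where
  here : ∀ {u} → Walk D u u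
  step : ∀ {u v w} → uadj D u v ≡ true → Walk D v w → Walk D u w

Connected : ∀ {n} → Digraph n → Set
Connected {n} D = ∀ (u v : Fin n) → Walk D u v

IsAntidirected : ∀ {n} → Digraph n → Set
IsAntidirected {n} D = ∀ (u v w : Fin n) → D u v ≡ true → D v w ≡ false

-- An antidirected tree with k edges: an antidirected oriented graph on
-- k+1 vertices whose underlying undirected graph is a tree, i.e. it is
-- connected and has exactly k edges (= number of vertices minus one).
IsAntidirectedTree : (k : ℕ) → Digraph (suc k) → Set
IsAntidirectedTree k T =
  IsOriented T × IsAntidirected T × Connected T × (edgeCount T ≡ k)

isSink : ∀ {n} → Digraph n → Fin n → Bool
isSink {n} D u = not (Data.Bool.ListAction.any (λ v → D u v) (allFin n))

isSource : ∀ {n} → Digraph n → Fin n → Bool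
isSource {n} D u = not (Data.Bool.ListAction.any (λ v → D v u) (allFin n))

numSinks : ∀ {n} → Digraph n → ℕ
numSinks {n} D = length (filter (λ u → Data.Bool.Properties.T? (isSink D u)) (allFin n))

numSources : ∀ {n} → Digraph n → ℕ
numSources {n} D = length (filter (λ u → Data.Bool.Properties.T? (isSource D u)) (allFin n))

IsBalanced : ∀ {n} → Digraph n → Set
IsBalanced D = numSinks D ≡ numSources D

Contains : ∀ {n m} → Digraph n → Digraph m → Set
Contains {n} {m} D H =
  Σ[ f ∈ (Fin m → Fin n) ] (Injective _≡_ _≡_ f ×
    (∀ (u v : Fin m) → H u v ≡ true → D (f u) (f v) ≡ true))

{-# OPTIONS --safe #-}
-- Only a one-sided form of regularity is needed: any two large subsets of two clusters joined in the reduced graph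
-- span many edges.  Such a partition is found without an energy function: as long as many pairs of clusters contain a
-- sparse pair of large subsets, declare these sparse rectangles and refine.  The declared region grows by a fixed
-- proportion of n² in every round, and it carries few edges.
--
-- In the bipartite double cover of the reduced graph (every cluster once as a source and once as a sink), a minimal
-- part whose density is at least (1 + 1/2q) k/2 is connected and has at least this minimum degree, where η ≥ 1/q.
-- A cluster used in both roles has twice as many neighbours, because D is oriented; if there is none, the part is
-- bipartite.  In both cases augmentation yields a matching of the covered vertices with more than k/2 pairs.
--
-- The tree is cut into pieces at regularly spaced levels, and the first L levels of every piece are called
-- transitional; averaging over the offset, they form a small proportion of the tree.  As the degrees are
-- polylogarithmic the pieces are small, and they can be packed, with sources and sinks in balance, into the pairs of
-- clusters met by the matching.  The transitional levels walk through the connected part, inside a reserve set aside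
-- in every cluster, to the pair assigned to their piece, and the tree is embedded greedily piece by piece.
module Submission where

open import Defs
open import Data.Nat using (ℕ; suc; _≤_; _^_)
open import Data.Nat.Logarithm using (⌈log₂_⌉)
open import Data.Product using (Σ-syntax; _×_)

-- A greedy embedding must keep room for children that are placed later. One-sided regularity only
-- yields a vertex of large degree into one given set, so the image of `v` is chosen with respect to
-- a single target, which may shrink only a little before the children of `v` are placed. Hence all
-- children of a vertex go to one cluster and to one kind of room. Transitional children use the
-- reserve, which all transitional vertices together cannot exhaust; other children use what was
-- free when their piece was begun, and only this small piece takes from it.
--
-- Every step of a walk changes the role together with the cluster, so in the double cover the
-- parity of walks takes care of itself.
--
-- The matching lives in the blow-up of the reduced graph. It tells how much of each pair of
-- clusters to fill; its pairs need not be edges of `D`.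
--
-- The constants depend on each other in this order: `q`; `w = 8q` (the bins leave `1/w` of a
-- cluster, half of which is reserved); `G = 12q²` (density `1/G`); `ρ = 4w`; `E = 2ρG` (size `1/E`
-- of the subsets); the bound `M` on the number of clusters; the period `h + 1` of the levels; `n₀`.

module BalancedTrees where

  open import Data.Nat
  open import Data.Nat.Properties
  open import Data.Nat.DivMod using (m/n*n≤m; m≡m%n+[m/n]*n; m%n<n; m≥n⇒m/n>0; _/_)
  open import Data.Nat.Induction using (<-wellFounded)
  open import Data.Nat.Logarithm using (⌈log₂⌉-mono-≤; ⌈log₂2^n⌉≡n)
  open import Data.Nat.Tactic.RingSolver using (solve-∀)
  open import Induction.WellFounded using (Acc; acc)
  open import Data.Bool using (Bool; true; false; _∧_; _∨_; not; if_then_else_)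
  import Data.Bool.Properties as Bool
  open import Data.Bool.ListAction using (any)
  open import Data.Fin using (Fin; zero; suc; _↑ˡ_; _↑ʳ_; splitAt; combine; remQuot; funToFin; finToFun)
  import Data.Fin.Properties as Fin
  open import Data.Fin.Subset.Properties using (anySubset?)
  open import Data.List using (List; []; _∷_; length; filter; tabulate; map; concatMap)
  open import Data.List.Properties using (length-++; filter-++)
  open import Data.List.Relation.Unary.All using (All; []; _∷_)
  open import Data.Vec using (lookup) renaming (tabulate to tabulateᵛ)
  open import Data.Vec.Properties using (lookup∘tabulate)
  open import Data.Product using (∃; ∃₂; _,_; proj₁; proj₂)
  import Data.Sum
  open import Data.Sum using (_⊎_; inj₁; inj₂; [_,_]′)
  open import Data.Empty using (⊥; ⊥-elim)
  open import Relation.Nullary using (¬_; Dec; yes; no; does)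
  open import Relation.Nullary.Decidable using (_×-dec_; _→-dec_; _⊎-dec_)
  open import Relation.Binary.PropositionalEquality
  open import Function using (_∘_; id)

  -- Finite sums and cardinalities

  ⟦_⟧ : Bool → ℕ
  ⟦ true ⟧ = 1
  ⟦ false ⟧ = 0

  ⟦⟧≤1 : ∀ b → ⟦ b ⟧ ≤ 1
  ⟦⟧≤1 true = ≤-refl
  ⟦⟧≤1 false = z≤n

  ⟦∧⟧ : ∀ a b → ⟦ a ∧ b ⟧ ≡ ⟦ a ⟧ * ⟦ b ⟧
  ⟦∧⟧ true b = sym (+-identityʳ _)
  ⟦∧⟧ false b = refl

  ⟦not⟧ : ∀ b → ⟦ b ⟧ + ⟦ not b ⟧ ≡ 1
  ⟦not⟧ true = refl
  ⟦not⟧ false = refl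

  ⟦⟧-mono : ∀ {a b} → (a ≡ true → b ≡ true) → ⟦ a ⟧ ≤ ⟦ b ⟧
  ⟦⟧-mono {true} h rewrite h refl = ≤-refl
  ⟦⟧-mono {false} h = z≤n

  true≢false : ∀ {b} → b ≡ true → b ≡ false → ⊥
  true≢false refl ()

  ¬true⇒false : ∀ {b} → ¬ (b ≡ true) → b ≡ false
  ¬true⇒false {true} h = ⊥-elim (h refl)
  ¬true⇒false {false} h = refl

  ∧-elim : ∀ {a b} → a ∧ b ≡ true → a ≡ true × b ≡ true
  ∧-elim {true} {true} _ = refl , refl

  ∧-intro : ∀ {a b} → a ≡ true → b ≡ true → a ∧ b ≡ true
  ∧-intro refl refl = refl

  ∨-elim : ∀ {a b} → a ∨ b ≡ true → a ≡ true ⊎ b ≡ true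
  ∨-elim {true} _ = inj₁ refl
  ∨-elim {false} h = inj₂ h

  not-elim : ∀ {a} → not a ≡ true → a ≡ false
  not-elim {false} _ = refl

  Dec⇒true : ∀ {p} {P : Set p} (d : Dec P) → P → does d ≡ true
  Dec⇒true (yes _) _ = refl
  Dec⇒true (no ¬p) p = ⊥-elim (¬p p)

  true⇒Dec : ∀ {p} {P : Set p} (d : Dec P) → does d ≡ true → P
  true⇒Dec (yes p) _ = p

  false⇒Dec : ∀ {p} {P : Set p} (d : Dec P) → does d ≡ false → ¬ P
  false⇒Dec (no ¬p) _ = ¬p

  opaque
    ∑ : ∀ {n} → (Fin n → ℕ) → ℕ
    ∑ {zero} f = 0
    ∑ {suc n} f = f zero + ∑ (λ i → f (suc i))

    ∑-empty : (f : Fin 0 → ℕ) → ∑ f ≡ 0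
    ∑-empty f = refl

    ∑-suc : ∀ {n} (f : Fin (suc n) → ℕ) → ∑ f ≡ f zero + ∑ (f ∘ suc)
    ∑-suc f = refl

    ∑-cong : ∀ {n} {f g : Fin n → ℕ} → (∀ i → f i ≡ g i) → ∑ f ≡ ∑ g
    ∑-cong {zero} h = refl
    ∑-cong {suc n} h = cong₂ _+_ (h zero) (∑-cong (λ i → h (suc i)))

    ∑-distrib-+ : ∀ {n} (f g : Fin n → ℕ) → ∑ (λ i → f i + g i) ≡ ∑ f + ∑ g
    ∑-distrib-+ {zero} f g = refl
    ∑-distrib-+ {suc n} f g =
      trans (cong (f zero + g zero +_) (∑-distrib-+ (f ∘ suc) (g ∘ suc)))
            (interchange (f zero) (g zero) _ _)
      where
      interchange : ∀ a b c d → a + b + (c + d) ≡ a + c + (b + d)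
      interchange = solve-∀

    ∑-const : ∀ n c → ∑ {n} (λ _ → c) ≡ n * c
    ∑-const zero c = refl
    ∑-const (suc n) c = cong (c +_) (∑-const n c)

    ∑-*ˡ : ∀ {n} c (f : Fin n → ℕ) → ∑ (λ i → c * f i) ≡ c * ∑ f
    ∑-*ˡ {zero} c f = sym (*-zeroʳ c)
    ∑-*ˡ {suc n} c f = trans (cong (c * f zero +_) (∑-*ˡ c (f ∘ suc))) (sym (*-distribˡ-+ c (f zero) _))

    ∑-mono : ∀ {n} {f g : Fin n → ℕ} → (∀ i → f i ≤ g i) → ∑ f ≤ ∑ g
    ∑-mono {zero} h = z≤n
    ∑-mono {suc n} h = +-mono-≤ (h zero) (∑-mono (h ∘ suc))

    ∑-mono-< : ∀ {n} {f g : Fin n → ℕ} → (∀ i → f i ≤ g i) → ∀ j → f j < g j → ∑ f < ∑ g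
    ∑-mono-< {suc n} h zero lt = +-mono-<-≤ lt (∑-mono (h ∘ suc))
    ∑-mono-< {suc n} h (suc j) lt = +-mono-≤-< (h zero) (∑-mono-< (h ∘ suc) j lt)

    ∑-term : ∀ {n} (f : Fin n → ℕ) i → f i ≤ ∑ f
    ∑-term f zero = m≤m+n _ _
    ∑-term f (suc i) = ≤-trans (∑-term (f ∘ suc) i) (m≤n+m _ _)

    ∑-↑ : ∀ m {n} (f : Fin (m + n) → ℕ) → ∑ f ≡ ∑ (λ i → f (i ↑ˡ n)) + ∑ (λ j → f (m ↑ʳ j))
    ∑-↑ zero f = refl
    ∑-↑ (suc m) f = trans (cong (f zero +_) (∑-↑ m (f ∘ suc))) (sym (+-assoc (f zero) _ _))

  ∑-zero : ∀ {n} {f : Fin n → ℕ} → (∀ i → f i ≡ 0) → ∑ f ≡ 0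
  ∑-zero {n} h = trans (∑-cong h) (trans (∑-const n 0) (*-zeroʳ n))

  ∑-comm : ∀ {m n} (f : Fin m → Fin n → ℕ) → ∑ (λ i → ∑ (f i)) ≡ ∑ (λ j → ∑ (λ i → f i j))
  ∑-comm {zero} f = trans (∑-empty _) (sym (∑-zero (λ _ → ∑-empty _)))
  ∑-comm {suc m} f = trans (∑-suc _) (trans (cong (∑ (f zero) +_) (∑-comm (f ∘ suc)))
    (trans (sym (∑-distrib-+ (f zero) _)) (∑-cong (λ j → sym (∑-suc (λ i → f i j))))))

  ∑-*ʳ : ∀ {n} (f : Fin n → ℕ) c → ∑ (λ i → f i * c) ≡ ∑ f * c
  ∑-*ʳ f c = trans (∑-cong (λ i → *-comm (f i) c)) (trans (∑-*ˡ c f) (*-comm c (∑ f)))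

  ∑-≤⇒≡ : ∀ {n} {f g : Fin n → ℕ} → (∀ i → f i ≤ g i) → ∑ g ≤ ∑ f → ∀ j → f j ≡ g j
  ∑-≤⇒≡ {f = f} {g} h le j with f j <? g j
  ... | yes lt = ⊥-elim (<⇒≱ (∑-mono-< h j lt) le)
  ... | no ¬lt = ≤-antisym (h j) (≮⇒≥ ¬lt)

  ∑-find : ∀ {n} {f g : Fin n → ℕ} → ∑ f < ∑ g → ∃ λ i → f i < g i
  ∑-find {n} {f} {g} lt with Fin.any? (λ i → f i <? g i)
  ... | yes p = p
  ... | no ¬p = ⊥-elim (<⇒≱ lt (∑-mono λ i → ≮⇒≥ (λ l → ¬p (i , l))))

  _==_ : ∀ {n} → Fin n → Fin n → Bool
  i == j = does (i Fin.≟ j)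

  ==-refl : ∀ {n} (i : Fin n) → (i == i) ≡ true
  ==-refl i = Dec⇒true (i Fin.≟ i) refl

  ==⇒≡ : ∀ {n} {i j : Fin n} → (i == j) ≡ true → i ≡ j
  ==⇒≡ {i = i} {j} = true⇒Dec (i Fin.≟ j)

  ≢⇒== : ∀ {n} {i j : Fin n} → i ≢ j → (i == j) ≡ false
  ≢⇒== {i = i} {j} h = ¬true⇒false (h ∘ ==⇒≡)

  ==⇒≢ : ∀ {n} {i j : Fin n} → (i == j) ≡ false → i ≢ j
  ==⇒≢ {i = i} {j} = false⇒Dec (i Fin.≟ j)

  ==-sym : ∀ {n} (i j : Fin n) → (i == j) ≡ (j == i)
  ==-sym i j with i Fin.≟ j
  ... | yes refl = sym (==-refl i)
  ... | no ne = sym (≢⇒== (ne ∘ sym))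

  suc-== : ∀ {n} (i j : Fin n) → (suc i == suc j) ≡ (i == j)
  suc-== i j with i Fin.≟ j
  ... | yes refl = refl
  ... | no _ = refl

  ∑-δ : ∀ {n} (i : Fin n) (f : Fin n → ℕ) → ∑ (λ j → ⟦ i == j ⟧ * f j) ≡ f i
  ∑-δ {suc n} zero f = trans (∑-suc _) (trans (cong₂ _+_ (+-identityʳ (f zero)) (∑-zero (λ _ → refl))) (+-identityʳ _))
  ∑-δ {suc n} (suc i) f = trans (∑-suc _) (trans (∑-cong (λ j → cong (λ b → ⟦ b ⟧ * f (suc j)) (suc-== i j))) (∑-δ i (f ∘ suc)))

  ∑-δ1 : ∀ {n} (i : Fin n) → ∑ (λ j → ⟦ i == j ⟧) ≡ 1
  ∑-δ1 i = trans (∑-cong (λ j → sym (*-identityʳ _))) (∑-δ i (λ _ → 1))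

  card : ∀ {n} → (Fin n → Bool) → ℕ
  card p = ∑ (λ v → ⟦ p v ⟧)

  card-mono : ∀ {n} {p q : Fin n → Bool} → (∀ v → p v ≡ true → q v ≡ true) → card p ≤ card q
  card-mono h = ∑-mono (λ v → ⟦⟧-mono (h v))

  card-cong : ∀ {n} {p q : Fin n → Bool} → p ≗ q → card p ≡ card q
  card-cong h = ∑-cong (λ v → cong ⟦_⟧ (h v))

  card≤n : ∀ {n} (p : Fin n → Bool) → card p ≤ n
  card≤n {n} p = ≤-trans (∑-mono (λ v → ⟦⟧≤1 (p v))) (≤-reflexive (trans (∑-const n 1) (*-identityʳ n)))

  card-∖ : ∀ {n} (p q : Fin n → Bool) → card p ≤ card (λ v → p v ∧ not (q v)) + card (λ v → p v ∧ q v)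
  card-∖ p q = ≤-trans (∑-mono (λ v → aux (p v) (q v))) (≤-reflexive (∑-distrib-+ _ _))
    where
    aux : ∀ a b → ⟦ a ⟧ ≤ ⟦ a ∧ not b ⟧ + ⟦ a ∧ b ⟧
    aux true true = ≤-refl
    aux true false = ≤-refl
    aux false _ = z≤n

  card>0 : ∀ {n} {p : Fin n → Bool} → 0 < card p → ∃ λ v → p v ≡ true
  card>0 {n} {p} lt with ∑-find {f = λ _ → 0} {g = λ v → ⟦ p v ⟧} (subst (_< card p) (sym (∑-zero {n} (λ _ → refl))) lt)
  ... | v , h = v , aux (p v) h
    where
    aux : ∀ b → 0 < ⟦ b ⟧ → b ≡ true
    aux true _ = refl

  card-find : ∀ {n} {p q : Fin n → Bool} → card q < card p → ∃ λ v → p v ≡ true × q v ≡ false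
  card-find {p = p} {q} lt with ∑-find lt
  ... | v , h = v , aux (p v) (q v) h
    where
    aux : ∀ a b → ⟦ b ⟧ < ⟦ a ⟧ → a ≡ true × b ≡ false
    aux true false _ = refl , refl
    aux true true (s≤s ())

  card-pos : ∀ {n} {p : Fin n → Bool} v → p v ≡ true → 0 < card p
  card-pos {p = p} v h = ≤-trans (subst (λ b → 1 ≤ ⟦ b ⟧) (sym h) ≤-refl) (∑-term (λ v → ⟦ p v ⟧) v)

  -- Linear arithmetic: X ≤ Y follows from A ≤ B and a semiring identity, with s the slack.
  ≤-by : ∀ {A B X Y : ℕ} s → A ≤ B → X + B + s ≡ Y + A → X ≤ Y
  ≤-by {A} {B} {X} {Y} s h e = +-cancelʳ-≤ B X Y (≤-trans (m≤m+n (X + B) s) (≤-trans (≤-reflexive e) (+-monoʳ-≤ Y h)))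

  infixr 6 _⊕_
  _⊕_ : ∀ {a b c d} → a ≤ b → c ≤ d → a + c ≤ b + d
  _⊕_ = +-mono-≤

  infixr 7 _⊗_
  _⊗_ : ∀ c {a b} → a ≤ b → c * a ≤ c * b
  c ⊗ h = *-monoʳ-≤ c h

  -- One-sided regularity

  _⊆_ : ∀ {n} → (Fin n → Bool) → (Fin n → Bool) → Set
  X ⊆ A = ∀ v → X v ≡ true → A v ≡ true

  edges : ∀ {n} → (Fin n → Fin n → Bool) → (Fin n → Bool) → (Fin n → Bool) → ℕ
  edges D X Y = ∑ (λ u → ∑ (λ v → ⟦ X u ⟧ * ⟦ Y v ⟧ * ⟦ D u v ⟧))

  ∑∑-cong : ∀ {m n} {f g : Fin m → Fin n → ℕ} → (∀ u v → f u v ≡ g u v) → ∑ (λ u → ∑ (f u)) ≡ ∑ (λ u → ∑ (g u))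
  ∑∑-cong h = ∑-cong (λ u → ∑-cong (h u))

  ∑∑-mono : ∀ {m n} {f g : Fin m → Fin n → ℕ} → (∀ u v → f u v ≤ g u v) → ∑ (λ u → ∑ (f u)) ≤ ∑ (λ u → ∑ (g u))
  ∑∑-mono h = ∑-mono (λ u → ∑-mono (h u))

  ∑∑-+ : ∀ {m n} (f g : Fin m → Fin n → ℕ) →
    ∑ (λ u → ∑ (λ v → f u v + g u v)) ≡ ∑ (λ u → ∑ (f u)) + ∑ (λ u → ∑ (g u))
  ∑∑-+ f g = trans (∑-cong (λ u → ∑-distrib-+ (f u) (g u))) (∑-distrib-+ _ _)

  ∑∑-*ˡ : ∀ {m n} c (f : Fin m → Fin n → ℕ) → ∑ (λ u → ∑ (λ v → c * f u v)) ≡ c * ∑ (λ u → ∑ (f u))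
  ∑∑-*ˡ c f = trans (∑-cong (λ u → ∑-*ˡ c (f u))) (∑-*ˡ c _)

  ∑∑-product : ∀ {m n} (f : Fin m → ℕ) (g : Fin n → ℕ) → ∑ (λ u → ∑ (λ v → f u * g v)) ≡ ∑ f * ∑ g
  ∑∑-product f g = trans (∑-cong (λ u → ∑-*ˡ (f u) g)) (∑-*ʳ f (∑ g))

  ∑∑-zero : ∀ {m n} {f : Fin m → Fin n → ℕ} → (∀ u v → f u v ≡ 0) → ∑ (λ u → ∑ (f u)) ≡ 0
  ∑∑-zero h = ∑-zero (λ u → ∑-zero (h u))

  ∑∑≤n² : ∀ {n} (f : Fin n → Fin n → Bool) → ∑ (λ u → ∑ (λ v → ⟦ f u v ⟧)) ≤ n * n
  ∑∑≤n² {n} f = ≤-trans (∑-mono (λ u → card≤n (f u))) (≤-reflexive (∑-const n n))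

  -- Inserting `∑-δ` in both coordinates sorts pairs of vertices by their clusters, so that global
  -- counts can be estimated cell by cell.
  ∑∑-cells : ∀ {n m} (c : Fin n → Fin m) (F : Fin m → Fin m → Fin n → Fin n → ℕ) →
    ∑ (λ u → ∑ (λ v → F (c u) (c v) u v)) ≡
    ∑ (λ i → ∑ (λ j → ∑ (λ u → ∑ (λ v → ⟦ c u == i ⟧ * (⟦ c v == j ⟧ * F i j u v)))))
  ∑∑-cells c F = begin
    ∑ (λ u → ∑ (λ v → F (c u) (c v) u v))
      ≡⟨ ∑∑-cong (λ u v → trans (sym (∑-δ (c v) (λ j → F (c u) j u v)))
           (sym (∑-δ (c u) (λ i → ∑ (λ j → ⟦ c v == j ⟧ * F i j u v))))) ⟩
    ∑ (λ u → ∑ (λ v → ∑ (λ i → ⟦ c u == i ⟧ * ∑ (λ j → ⟦ c v == j ⟧ * F i j u v))))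
      ≡⟨ ∑∑-cong (λ u v → ∑-cong (λ i → sym (∑-*ˡ ⟦ c u == i ⟧ (λ j → ⟦ c v == j ⟧ * F i j u v)))) ⟩
    ∑ (λ u → ∑ (λ v → ∑ (λ i → ∑ (λ j → H i j u v))))
      ≡⟨ ∑-cong (λ u → ∑-comm (λ v i → ∑ (λ j → H i j u v))) ⟩
    ∑ (λ u → ∑ (λ i → ∑ (λ v → ∑ (λ j → H i j u v))))
      ≡⟨ ∑-comm (λ u i → ∑ (λ v → ∑ (λ j → H i j u v))) ⟩
    ∑ (λ i → ∑ (λ u → ∑ (λ v → ∑ (λ j → H i j u v))))
      ≡⟨ ∑∑-cong (λ i u → ∑-comm (λ v j → H i j u v)) ⟩
    ∑ (λ i → ∑ (λ u → ∑ (λ j → ∑ (λ v → H i j u v))))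
      ≡⟨ ∑-cong (λ i → ∑-comm (λ u j → ∑ (λ v → H i j u v))) ⟩
    ∑ (λ i → ∑ (λ j → ∑ (λ u → ∑ (λ v → H i j u v)))) ∎
    where
    open ≡-Reasoning
    H : _ → _ → _ → _ → ℕ
    H i j u v = ⟦ c u == i ⟧ * (⟦ c v == j ⟧ * F i j u v)

  -- A vertex remembers its cluster and, for every cluster, whether it lies in the left and in the
  -- right side of the sparse rectangle found there: one factor `2 ^ m` for each side.
  refineSize : ℕ → ℕ
  refineSize m = m * (2 ^ m * 2 ^ m)

  refineIter : ℕ → ℕ → ℕ
  refineIter zero m = m
  refineIter (suc t) m = refineIter t (refineSize m)

  1≤2^ : ∀ m → 1 ≤ 2 ^ m
  1≤2^ m = m^n>0 2 m

  m≤refineSize : ∀ m → m ≤ refineSize m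
  m≤refineSize m = ≤-trans (≤-reflexive (sym (*-identityʳ m))) (*-monoʳ-≤ m (*-mono-≤ (1≤2^ m) (1≤2^ m)))

  m≤refineIter : ∀ t m → m ≤ refineIter t m
  m≤refineIter zero m = ≤-refl
  m≤refineIter (suc t) m = ≤-trans (m≤refineSize m) (m≤refineIter t (refineSize m))

  -- Every unsuccessful round declares more than `n²/(E²G)` new pairs of vertices sparse, so
  -- `E²G + 1` rounds starting from a single cluster cannot all be unsuccessful.
  clusterBound : ℕ → ℕ → ℕ
  clusterBound E G = refineIter (suc (E * E * G)) 1

  module Regularity {n} (D : Fin n → Fin n → Bool) (E G : ℕ) where

    Sparse : (A B X Y : Fin n → Bool) → Set
    Sparse A B X Y = X ⊆ A × Y ⊆ B × card A ≤ E * card X × card B ≤ E * card Y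
      × G * edges D X Y < card X * card Y

    Regular : (A B : Fin n → Bool) → Set
    Regular A B = ∀ X Y → X ⊆ A → Y ⊆ B → card A ≤ E * card X → card B ≤ E * card Y →
      card X * card Y ≤ G * edges D X Y

    ⊆? : (X A : Fin n → Bool) → Dec (X ⊆ A)
    ⊆? X A = Fin.all? (λ v → (X v Bool.≟ true) →-dec (A v Bool.≟ true))

    Sparse? : ∀ A B X Y → Dec (Sparse A B X Y)
    Sparse? A B X Y = ⊆? X A ×-dec ⊆? Y B ×-dec (_ ≤? _) ×-dec (_ ≤? _) ×-dec (_ <? _)

    -- A search through all pairs of subsets. `anySubset?` ranges over vectors, hence the passage
    -- through `lookup` and `tabulate`.
    sparse-or-regular : ∀ A B → (∃₂ λ X Y → Sparse A B X Y) ⊎ Regular A B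
    sparse-or-regular A B
      with anySubset? (λ s → anySubset? (λ t → Sparse? A B (lookup s) (lookup t)))
    ... | yes (s , t , h) = inj₁ (lookup s , lookup t , h)
    ... | no ¬h = inj₂ λ X Y X⊆ Y⊆ AX BY → ≮⇒≥ λ lt → ¬h (tabulateᵛ X , tabulateᵛ Y ,
        (λ v e → X⊆ v (trans (sym (lookup∘tabulate X v)) e)) ,
        (λ v e → Y⊆ v (trans (sym (lookup∘tabulate Y v)) e)) ,
        subst (λ z → card A ≤ E * z) (card-cong (λ v → sym (lookup∘tabulate X v))) AX ,
        subst (λ z → card B ≤ E * z) (card-cong (λ v → sym (lookup∘tabulate Y v))) BY ,
        subst₂ _<_
          (cong (G *_) (∑∑-cong (λ u v → cong₂ (λ a b → ⟦ a ⟧ * ⟦ b ⟧ * ⟦ D u v ⟧)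
            (sym (lookup∘tabulate X u)) (sym (lookup∘tabulate Y v)))))
          (cong₂ _*_ (card-cong (λ v → sym (lookup∘tabulate X v))) (card-cong (λ v → sym (lookup∘tabulate Y v))))
          lt)

    record Partition (M : ℕ) : Set where
      field
        m : ℕ
        m≤M : m ≤ M
        c : Fin n → Fin m
        R : Fin m → Fin m → Bool
        regular : ∀ i j → R i j ≡ true → Regular (λ v → c v == i) (λ v → c v == j)
        lost : G * ∑ (λ u → ∑ (λ v → ⟦ not (R (c u) (c v)) ⟧ * ⟦ D u v ⟧)) ≤ 2 * (n * n)

    bits : ∀ {m} → (Fin m → Bool) → Fin (2 ^ m)
    bits f = funToFin (λ j → if f j then suc zero else zero)

    unbits : ∀ {m} → Fin (2 ^ m) → Fin m → Bool
    unbits k j = finToFun k j == suc zero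

    unbits-bits : ∀ {m} (f : Fin m → Bool) j → unbits (bits f) j ≡ f j
    unbits-bits f j = trans (cong (_== suc zero) (Fin.finToFun-funToFin _ j)) (aux (f j))
      where
      aux : ∀ b → ((if b then suc zero else zero) == suc {1} zero) ≡ b
      aux true = refl
      aux false = refl

    -- `Z` marks the pairs of clusters declared so far. They are never searched again, so the new
    -- rectangles lie outside the old region and sizes simply add.
    module Round {m} (c : Fin n → Fin m) (Z : Fin m → Fin m → Bool) where

      V : Fin m → Fin n → Bool
      V i v = c v == i

      bad : Fin m → Fin m → Bool
      bad i j = not (Z i j) ∧ [ (λ _ → true) , (λ _ → false) ]′ (sparse-or-regular (V i) (V j))

      X Y : Fin m → Fin m → Fin n → Bool
      X i j = [ proj₁ , (λ _ _ → false) ]′ (sparse-or-regular (V i) (V j))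
      Y i j = [ proj₁ ∘ proj₂ , (λ _ _ → false) ]′ (sparse-or-regular (V i) (V j))

      bad⇒Sparse : ∀ i j → bad i j ≡ true → Sparse (V i) (V j) (X i j) (Y i j)
      bad⇒Sparse i j h with sparse-or-regular (V i) (V j)
      ... | inj₁ (_ , _ , s) = s
      ... | inj₂ r = ⊥-elim (true≢false (proj₂ (∧-elim {not (Z i j)} h)) refl)

      good⇒Regular : ∀ i j → not (Z i j) ∧ not (bad i j) ≡ true → Regular (V i) (V j)
      good⇒Regular i j h with Z i j | sparse-or-regular (V i) (V j)
      ... | false | inj₂ r = r

      -- The rectangles declared in this round, as a relation between vertices: they cut through the
      -- cells of `c` and become unions of cells only for `c′`.
      N : Fin n → Fin n → Bool
      N u v = bad (c u) (c v) ∧ (X (c u) (c v) u ∧ Y (c u) (c v) v)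

      |Z| eZ |N| eN badMass : ℕ
      |Z| = ∑ (λ u → ∑ (λ v → ⟦ Z (c u) (c v) ⟧))
      eZ = ∑ (λ u → ∑ (λ v → ⟦ Z (c u) (c v) ⟧ * ⟦ D u v ⟧))
      |N| = ∑ (λ u → ∑ (λ v → ⟦ N u v ⟧))
      eN = ∑ (λ u → ∑ (λ v → ⟦ N u v ⟧ * ⟦ D u v ⟧))
      badMass = ∑ (λ u → ∑ (λ v → ⟦ bad (c u) (c v) ⟧))

      private
        cell : ∀ i j (f : Bool → Bool → Bool → ℕ → ℕ) → ℕ
        cell i j f = ∑ (λ u → ∑ (λ v → ⟦ V i u ⟧ * (⟦ V j v ⟧ * f (bad i j) (X i j u) (Y i j v) ⟦ D u v ⟧)))

        absorb : ∀ a b x y d → (x ≡ true → a ≡ true) → (y ≡ true → b ≡ true) →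
          ⟦ a ⟧ * (⟦ b ⟧ * (⟦ true ∧ (x ∧ y) ⟧ * d)) ≡ ⟦ x ⟧ * ⟦ y ⟧ * d
        absorb a b false y d _ _ = trans (cong (⟦ a ⟧ *_) (*-zeroʳ ⟦ b ⟧)) (*-zeroʳ ⟦ a ⟧)
        absorb a b true false d _ _ = trans (cong (⟦ a ⟧ *_) (*-zeroʳ ⟦ b ⟧)) (*-zeroʳ ⟦ a ⟧)
        absorb a b true true d p q rewrite p refl | q refl = trans (+-identityʳ _) (+-identityʳ _)

        vanish : ∀ a b x y → a * (b * (0 * y)) ≡ x * 0
        vanish a b x y = trans (cong (a *_) (*-zeroʳ b)) (trans (*-zeroʳ a) (sym (*-zeroʳ x)))

        cell-edges : ∀ i j → G * cell i j (λ b x y d → ⟦ b ∧ (x ∧ y) ⟧ * d) ≤ cell i j (λ b x y d → ⟦ b ∧ (x ∧ y) ⟧ * 1)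
        cell-edges i j with bad i j in eq
        ... | false = ≤-trans (≤-reflexive (trans (cong (G *_) (∑∑-zero (λ u v → vanish ⟦ V i u ⟧ ⟦ V j v ⟧ 0 ⟦ D u v ⟧))) (*-zeroʳ G))) z≤n
        ... | true with bad⇒Sparse i j eq
        ...   | X⊆ , Y⊆ , _ , _ , lt = ≤-trans (≤-reflexive (cong (G *_) (∑∑-cong (λ u v →
                  absorb (V i u) (V j v) (X i j u) (Y i j v) ⟦ D u v ⟧ (X⊆ u) (Y⊆ v)))))
                (≤-trans (<⇒≤ lt) (≤-reflexive (trans (sym (∑∑-product _ _)) (∑∑-cong (λ u v →
                  trans (sym (*-identityʳ _)) (sym (absorb (V i u) (V j v) (X i j u) (Y i j v) 1 (X⊆ u) (Y⊆ v))))))))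

        cell-mass : ∀ i j → cell i j (λ b _ _ _ → ⟦ b ⟧) ≤ E * E * cell i j (λ b x y d → ⟦ b ∧ (x ∧ y) ⟧ * 1)
        cell-mass i j with bad i j in eq
        ... | false = ≤-trans (≤-reflexive (∑∑-zero (λ u v → trans (cong (⟦ V i u ⟧ *_) (*-zeroʳ ⟦ V j v ⟧)) (*-zeroʳ ⟦ V i u ⟧)))) z≤n
        ... | true with bad⇒Sparse i j eq
        ...   | X⊆ , Y⊆ , ax , by , _ = ≤-trans
                (≤-reflexive (trans (∑∑-cong (λ u v → cong (⟦ V i u ⟧ *_) (*-identityʳ ⟦ V j v ⟧))) (∑∑-product _ _)))
                (≤-trans (*-mono-≤ ax by) (≤-reflexive (trans (rearr E (card (X i j)) (card (Y i j))) (cong (E * E *_)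
                  (trans (sym (∑∑-product _ _)) (∑∑-cong (λ u v →
                  trans (sym (*-identityʳ _)) (sym (absorb (V i u) (V j v) (X i j u) (Y i j v) 1 (X⊆ u) (Y⊆ v)))))))))) 
          where
          rearr : ∀ e x y → e * x * (e * y) ≡ e * e * (x * y)
          rearr = solve-∀

        |N|-cells : |N| ≡ ∑ (λ i → ∑ (λ j → cell i j (λ b x y d → ⟦ b ∧ (x ∧ y) ⟧ * 1)))
        |N|-cells = trans (∑∑-cong (λ u v → sym (*-identityʳ _)))
          (∑∑-cells c (λ i j u v → ⟦ bad i j ∧ (X i j u ∧ Y i j v) ⟧ * 1))

      eN≤|N| : G * eN ≤ |N|
      eN≤|N| = ≤-trans (≤-reflexive (trans (cong (G *_) (∑∑-cells c (λ i j u v → ⟦ bad i j ∧ (X i j u ∧ Y i j v) ⟧ * ⟦ D u v ⟧)))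
          (sym (∑∑-*ˡ G _))))
        (≤-trans (∑∑-mono cell-edges) (≤-reflexive (sym |N|-cells)))

      -- Each side of a sparse rectangle takes at least `1/E` of its cluster.
      badMass≤ : badMass ≤ E * E * |N|
      badMass≤ = ≤-trans (≤-reflexive (∑∑-cells c (λ i j u v → ⟦ bad i j ⟧)))
        (≤-trans (∑∑-mono cell-mass) (≤-reflexive (trans (∑∑-*ˡ (E * E) _) (cong (E * E *_) (sym |N|-cells)))))

      c′ : Fin n → Fin (refineSize m)
      c′ v = combine (c v) (combine (bits (λ j → X (c v) j v)) (bits (λ i → Y i (c v) v)))

      old : Fin (refineSize m) → Fin m
      old i = proj₁ (remQuot {m} (2 ^ m * 2 ^ m) i)

      xs ys : Fin (refineSize m) → Fin m → Bool
      xs i = unbits (proj₁ (remQuot {2 ^ m} (2 ^ m) (proj₂ (remQuot {m} (2 ^ m * 2 ^ m) i))))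
      ys i = unbits (proj₂ (remQuot {2 ^ m} (2 ^ m) (proj₂ (remQuot {m} (2 ^ m * 2 ^ m) i))))

      old-c′ : ∀ v → old (c′ v) ≡ c v
      old-c′ v = cong proj₁ (Fin.remQuot-combine {m} {2 ^ m * 2 ^ m} (c v) _)

      xs-c′ : ∀ v j → xs (c′ v) j ≡ X (c v) j v
      xs-c′ v j = trans (cong (λ p → unbits (proj₁ (remQuot {2 ^ m} (2 ^ m) (proj₂ p))) j) (Fin.remQuot-combine {m} {2 ^ m * 2 ^ m} (c v) _))
        (trans (cong (λ p → unbits (proj₁ p) j) (Fin.remQuot-combine {2 ^ m} {2 ^ m} (bits (λ j → X (c v) j v)) _))
          (unbits-bits (λ j → X (c v) j v) j))

      ys-c′ : ∀ v j → ys (c′ v) j ≡ Y j (c v) v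
      ys-c′ v j = trans (cong (λ p → unbits (proj₂ (remQuot {2 ^ m} (2 ^ m) (proj₂ p))) j) (Fin.remQuot-combine {m} {2 ^ m * 2 ^ m} (c v) _))
        (trans (cong (λ p → unbits (proj₂ p) j) (Fin.remQuot-combine {2 ^ m} {2 ^ m} (bits (λ j → X (c v) j v)) _))
          (unbits-bits (λ i → Y i (c v) v) j))

      Z′ : Fin (refineSize m) → Fin (refineSize m) → Bool
      Z′ i j = Z (old i) (old j) ∨ (bad (old i) (old j) ∧ (xs i (old j) ∧ ys j (old i)))

      Z′-c′ : ∀ u v → Z′ (c′ u) (c′ v) ≡ Z (c u) (c v) ∨ N u v
      Z′-c′ u v = trans
        (cong₂ (λ x y → Z (old (c′ u)) (old (c′ v)) ∨ (bad (old (c′ u)) (old (c′ v)) ∧ (x ∧ y)))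
          (trans (cong (xs (c′ u)) (old-c′ v)) (xs-c′ u (c v)))
          (trans (cong (ys (c′ v)) (old-c′ u)) (ys-c′ v (c u))))
        (cong₂ (λ i j → Z i j ∨ (bad i j ∧ (X (c u) (c v) u ∧ Y (c u) (c v) v))) (old-c′ u) (old-c′ v))

      ⟦Z′⟧ : ∀ u v → ⟦ Z′ (c′ u) (c′ v) ⟧ ≡ ⟦ Z (c u) (c v) ⟧ + ⟦ N u v ⟧
      ⟦Z′⟧ u v = trans (cong ⟦_⟧ (Z′-c′ u v)) (disjoint (Z (c u) (c v)) _ _)
        where
        disjoint : ∀ z s w → ⟦ z ∨ ((not z ∧ s) ∧ w) ⟧ ≡ ⟦ z ⟧ + ⟦ (not z ∧ s) ∧ w ⟧
        disjoint true s w = refl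
        disjoint false s w = refl

      |Z′|≡ : ∑ (λ u → ∑ (λ v → ⟦ Z′ (c′ u) (c′ v) ⟧)) ≡ |Z| + |N|
      |Z′|≡ = trans (∑∑-cong ⟦Z′⟧) (∑∑-+ _ _)

      eZ′≡ : ∑ (λ u → ∑ (λ v → ⟦ Z′ (c′ u) (c′ v) ⟧ * ⟦ D u v ⟧)) ≡ eZ + eN
      eZ′≡ = trans (∑∑-cong (λ u v → trans (cong (_* ⟦ D u v ⟧) (⟦Z′⟧ u v)) (*-distribʳ-+ ⟦ D u v ⟧ ⟦ Z (c u) (c v) ⟧ _))) (∑∑-+ _ _)

    open Round

    -- The region Z of cells declared sparse only grows, by a fixed proportion of n² in every round
    -- in which the cells that are neither declared nor regular have substantial total size.
    regularise : ∀ t s → t + s ≡ suc (E * E * G) → 0 < n →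
      ∀ {m} (c : Fin n → Fin m) (Z : Fin m → Fin m → Bool) →
      G * eZ c Z ≤ |Z| c Z → s * (n * n) ≤ E * E * G * |Z| c Z → Partition (refineIter t m)
    regularise zero s eq n>0 c Z sparse grow = ⊥-elim (<⇒≱ (*-monoˡ-< (n * n) {{>-nonZero (*-mono-≤ n>0 n>0)}} {E * E * G} {suc (E * E * G)} ≤-refl)
      (≤-trans (≤-reflexive (cong (_* (n * n)) (sym eq))) (≤-trans grow (*-monoʳ-≤ (E * E * G) (∑∑≤n² (λ u v → Z (c u) (c v)))))))
    regularise (suc t) s eq n>0 {m} c Z sparse grow with G * badMass c Z ≤? n * n
    ... | no big = regularise t (suc s) (trans (+-suc t s) eq) n>0 (c′ c Z) (Z′ c Z)
        (subst₂ (λ a b → G * a ≤ b) (sym (eZ′≡ c Z)) (sym (|Z′|≡ c Z))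
          (≤-trans (≤-reflexive (*-distribˡ-+ G (eZ c Z) _)) (+-mono-≤ sparse (eN≤|N| c Z))))
        (≤-trans (+-mono-≤ (≤-trans (<⇒≤ (≰⇒> big)) (*-monoʳ-≤ G (badMass≤ c Z))) grow)
          (≤-reflexive (trans (rearr E G (|N| c Z) (|Z| c Z)) (cong (E * E * G *_) (sym (|Z′|≡ c Z))))))
      where
      rearr : ∀ e g x z → g * (e * e * x) + e * e * g * z ≡ e * e * g * (z + x)
      rearr = solve-∀
    ... | yes small = record
      { m = m
      ; m≤M = m≤refineIter (suc t) m
      ; c = c
      ; R = λ i j → not (Z i j) ∧ not (bad c Z i j)
      ; regular = good⇒Regular c Z
      -- The edges in `Z` are few because `Z` is sparse, those in the bad cells because these cells
      -- are small; each kind contributes at most `n²/G`.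
      ; lost = ≤-trans (*-monoʳ-≤ G (≤-trans (∑∑-mono (λ u v → split (Z (c u) (c v)) (bad c Z (c u) (c v)) ⟦ D u v ⟧ (⟦⟧≤1 (D u v))))
            (≤-reflexive (∑∑-+ _ _))))
          (≤-trans (≤-reflexive (*-distribˡ-+ G (eZ c Z) _))
            (≤-trans (+-mono-≤ (≤-trans sparse (∑∑≤n² (λ u v → Z (c u) (c v)))) small)
              (≤-reflexive (cong (n * n +_) (sym (+-identityʳ _))))))
      }
      where
      split : ∀ z b d → d ≤ 1 → ⟦ not (not z ∧ not b) ⟧ * d ≤ ⟦ z ⟧ * d + ⟦ b ⟧
      split true b d _ = m≤m+n _ _
      split false true d h = ≤-trans (≤-reflexive (+-identityʳ d)) h
      split false false d _ = z≤n

    regularity : 0 < n → Partition (clusterBound E G)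
    regularity n>0 = regularise (suc (E * E * G)) 0 (+-identityʳ _) n>0 {1} (λ _ → zero) (λ _ _ → false)
      (≤-trans (≤-reflexive (trans (cong (G *_) (∑∑-zero (λ u v → refl))) (*-zeroʳ G))) z≤n) z≤n

  -- A minimal dense part of a weighted graph, and matchings

  module Core {N} (w : Fin N → ℕ) (e : Fin N → Fin N → ℕ) (e-sym : ∀ a b → e a b ≡ e b a)
    (e-irr : ∀ a → e a a ≡ 0) (e≤w : ∀ a b → e a b ≤ w a * w b) (num den : ℕ) where

    weight inner : (Fin N → Bool) → ℕ
    weight C = ∑ (λ a → ⟦ C a ⟧ * w a)
    inner C = ∑ (λ a → ∑ (λ b → ⟦ C a ⟧ * ⟦ C b ⟧ * e a b))

    -- Positive weight excludes the empty set, for which the density condition is trivial.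
    Good : (Fin N → Bool) → Set
    Good C = 0 < weight C × num * weight C ≤ den * inner C

    Good? : ∀ C → Dec (Good C)
    Good? C = (_ <? _) ×-dec (_ ≤? _)

    Good-cong : ∀ {C C′} → (∀ a → C a ≡ C′ a) → Good C → Good C′
    Good-cong {C} {C′} h (p , q) = subst (0 <_) W p , subst₂ (λ x y → num * x ≤ den * y) W I q
      where
      W : weight C ≡ weight C′
      W = ∑-cong (λ a → cong (λ z → ⟦ z ⟧ * w a) (h a))
      I : inner C ≡ inner C′
      I = ∑∑-cong (λ a b → cong₂ (λ y z → ⟦ y ⟧ * ⟦ z ⟧ * e a b) (h a) (h b))

    Minimal : (Fin N → Bool) → Set
    Minimal C = ∀ C′ → card C′ < card C → ¬ Good C′

    minimal-from : ∀ C → Good C → Acc _<_ (card C) → ∃ λ C′ → Good C′ × Minimal C′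
    minimal-from C good (acc rec)
      with anySubset? (λ s → (card (lookup s) <? card C) ×-dec Good? (lookup s))
    ... | yes (s , lt , g) = minimal-from (lookup s) g (rec lt)
    ... | no ¬h = C , good , λ C′ lt g → ¬h (tabulateᵛ C′ ,
        subst (_< card C) (card-cong (λ v → sym (lookup∘tabulate C′ v))) lt ,
        Good-cong (λ v → sym (lookup∘tabulate C′ v)) g)

    minimal : ∀ C → Good C → ∃ λ C′ → Good C′ × Minimal C′
    minimal C good = minimal-from C good (<-wellFounded _)

    inner≤weight² : ∀ C → inner C ≤ weight C * weight C
    inner≤weight² C = ≤-trans (∑∑-mono (λ a b → ≤-trans (*-monoʳ-≤ (⟦ C a ⟧ * ⟦ C b ⟧) (e≤w a b))
        (≤-reflexive (rearr ⟦ C a ⟧ ⟦ C b ⟧ (w a) (w b))))) (≤-reflexive (∑∑-product _ _))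
      where
      rearr : ∀ a b x y → a * b * (x * y) ≡ a * x * (b * y)
      rearr = solve-∀

    module _ (C : Fin N → Bool) (good : Good C) (min : Minimal C) where

      sparse< : ∀ C′ → card C′ < card C → 0 < weight C′ → den * inner C′ < num * weight C′
      sparse< C′ lt pos = ≰⇒> (λ h → min C′ lt (pos , h))

      -- Sets of weight zero do not compete in `Minimal`, but by `e≤w` they carry no edges.
      sparse≤ : ∀ C′ → card C′ < card C → den * inner C′ ≤ num * weight C′
      sparse≤ C′ lt with weight C′ in eq
      ... | suc _ = subst (λ z → den * inner C′ ≤ num * z) eq (<⇒≤ (sparse< C′ lt (subst (0 <_) (sym eq) (s≤s z≤n))))
      ... | zero = ≤-trans (*-monoʳ-≤ den (≤-trans (inner≤weight² C′) (≤-reflexive (cong₂ _*_ eq eq))))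
                     (≤-trans (≤-reflexive (*-zeroʳ den)) z≤n)

      -- Otherwise deleting `a` would leave a smaller set that is still dense enough. The factor 2
      -- arises because `inner` counts ordered pairs.
      minDegree : ∀ a → C a ≡ true → num * w a ≤ den * (2 * ∑ (λ b → ⟦ C b ⟧ * e a b))
      minDegree a Ca = finish num den (weight C′) (w a) (inner C) (inner C′) deg
          (subst (λ z → num * z ≤ den * inner C) W (proj₂ good)) I (sparse≤ C′ smaller)
        where
        C′ : Fin N → Bool
        C′ b = C b ∧ not (a == b)
        deg : ℕ
        deg = ∑ (λ b → ⟦ C b ⟧ * e a b)
        split : ∀ b → ⟦ C b ⟧ ≡ ⟦ C′ b ⟧ + ⟦ a == b ⟧
        split b with a Fin.≟ b
        ... | yes refl rewrite Ca = refl
        ... | no _ with C b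
        ...   | true = refl
        ...   | false = refl
        smaller : card C′ < card C
        smaller = ≤-reflexive (sym (trans (∑-cong split) (trans (∑-distrib-+ _ _) (trans (cong (card C′ +_) (∑-δ1 a)) (+-comm (card C′) 1)))))
        W : weight C ≡ weight C′ + w a
        W = trans (∑-cong (λ b → trans (cong (_* w b) (split b)) (*-distribʳ-+ (w b) ⟦ C′ b ⟧ _)))
              (trans (∑-distrib-+ _ _) (cong (weight C′ +_) (∑-δ a w)))
        C′≤C : ∀ b → ⟦ C′ b ⟧ ≤ ⟦ C b ⟧
        C′≤C b = ≤-trans (m≤m+n _ _) (≤-reflexive (sym (split b)))
        expand : ∀ p q x y z → (p + x) * (q + y) * z ≡ p * q * z + (x * ((q + y) * z) + y * (p * z))
        expand = solve-∀
        I : inner C ≤ inner C′ + 2 * deg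
        I = ≤-trans (≤-reflexive (trans (∑∑-cong (λ x y → trans (cong₂ (λ s t → s * t * e x y) (split x) (split y))
                (expand ⟦ C′ x ⟧ ⟦ C′ y ⟧ ⟦ a == x ⟧ ⟦ a == y ⟧ (e x y)))) (trans (∑∑-+ _ _) (cong (inner C′ +_) (∑∑-+ _ _)))))
            (+-monoʳ-≤ (inner C′) (≤-trans (+-mono-≤
              (≤-reflexive (trans (∑-cong (λ x → ∑-*ˡ ⟦ a == x ⟧ (λ y → (⟦ C′ y ⟧ + ⟦ a == y ⟧) * e x y)))
                (trans (∑-δ a (λ x → ∑ (λ y → (⟦ C′ y ⟧ + ⟦ a == y ⟧) * e x y))) (∑-cong (λ y → cong (_* e a y) (sym (split y)))))))
              (≤-trans (≤-reflexive (∑-cong (λ x → ∑-δ a (λ y → ⟦ C′ x ⟧ * e x y))))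
                (∑-mono (λ x → *-mono-≤ (C′≤C x) (≤-reflexive (e-sym x a))))))
              (≤-reflexive (cong (deg +_) (sym (+-identityʳ deg))))))
        finish : ∀ num den W′ wa i i′ d → num * (W′ + wa) ≤ den * i → i ≤ i′ + 2 * d → den * i′ ≤ num * W′ → num * wa ≤ den * (2 * d)
        finish num den W′ wa i i′ d h₁ h₂ h₃ = ≤-by 0 (h₁ ⊕ den ⊗ h₂ ⊕ h₃) (ident num den W′ wa i i′ d)
          where
          ident : ∀ num den W′ wa i i′ d →
            num * wa + (den * i + (den * (i′ + 2 * d) + num * W′)) + 0 ≡ den * (2 * d) + (num * (W′ + wa) + (den * i + den * i′))
          ident = solve-∀

      -- Without a crossing edge both weight and `inner` split along `S`. Both parts are sparser
      -- than the threshold by minimality, strictly so for a part of positive weight, and hence so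
      -- would be `C`.
      connected : ∀ S → S ⊆ C → ∀ a → S a ≡ true → ∀ b → C b ≡ true → S b ≡ false →
        ∃₂ λ x y → S x ≡ true × C y ≡ true × S y ≡ false × 0 < e x y
      connected S S⊆C a Sa b Cb Sb
        with Fin.any? (λ x → Fin.any? (λ y → (S x Bool.≟ true) ×-dec (C y Bool.≟ true) ×-dec (S y Bool.≟ false) ×-dec (0 <? e x y)))
      ... | yes h = h
      ... | no ¬h = ⊥-elim contra
        where
        S′ : Fin N → Bool
        S′ x = C x ∧ not (S x)
        split : ∀ x → ⟦ C x ⟧ ≡ ⟦ S x ⟧ + ⟦ S′ x ⟧
        split x with S x in eq | C x in eq′
        ... | true | true = refl
        ... | true | false = ⊥-elim (true≢false (S⊆C x eq) eq′)
        ... | false | true = refl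
        ... | false | false = refl
        W : weight C ≡ weight S + weight S′
        W = trans (∑-cong (λ x → trans (cong (_* w x) (split x)) (*-distribʳ-+ (w x) ⟦ S x ⟧ _))) (∑-distrib-+ _ _)
        cross₀ : ∀ x y → ⟦ S x ⟧ * ⟦ S′ y ⟧ * e x y ≡ 0
        cross₀ x y with S x in eq₁ | C y in eq₂ | S y in eq₃ | e x y in eq₄
        ... | true | true | false | suc _ = ⊥-elim (¬h (x , y , eq₁ , eq₂ , eq₃ , subst (0 <_) (sym eq₄) (s≤s z≤n)))
        ... | true | true | false | zero = refl
        ... | true | true | true | _ = refl
        ... | true | false | _ | _ = refl
        ... | false | _ | _ | _ = refl
        cross₁ : ∀ x y → ⟦ S′ x ⟧ * ⟦ S y ⟧ * e x y ≡ 0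
        cross₁ x y = trans (cong₂ _*_ (*-comm ⟦ S′ x ⟧ ⟦ S y ⟧) (e-sym x y)) (cross₀ y x)
        expand : ∀ p q x y z → (p + x) * (q + y) * z ≡ p * q * z + x * y * z + (p * y * z + x * q * z)
        expand = solve-∀
        I : inner C ≡ inner S + inner S′
        I = trans (∑∑-cong (λ x y → trans (cong₂ (λ s t → s * t * e x y) (split x) (split y))
              (trans (expand ⟦ S x ⟧ ⟦ S y ⟧ ⟦ S′ x ⟧ ⟦ S′ y ⟧ (e x y))
                (trans (cong₂ (λ s t → ⟦ S x ⟧ * ⟦ S y ⟧ * e x y + ⟦ S′ x ⟧ * ⟦ S′ y ⟧ * e x y + (s + t)) (cross₀ x y) (cross₁ x y)) (+-identityʳ _)))))
            (∑∑-+ _ _)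
        S<C : card S < card C
        S<C = ∑-mono-< (λ x → ≤-trans (m≤m+n _ _) (≤-reflexive (sym (split x)))) b
                (subst₂ (λ s t → ⟦ s ⟧ < ⟦ t ⟧) (sym Sb) (sym Cb) ≤-refl)
        S′<C : card S′ < card C
        S′<C = ∑-mono-< (λ x → ≤-trans (m≤n+m _ ⟦ S x ⟧) (≤-reflexive (sym (split x)))) a
                (subst₂ _<_ (sym (cong ⟦_⟧ (trans (cong (λ t → C a ∧ not t) Sa) (Bool.∧-zeroʳ (C a))))) (sym (cong ⟦_⟧ (S⊆C a Sa))) ≤-refl)
        total : num * (weight S + weight S′) ≤ den * (inner S + inner S′)
        total = subst₂ (λ s t → num * s ≤ den * t) W I (proj₂ good)
        total′ : num * weight S + num * weight S′ ≤ den * inner S + den * inner S′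
        total′ = subst₂ _≤_ (*-distribˡ-+ num (weight S) _) (*-distribˡ-+ den (inner S) _) total
        contra : ⊥
        contra with weight S in eq
        ... | suc _ = <⇒≱ (+-mono-<-≤ (sparse< S S<C (subst (0 <_) (sym eq) (s≤s z≤n))) (sparse≤ S′ S′<C)) total′
        ... | zero = <⇒≱ (+-mono-≤-< (sparse≤ S S<C) (sparse< S′ S′<C (subst (0 <_) (trans W (cong (_+ weight S′) eq)) (proj₁ good)))) total′

  sumL : ∀ {A : Set} → (A → ℕ) → List A → ℕ
  sumL f [] = 0
  sumL f (x ∷ xs) = f x + sumL f xs

  sumL-+ : ∀ {A : Set} (f g : A → ℕ) xs → sumL (λ p → f p + g p) xs ≡ sumL f xs + sumL g xs
  sumL-+ f g [] = refl
  sumL-+ f g (p ∷ xs) = trans (cong (f p + g p +_) (sumL-+ f g xs)) (ident (f p) (g p) (sumL f xs) (sumL g xs))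
    where
    ident : ∀ a b c d → a + b + (c + d) ≡ a + c + (b + d)
    ident = solve-∀

  module _ {n} (adj : Fin n → Fin n → Bool) where

    Edge : Fin n × Fin n → Set
    Edge (x , y) = adj x y ≡ true

    covers : Fin n → Fin n × Fin n → ℕ
    covers w (x , y) = ⟦ x == w ⟧ + ⟦ y == w ⟧

    record Matching (d : ℕ) : Set where
      field
        pairs : List (Fin n × Fin n)
        size : length pairs ≡ d
        areEdges : All Edge pairs
        disjoint : ∀ w → sumL (covers w) pairs ≤ 1

    ∑-covers : ∀ (f : Fin n → ℕ) M → ∑ (λ w → f w * sumL (covers w) M) ≡ sumL (λ p → f (proj₁ p) + f (proj₂ p)) M
    ∑-covers f [] = ∑-zero (λ w → *-zeroʳ (f w))
    ∑-covers f ((x , y) ∷ M) = trans (∑-cong (λ w → expand (f w) ⟦ x == w ⟧ ⟦ y == w ⟧ (sumL (covers w) M)))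
      (trans (∑-distrib-+ _ _) (cong₂ _+_ (trans (∑-distrib-+ _ _) (cong₂ _+_ (∑-δ x f) (∑-δ y f))) (∑-covers f M)))
      where
      expand : ∀ f a b c → f * (a + b + c) ≡ a * f + b * f + f * c
      expand = solve-∀

    -- Pigeonhole. That `M` is a rearrangement of `p ∷ M′` is recorded as the equality of all sums
    -- over the two lists.
    extract : ∀ (φ : Fin n × Fin n → ℕ) M → 2 * length M < sumL φ M → All Edge M →
      ∃₂ λ p M′ → 2 < φ p × length M ≡ suc (length M′) × All Edge M′ × (∀ f → sumL f M ≡ f p + sumL f M′)
    extract φ (p ∷ M) lt (h ∷ hs) with 2 <? φ p
    ... | yes gt = p , M , gt , refl , hs , λ f → refl
    ... | no ¬gt with extract φ M rest hs
      where
      rest : 2 * length M < sumL φ M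
      rest = +-cancelˡ-< 2 _ _ (<-≤-trans (≤-trans (s≤s (≤-reflexive (ident (length M)))) lt) (+-monoˡ-≤ (sumL φ M) (≮⇒≥ ¬gt)))
        where
        ident : ∀ l → 2 + 2 * l ≡ 2 * suc l
        ident = solve-∀
    ...   | q , M′ , gt , len , es , sums = q , p ∷ M′ , gt , cong suc len , h ∷ es , λ f → trans (cong (f p +_) (sums f)) (swap (f p) (f q) (sumL f M′))
      where
      swap : ∀ a b c → a + (b + c) ≡ b + (a + c)
      swap = solve-∀

    module _ (irr : ∀ u → adj u u ≡ false) (W : Fin n → Bool) (d : ℕ)
      (deg : ∀ u → W u ≡ true → d ≤ card (adj u)) (big : 2 * d ≤ card W) where

      module _ {l} (l<d : l < d) (M : List (Fin n × Fin n)) (len : length M ≡ l) (es : All Edge M)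
        (dis : ∀ w → sumL (covers w) M ≤ 1) where

        cov : Fin n → ℕ
        cov w = sumL (covers w) M

        ∑cov : ∑ cov ≡ 2 * l
        ∑cov = trans (∑-cong (λ w → sym (+-identityʳ (cov w)))) (trans (∑-covers (λ _ → 1) M) (trans (const M) (cong (2 *_) len)))
          where
          const : ∀ M → sumL (λ _ → 2) M ≡ 2 * length M
          const [] = refl
          const (_ ∷ M) = trans (cong (2 +_) (const M)) (sym (*-suc 2 (length M)))

        2l+2≤|W| : 2 + 2 * l ≤ card W
        2l+2≤|W| = ≤-trans (≤-trans (≤-reflexive (sym (*-suc 2 l))) (*-monoʳ-≤ 2 l<d)) big

        <⟦⟧ : ∀ {x} b → x < ⟦ b ⟧ → b ≡ true × x ≡ 0
        <⟦⟧ true (s≤s z≤n) = refl , refl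

        two-uncovered : ∃₂ λ u v → u ≢ v × W u ≡ true × W v ≡ true × cov u ≡ 0 × cov v ≡ 0
        two-uncovered
          with u , hu ← ∑-find {f = cov} {g = λ w → ⟦ W w ⟧} (subst (_< card W) (sym ∑cov) (≤-trans (n≤1+n _) 2l+2≤|W|))
          with v , hv ← ∑-find {f = λ w → cov w + ⟦ u == w ⟧} {g = λ w → ⟦ W w ⟧}
                 (subst (_< card W) (sym (trans (∑-distrib-+ _ _) (cong₂ _+_ ∑cov (∑-δ1 u)))) (subst (_< card W) (+-comm 1 (2 * l)) 2l+2≤|W|))
          with Wu , cu ← <⟦⟧ (W u) hu | Wv , cv ← <⟦⟧ (W v) hv
          = u , v , (λ e → 1≢0 (trans (cong ⟦_⟧ (sym (trans (cong (u ==_) (sym e)) (==-refl u)))) (m+n≡0⇒n≡0 (cov v) cv)))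
            , Wu , Wv , cu , m+n≡0⇒m≡0 (cov v) cv
          where
          1≢0 : 1 ≢ 0
          1≢0 ()

        add-two : ∀ x y → x ≢ y → cov x ≡ 0 → cov y ≡ 0 → ∀ w → ⟦ x == w ⟧ + ⟦ y == w ⟧ + cov w ≤ 1
        add-two x y x≢y cx cy w with x Fin.≟ w | y Fin.≟ w
        ... | yes refl | yes refl = ⊥-elim (x≢y refl)
        ... | yes refl | no _ = s≤s (≤-reflexive cx)
        ... | no _ | yes refl = s≤s (≤-reflexive cy)
        ... | no _ | no _ = dis w

        extend : ∀ x → cov x ≡ 0 → ∀ y → adj x y ≡ true → cov y ≡ 0 → Matching (suc l)
        extend x cx y xy cy = record
          { pairs = (x , y) ∷ M ; size = cong suc len ; areEdges = xy ∷ es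
          ; disjoint = add-two x y (λ e → true≢false xy (trans (cong (adj x) (sym e)) (irr x))) cx cy }

        FreeNeighbour : Fin n → Set
        FreeNeighbour x = ∃ λ y → adj x y ≡ true × cov y ≡ 0

        free? : ∀ x → Dec (FreeNeighbour x)
        free? x = Fin.any? (λ y → (adj x y Bool.≟ true) ×-dec (cov y ≟ 0))

        hits : Fin n → Fin n × Fin n → ℕ
        hits x p = ⟦ adj x (proj₁ p) ⟧ + ⟦ adj x (proj₂ p) ⟧

        saturated : ∀ x → W x ≡ true → ¬ FreeNeighbour x → d ≤ sumL (hits x) M
        saturated x Wx ¬f = ≤-trans (deg x Wx) (≤-trans (∑-mono bound) (≤-reflexive (∑-covers (λ y → ⟦ adj x y ⟧) M)))
          where
          bound : ∀ y → ⟦ adj x y ⟧ ≤ ⟦ adj x y ⟧ * cov y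
          bound y with adj x y in xy | cov y in cy
          ... | false | _ = z≤n
          ... | true | zero = ⊥-elim (¬f (y , xy , cy))
          ... | true | suc _ = s≤s z≤n

        three : ∀ a b c d → 2 < (⟦ a ⟧ + ⟦ b ⟧) + (⟦ c ⟧ + ⟦ d ⟧) → (a ≡ true × d ≡ true) ⊎ (b ≡ true × c ≡ true)
        three true b c true _ = inj₁ (refl , refl)
        three true true true false _ = inj₂ (refl , refl)
        three false true true d _ = inj₂ (refl , refl)
        three true true false false (s≤s (s≤s ()))
        three true false true false (s≤s (s≤s ()))
        three true false false false (s≤s ())
        three false true false true (s≤s (s≤s ()))
        three false true false false (s≤s ())
        three false false true true (s≤s (s≤s ()))
        three false false true false (s≤s ())
        three false false false true (s≤s ())

        -- The pairs u–x and v–y replace the pair x–y.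
        reroute : ∀ u v → u ≢ v → cov u ≡ 0 → cov v ≡ 0 → ∀ x y M′ → adj u x ≡ true → adj v y ≡ true →
          length M ≡ suc (length M′) → All Edge M′ →
          (∀ w → cov w ≡ ⟦ x == w ⟧ + ⟦ y == w ⟧ + sumL (covers w) M′) → Matching (suc l)
        reroute u v u≢v cu cv x y M′ ux vy len′ es′ covM = record
          { pairs = (u , x) ∷ (v , y) ∷ M′ ; size = cong suc (trans (sym len′) len) ; areEdges = ux ∷ vy ∷ es′
          ; disjoint = λ w → ≤-trans (≤-reflexive (trans (perm ⟦ u == w ⟧ ⟦ x == w ⟧ ⟦ v == w ⟧ ⟦ y == w ⟧ (sumL (covers w) M′))
              (cong (⟦ u == w ⟧ + ⟦ v == w ⟧ +_) (sym (covM w))))) (add-two u v u≢v cu cv w) }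
          where
          perm : ∀ a b c d e → a + b + (c + d + e) ≡ a + c + (b + d + e)
          perm = solve-∀

        -- If the uncovered vertices `u` and `v` have covered neighbours only, then together they
        -- send at least `2d > 2l` edges to the `l` pairs. Some pair receives three of the four
        -- possible edges, and so `u` and `v` can be joined to different ends of it.
        augment : Matching (suc l)
        augment with u , v , u≢v , Wu , Wv , cu , cv ← two-uncovered with free? u | free? v
        ... | yes (y , uy , cy) | _ = extend u cu y uy cy
        ... | no _ | yes (y , vy , cy) = extend v cv y vy cy
        ... | no ¬fu | no ¬fv
          with (x , y) , M′ , gt , len′ , es′ , sums ← extract (λ p → hits u p + hits v p) M
                 (<-≤-trans (*-monoʳ-< 2 (subst (_< d) (sym len) l<d))
                   (≤-trans (+-mono-≤ (saturated u Wu ¬fu) (≤-trans (≤-reflexive (+-identityʳ d)) (saturated v Wv ¬fv)))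
                     (≤-reflexive (sym (sumL-+ (hits u) (hits v) M))))) es
          with three (adj u x) (adj u y) (adj v x) (adj v y) gt
        ... | inj₁ (ux , vy) = reroute u v u≢v cu cv x y M′ ux vy len′ es′ (λ w → sums (covers w))
        ... | inj₂ (uy , vx) = reroute u v u≢v cu cv y x M′ uy vx len′ es′
                (λ w → trans (sums (covers w)) (cong (_+ sumL (covers w) M′) (+-comm ⟦ x == w ⟧ ⟦ y == w ⟧)))

      matching≤ : ∀ l → l ≤ d → Matching l
      matching≤ zero _ = record { pairs = [] ; size = refl ; areEdges = [] ; disjoint = λ _ → z≤n }
      matching≤ (suc l) l<d = augment l<d pairs size areEdges disjoint
        where open Matching (matching≤ l (<⇒≤ l<d))

      matching : Matching d
      matching = matching≤ d ≤-refl

  -- Spanning forests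

  -- Serves twice: seeded with the two ends of a pair of clusters it provides the steering, seeded
  -- with the root it provides the parents in the tree. `rank` is the depth in the forest, not
  -- necessarily a distance in the graph.
  module Spanning {N} (C seed : Fin N → Bool) (adj : Fin N → Fin N → Bool) (seed⊆C : seed ⊆ C)
    (crossing : ∀ S → seed ⊆ S → S ⊆ C → ∀ b → C b ≡ true → S b ≡ false →
      ∃₂ λ x y → S x ≡ true × C y ≡ true × S y ≡ false × adj y x ≡ true) where

    record Forest (S : Fin N → Bool) : Set where
      field
        par : Fin N → Fin N
        rank : Fin N → ℕ
        rank≤ : ∀ v → S v ≡ true → rank v ≤ card S
        seed-rank : ∀ v → seed v ≡ true → rank v ≡ 0
        par∈ : ∀ v → S v ≡ true → seed v ≡ false → S (par v) ≡ true
        par-adj : ∀ v → S v ≡ true → seed v ≡ false → adj v (par v) ≡ true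
        par-rank : ∀ v → S v ≡ true → seed v ≡ false → rank v ≡ suc (rank (par v))

    grow : ∀ {S} → seed ⊆ S → Forest S → ∀ x y → S x ≡ true → S y ≡ false → adj y x ≡ true →
      let S⁺ = λ v → S v ∨ (y == v) in (card S⁺ ≡ suc (card S)) × Forest S⁺
    grow {S} seed⊆S F x y Sx Sy yx = card-S⁺ , record
      { par = par′ ; rank = rank′
      ; rank≤ = λ v → subst (rank′ v ≤_) (sym card-S⁺) ∘ rank≤′ v
      ; seed-rank = λ v sv → trans (cong (λ b → if b then suc (rank x) else rank v) (≢⇒== (y≢ (seed⊆S v sv)))) (seed-rank v sv)
      ; par∈ = par∈′
      ; par-adj = par-adj′
      ; par-rank = par-rank′ }
      where
      open Forest F
      y≢ : ∀ {v} → S v ≡ true → y ≢ v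
      y≢ Sv refl = true≢false Sv Sy
      card-S⁺ : card (λ v → S v ∨ (y == v)) ≡ suc (card S)
      card-S⁺ = trans (∑-cong split) (trans (∑-distrib-+ _ _) (trans (cong (card S +_) (∑-δ1 y)) (+-comm (card S) 1)))
        where
        split : ∀ v → ⟦ S v ∨ (y == v) ⟧ ≡ ⟦ S v ⟧ + ⟦ y == v ⟧
        split v with y Fin.≟ v
        ... | yes refl rewrite Sy = refl
        ... | no _ with S v
        ...   | true = refl
        ...   | false = refl
      par′ : Fin N → Fin N
      par′ v = if y == v then x else par v
      rank′ : Fin N → ℕ
      rank′ v = if y == v then suc (rank x) else rank v
      rank′-S : ∀ {v} → S v ≡ true → rank′ v ≡ rank v
      rank′-S {v} Sv = cong (λ b → if b then suc (rank x) else rank v) (≢⇒== (y≢ Sv))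
      rank≤′ : ∀ v → S v ∨ (y == v) ≡ true → rank′ v ≤ suc (card S)
      rank≤′ v h with y Fin.≟ v
      ... | yes refl = s≤s (rank≤ x Sx)
      ... | no _ = ≤-trans (rank≤ v (trans (sym (Bool.∨-identityʳ (S v))) h)) (n≤1+n _)
      par∈′ : ∀ v → S v ∨ (y == v) ≡ true → seed v ≡ false → S (par′ v) ∨ (y == par′ v) ≡ true
      par∈′ v h sv with y Fin.≟ v
      ... | yes refl rewrite Sx = refl
      ... | no _ rewrite par∈ v (trans (sym (Bool.∨-identityʳ (S v))) h) sv = refl
      par-adj′ : ∀ v → S v ∨ (y == v) ≡ true → seed v ≡ false → adj v (par′ v) ≡ true
      par-adj′ v h sv with y Fin.≟ v
      ... | yes refl = yx
      ... | no _ = par-adj v (trans (sym (Bool.∨-identityʳ (S v))) h) sv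
      par-rank′ : ∀ v → S v ∨ (y == v) ≡ true → seed v ≡ false → rank′ v ≡ suc (rank′ (par′ v))
      par-rank′ v h sv with y Fin.≟ v
      ... | yes refl = cong suc (sym (rank′-S Sx))
      ... | no _ = trans (par-rank v Sv sv) (cong suc (sym (rank′-S (par∈ v Sv sv))))
        where Sv = trans (sym (Bool.∨-identityʳ (S v))) h

    saturate : ∀ t S → N ≤ t + card S → seed ⊆ S → S ⊆ C → Forest S → ∃ λ S → C ⊆ S × S ⊆ C × Forest S
    saturate t S fuel s⊆ ⊆C F with Fin.any? (λ b → (C b Bool.≟ true) ×-dec (S b Bool.≟ false))
    ... | no ¬h = S , (λ v Cv → aux v Cv) , ⊆C , F
      where
      aux : ∀ v → C v ≡ true → S v ≡ true
      aux v Cv with S v in eq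
      ... | true = refl
      ... | false = ⊥-elim (¬h (v , Cv , eq))
    ... | yes (b , Cb , Sb) with crossing S s⊆ ⊆C b Cb Sb
    ...   | x , y , Sx , Cy , Sy , yx with grow s⊆ F x y Sx Sy yx
    ...     | cardS⁺ , F⁺ with t
    ...       | zero = ⊥-elim (<⇒≱ (≤-trans (≤-reflexive (sym cardS⁺)) (card≤n _)) fuel)
    ...       | suc t = saturate t _ (≤-trans fuel (≤-reflexive (trans (sym (+-suc t (card S))) (cong (t +_) (sym cardS⁺)))))
                  (λ v sv → cong (_∨ (y == v)) (s⊆ v sv)) ⊆C⁺ F⁺
      where
      ⊆C⁺ : ∀ v → S v ∨ (y == v) ≡ true → C v ≡ true
      ⊆C⁺ v h with ∨-elim {S v} h
      ... | inj₁ Sv = ⊆C v Sv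
      ... | inj₂ e = subst (λ z → C z ≡ true) (==⇒≡ e) Cy

    record SpanningForest : Set where
      field
        par : Fin N → Fin N
        rank : Fin N → ℕ
        rank≤ : ∀ v → C v ≡ true → rank v ≤ N
        seed-rank : ∀ v → seed v ≡ true → rank v ≡ 0
        par∈ : ∀ v → C v ≡ true → seed v ≡ false → C (par v) ≡ true
        par-adj : ∀ v → C v ≡ true → seed v ≡ false → adj v (par v) ≡ true
        par-rank : ∀ v → C v ≡ true → seed v ≡ false → rank v ≡ suc (rank (par v))

    spanningForest : SpanningForest
    spanningForest with saturate N seed (m≤m+n N _) (λ _ h → h) seed⊆C (record
      { par = id ; rank = λ _ → 0 ; rank≤ = λ _ _ → z≤n ; seed-rank = λ _ _ → refl
      ; par∈ = λ v s n → ⊥-elim (true≢false s n) ; par-adj = λ v s n → ⊥-elim (true≢false s n)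
      ; par-rank = λ v s n → ⊥-elim (true≢false s n) })
    ... | S , C⊆S , S⊆C , F = record
      { par = par ; rank = rank ; rank≤ = λ v Cv → ≤-trans (rank≤ v (C⊆S v Cv)) (card≤n S) ; seed-rank = seed-rank
      ; par∈ = λ v Cv n → S⊆C _ (par∈ v (C⊆S v Cv) n) ; par-adj = λ v Cv → par-adj v (C⊆S v Cv)
      ; par-rank = λ v Cv → par-rank v (C⊆S v Cv) }
      where open Forest F

  -- The reduced graph

  orientedBy : ∀ {A : Set} → (A → A → Bool) → Bool → A → A → Bool
  orientedBy E true x y = E x y
  orientedBy E false x y = E y x

  choose : ∀ {A : Set} → Bool → A → A → A
  choose s x y = if s then x else y

  -- A rule leading from any cluster, used for sources (s = true) or sinks (s = false), to the pair (i , j).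
  record Steering {m} (side : Bool → Fin m → Bool) (valid : Fin m → Fin m → Bool) (i j : Fin m) : Set where
    field
      next : Bool → Fin m → Fin m
      dist : Bool → Fin m → ℕ
      next-link : ∀ s h → side s h ≡ true → orientedBy valid s h (next s h) ≡ true
      dist≤ : ∀ s h → side s h ≡ true → dist s h ≤ m + m
      -- With `pred 0 = 0` a walk that has arrived may go on, alternating between the two ends.
      dist-next : ∀ s h → side s h ≡ true → dist (not s) (next s h) ≤ pred (dist s h)
      dist-0 : ∀ s h → side s h ≡ true → dist s h ≡ 0 → h ≡ choose s i j
      dist-target : ∀ s → dist s (choose s i j) ≡ 0

  -- `pairs` consists of pairs of vertices whose clusters are linked. It is an integral substitute
  -- for a fractional matching of clusters of different sizes.
  record ReducedGraph {n} (D : Fin n → Fin n → Bool) {m} (c : Fin n → Fin m) (R : Fin m → Fin m → Bool) (d : ℕ) : Set where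
    field
      side : Bool → Fin m → Bool
      valid : Fin m → Fin m → Bool
      valid⇒R : ∀ i j → valid i j ≡ true → R i j ≡ true
      valid⇒side : ∀ i j → valid i j ≡ true → side true i ≡ true × side false j ≡ true
      steer : ∀ i j → valid i j ≡ true → Steering side valid i j
      pairs : List (Fin n × Fin n)
      size-pairs : length pairs ≡ d
      pairs-valid : All (λ p → valid (c (proj₁ p)) (c (proj₂ p)) ≡ true) pairs
      pairs-disjoint : ∀ w → sumL (λ p → ⟦ proj₁ p == w ⟧ + ⟦ proj₂ p == w ⟧) pairs ≤ 1

  -- `num / den` is the minimum degree aimed at. The matching has size `d`, one less than the degree
  -- guaranteed, because a vertex may be counted among its own neighbours when its cluster is linked
  -- to itself.
  module Reduce {n} (D : Fin n → Fin n → Bool) (oriented : ∀ u v → D u v ≡ true → D v u ≡ false)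
    {m} (c : Fin n → Fin m) (R : Fin m → Fin m → Bool) (num den d : ℕ) (n>0 : 0 < n)
    (den>0 : 0 < den) (den*[1+d]≤num : den * suc d ≤ num)
    (dense : num * (2 * n) ≤ den * ∑ (λ u → ∑ (λ v → ⟦ R (c u) (c v) ⟧ * ⟦ D u v ⟧))) where

    V : Fin m → Fin n → Bool
    V i v = c v == i

    size : Fin m → ℕ
    size i = card (V i)

    ∑-size : ∀ (f : Fin m → ℕ) → ∑ (λ v → f (c v)) ≡ ∑ (λ i → f i * size i)
    ∑-size f = trans (∑-cong (λ v → sym (∑-δ (c v) f))) (trans (∑-comm _)
      (∑-cong (λ i → trans (∑-*ʳ (λ v → ⟦ c v == i ⟧) (f i)) (*-comm (size i) (f i)))))

    e : Fin m → Fin m → ℕ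
    e i j = edges D (V i) (V j)

    eR : Fin m → Fin m → ℕ
    eR i j = ⟦ R i j ⟧ * e i j

    -- Here the orientation enters: of the two directions between `u` and `v` at most one is an
    -- edge.
    e+e≤ : ∀ i j → e i j + e j i ≤ size i * size j
    e+e≤ i j = ≤-trans (≤-reflexive (trans (cong (e i j +_) (∑-comm _)) (sym (∑∑-+ _ _))))
      (≤-trans (∑∑-mono (λ u v → cell u v)) (≤-reflexive (∑∑-product _ _)))
      where
      anti : ∀ x y → (x ≡ true → y ≡ false) → ⟦ x ⟧ + ⟦ y ⟧ ≤ 1
      anti true y h rewrite h refl = ≤-refl
      anti false y h = ⟦⟧≤1 y
      rearr : ∀ a b x y → a * b * x + b * a * y ≡ a * b * (x + y)
      rearr = solve-∀
      cell : ∀ u v → ⟦ V i u ⟧ * ⟦ V j v ⟧ * ⟦ D u v ⟧ + ⟦ V j v ⟧ * ⟦ V i u ⟧ * ⟦ D v u ⟧ ≤ ⟦ V i u ⟧ * ⟦ V j v ⟧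
      cell u v = ≤-trans (≤-reflexive (rearr ⟦ V i u ⟧ ⟦ V j v ⟧ ⟦ D u v ⟧ ⟦ D v u ⟧))
        (≤-trans (*-monoʳ-≤ (⟦ V i u ⟧ * ⟦ V j v ⟧) (anti (D u v) (D v u) (oriented u v))) (≤-reflexive (*-identityʳ _)))

    eR≤ : ∀ i j → eR i j ≤ size i * size j
    eR≤ i j = ≤-trans (*-monoˡ-≤ (e i j) (⟦⟧≤1 (R i j))) (≤-trans (≤-reflexive (+-identityʳ _)) (≤-trans (m≤m+n _ (e j i)) (e+e≤ i j)))

    -- Node i ↑ˡ m is the cluster i in the role of a source, node m ↑ʳ i in the role of a sink.
    cluster : Fin m ⊎ Fin m → Fin m
    cluster = [ id , id ]′

    eN : Fin m ⊎ Fin m → Fin m ⊎ Fin m → ℕ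
    eN (inj₁ i) (inj₂ j) = eR i j
    eN (inj₂ j) (inj₁ i) = eR i j
    eN (inj₁ _) (inj₁ _) = 0
    eN (inj₂ _) (inj₂ _) = 0

    eN-sym : ∀ a b → eN a b ≡ eN b a
    eN-sym (inj₁ i) (inj₂ j) = refl
    eN-sym (inj₂ j) (inj₁ i) = refl
    eN-sym (inj₁ _) (inj₁ _) = refl
    eN-sym (inj₂ _) (inj₂ _) = refl

    eN-irr : ∀ a → eN a a ≡ 0
    eN-irr (inj₁ _) = refl
    eN-irr (inj₂ _) = refl

    eN≤ : ∀ a b → eN a b ≤ size (cluster a) * size (cluster b)
    eN≤ (inj₁ i) (inj₂ j) = eR≤ i j
    eN≤ (inj₂ j) (inj₁ i) = ≤-trans (eR≤ i j) (≤-reflexive (*-comm (size i) (size j)))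
    eN≤ (inj₁ _) (inj₁ _) = z≤n
    eN≤ (inj₂ _) (inj₂ _) = z≤n

    sp : Fin (m + m) → Fin m ⊎ Fin m
    sp = splitAt m

    -- The threshold is doubled since `inner` counts every edge of the double cover twice; `cancel2`
    -- removes the factor again.
    module Cr = Core {m + m} (λ a → size (cluster (sp a))) (λ a b → eN (sp a) (sp b)) (λ a b → eN-sym (sp a) (sp b))
      (λ a → eN-irr (sp a)) (λ a b → eN≤ (sp a) (sp b)) (2 * num) den

    ∑-nodes : ∀ (f : Fin (m + m) → Fin m ⊎ Fin m → ℕ) →
      ∑ (λ a → f a (sp a)) ≡ ∑ (λ i → f (i ↑ˡ m) (inj₁ i)) + ∑ (λ i → f (m ↑ʳ i) (inj₂ i))
    ∑-nodes f = trans (∑-↑ m (λ a → f a (sp a))) (cong₂ _+_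
      (∑-cong (λ i → cong (f (i ↑ˡ m)) (Fin.splitAt-↑ˡ m i m))) (∑-cong (λ i → cong (f (m ↑ʳ i)) (Fin.splitAt-↑ʳ m m i))))

    everything : Fin (m + m) → Bool
    everything _ = true

    ∑-size≡n : ∑ size ≡ n
    ∑-size≡n = trans (∑-cong (λ i → sym (+-identityʳ (size i)))) (trans (sym (∑-size (λ _ → 1))) (trans (∑-const n 1) (*-identityʳ n)))

    weight-all : Cr.weight everything ≡ 2 * n
    weight-all = trans (∑-nodes (λ _ x → 1 * size (cluster x))) (trans
      (cong₂ _+_ eq eq) (cong (n +_) (sym (+-identityʳ n))))
      where
      eq : ∑ (λ i → 1 * size i) ≡ n
      eq = trans (∑-cong (λ i → +-identityʳ (size i))) ∑-size≡n

    inner-all : Cr.inner everything ≡ 2 * ∑ (λ i → ∑ (λ j → eR i j))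
    inner-all = trans (∑-nodes (λ _ x → ∑ (λ b → 1 * 1 * eN x (sp b)))) (trans (cong₂ _+_
        (∑-cong (λ i → trans (∑-nodes (λ _ y → 1 * 1 * eN (inj₁ i) y)) (trans (cong (_+ ∑ (λ j → 1 * 1 * eR i j)) (∑-zero (λ _ → refl))) (∑-cong (λ j → +-identityʳ (eR i j))))))
        (trans (∑-cong (λ j → trans (∑-nodes (λ _ y → 1 * 1 * eN (inj₂ j) y)) (trans (cong (∑ (λ i → 1 * 1 * eR i j) +_) (∑-zero (λ _ → refl)))
            (trans (+-identityʳ _) (∑-cong (λ i → +-identityʳ (eR i j))))))) (∑-comm _)))
      (cong (∑ (λ i → ∑ (λ j → eR i j)) +_) (sym (+-identityʳ _))))

    ∑eR : ∑ (λ i → ∑ (λ j → eR i j)) ≡ ∑ (λ u → ∑ (λ v → ⟦ R (c u) (c v) ⟧ * ⟦ D u v ⟧))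
    ∑eR = sym (trans (∑∑-cells c (λ i j u v → ⟦ R i j ⟧ * ⟦ D u v ⟧)) (∑∑-cong (λ i j →
      trans (∑∑-cong (λ u v → rearr ⟦ V i u ⟧ ⟦ V j v ⟧ ⟦ R i j ⟧ ⟦ D u v ⟧)) (∑∑-*ˡ ⟦ R i j ⟧ _))))
      where
      rearr : ∀ a b r d → a * (b * (r * d)) ≡ r * (a * b * d)
      rearr = solve-∀

    good-all : Cr.Good everything
    good-all = subst (0 <_) (sym weight-all) (≤-trans n>0 (m≤m+n n _)) ,
      subst₂ (λ x y → 2 * num * x ≤ den * y) (sym weight-all) (sym (trans inner-all (cong (2 *_) ∑eR)))
        (≤-by 0 (2 ⊗ dense) (ident num n den _))
      where
      ident : ∀ num n den x → 2 * num * (2 * n) + 2 * (den * x) + 0 ≡ den * (2 * x) + 2 * (num * (2 * n))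
      ident = solve-∀

    module WithCore (C : Fin (m + m) → Bool) (good : Cr.Good C) (min : Cr.Minimal C) where

      side : Bool → Fin m → Bool
      side true i = C (i ↑ˡ m)
      side false i = C (m ↑ʳ i)

      valid : Fin m → Fin m → Bool
      valid i j = R i j ∧ (side true i ∧ side false j)

      F : Fin m → Fin m → ℕ
      F i j = ⟦ valid i j ⟧ * e i j

      cancel2 : ∀ x y → 2 * num * x ≤ den * (2 * y) → num * x ≤ den * y
      cancel2 x y h = *-cancelˡ-≤ 2 (≤-trans (≤-reflexive (sym (*-assoc 2 num x))) (≤-trans h (≤-reflexive (rearr den y))))
        where
        rearr : ∀ a b → a * (2 * b) ≡ 2 * (a * b)
        rearr = solve-∀

      outDegree : ∀ i → side true i ≡ true → num * size i ≤ den * ∑ (λ j → F i j)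
      outDegree i Ci = cancel2 _ _ (subst₂ (λ x y → 2 * num * x ≤ den * (2 * y))
        (cong (size ∘ cluster) (Fin.splitAt-↑ˡ m i m))
        (trans (∑-nodes (λ b y → ⟦ C b ⟧ * eN (sp (i ↑ˡ m)) y))
          (cong₂ _+_ (trans (∑-cong (λ j → cong (λ x → ⟦ C (j ↑ˡ m) ⟧ * eN x (inj₁ j)) (Fin.splitAt-↑ˡ m i m))) (∑-zero (λ j → *-zeroʳ ⟦ C (j ↑ˡ m) ⟧)))
            (∑-cong (λ j → trans (cong (λ x → ⟦ C (m ↑ʳ j) ⟧ * eN x (inj₂ j)) (Fin.splitAt-↑ˡ m i m)) (term (C (i ↑ˡ m)) Ci (C (m ↑ʳ j)) (R i j) (e i j))))))
        (Cr.minDegree C good min (i ↑ˡ m) Ci))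
        where
        term : ∀ x → x ≡ true → ∀ y r e → ⟦ y ⟧ * (⟦ r ⟧ * e) ≡ ⟦ r ∧ (x ∧ y) ⟧ * e
        term x refl true true e = +-identityʳ (1 * e)
        term x refl true false e = refl
        term x refl false true e = refl
        term x refl false false e = refl

      inDegree : ∀ j → side false j ≡ true → num * size j ≤ den * ∑ (λ i → F i j)
      inDegree j Cj = cancel2 _ _ (subst₂ (λ x y → 2 * num * x ≤ den * (2 * y))
        (cong (size ∘ cluster) (Fin.splitAt-↑ʳ m m j))
        (trans (∑-nodes (λ b y → ⟦ C b ⟧ * eN (sp (m ↑ʳ j)) y))
          (trans (cong₂ _+_
            (∑-cong (λ i → trans (cong (λ x → ⟦ C (i ↑ˡ m) ⟧ * eN x (inj₁ i)) (Fin.splitAt-↑ʳ m m j)) (term (C (m ↑ʳ j)) Cj (C (i ↑ˡ m)) (R i j) (e i j))))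
            (trans (∑-cong (λ i → cong (λ x → ⟦ C (m ↑ʳ i) ⟧ * eN x (inj₂ i)) (Fin.splitAt-↑ʳ m m j))) (∑-zero (λ i → *-zeroʳ ⟦ C (m ↑ʳ i) ⟧))))
          (+-identityʳ _)))
        (Cr.minDegree C good min (m ↑ʳ j) Cj))
        where
        term : ∀ x → x ≡ true → ∀ y r e → ⟦ y ⟧ * (⟦ r ⟧ * e) ≡ ⟦ r ∧ (y ∧ x) ⟧ * e
        term x refl true true e = +-identityʳ (1 * e)
        term x refl true false e = refl
        term x refl false true e = refl
        term x refl false false e = refl

      nb : Fin m → Fin m → Bool
      nb i j = valid i j ∨ valid j i

      valid⇒side : ∀ i j → valid i j ≡ true → side true i ≡ true × side false j ≡ true
      valid⇒side i j h = ∧-elim (proj₂ (∧-elim {R i j} h))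

      roles : Fin m → ℕ
      roles i = ⟦ side true i ⟧ + ⟦ side false i ⟧

      -- A cluster linked to `i` in both directions still counts only once as a neighbour; this is
      -- what makes two roles force twice as many neighbours.
      F+F≤ : ∀ i j → F i j + F j i ≤ size i * (⟦ nb i j ⟧ * size j)
      F+F≤ i j with valid i j | valid j i
      ... | true | true = ≤-trans (≤-reflexive (cong₂ _+_ (+-identityʳ (e i j)) (+-identityʳ (e j i)))) (≤-trans (e+e≤ i j) (≤-reflexive (cong (size i *_) (sym (+-identityʳ (size j))))))
      ... | true | false = ≤-trans (≤-reflexive (trans (+-identityʳ _) (+-identityʳ _))) (≤-trans (m≤m+n _ _) (≤-trans (e+e≤ i j) (≤-reflexive (cong (size i *_) (sym (+-identityʳ (size j)))))))
      ... | false | true = ≤-trans (≤-reflexive (+-identityʳ _)) (≤-trans (m≤n+m _ (e i j)) (≤-trans (e+e≤ i j) (≤-reflexive (cong (size i *_) (sym (+-identityʳ (size j)))))))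
      ... | false | false = z≤n

      size>0 : ∀ u → 0 < size (c u)
      size>0 u = card-pos u (==-refl (c u))

      nbCount : Fin m → ℕ
      nbCount i = card (λ v → nb i (c v))

      nbDegree : ∀ u → num * roles (c u) ≤ den * nbCount (c u)
      nbDegree u = *-cancelˡ-≤ (size i) {{>-nonZero (size>0 u)}} (≤-trans (≤-reflexive (rearr (size i) num ⟦ side true i ⟧ ⟦ side false i ⟧))
          (≤-trans (+-mono-≤ (outBound (side true i) refl) (inBound (side false i) refl))
          (≤-trans (≤-reflexive (trans (sym (*-distribˡ-+ den _ _)) (cong (den *_) (sym (∑-distrib-+ _ _)))))
          (≤-trans (*-monoʳ-≤ den (≤-trans (∑-mono (F+F≤ i)) (≤-reflexive (trans (∑-*ˡ (size i) _) (cong (size i *_) (sym (∑-size (λ j → ⟦ nb i j ⟧))))))))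
            (≤-reflexive (rearr₂ den (size i) (nbCount i)))))))
        where
        i = c u
        rearr : ∀ s n a b → s * (n * (a + b)) ≡ a * (n * s) + b * (n * s)
        rearr = solve-∀
        rearr₂ : ∀ d s x → d * (s * x) ≡ s * (d * x)
        rearr₂ = solve-∀
        outBound : ∀ b → side true i ≡ b → ⟦ b ⟧ * (num * size i) ≤ den * ∑ (λ j → F i j)
        outBound true eq = ≤-trans (≤-reflexive (+-identityʳ _)) (outDegree i eq)
        outBound false eq = z≤n
        inBound : ∀ b → side false i ≡ b → ⟦ b ⟧ * (num * size i) ≤ den * ∑ (λ j → F j i)
        inBound true eq = ≤-trans (≤-reflexive (+-identityʳ _)) (inDegree i eq)
        inBound false eq = z≤n

      nbCount≥ : ∀ u → roles (c u) * suc d ≤ nbCount (c u)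
      nbCount≥ u = *-cancelˡ-≤ den {{>-nonZero den>0}} (≤-trans (≤-reflexive (rearr den (roles (c u)) (suc d)))
        (≤-trans (*-monoʳ-≤ (roles (c u)) den*[1+d]≤num) (≤-trans (≤-reflexive (*-comm (roles (c u)) num)) (nbDegree u))))
        where
        rearr : ∀ a b c → a * (b * c) ≡ b * (a * c)
        rearr = solve-∀

      W : Fin n → Bool
      W u = side true (c u) ∨ side false (c u)

      -- The blow-up: all vertices of linked clusters are joined, whether or not `D` has an edge
      -- there. Loops are removed, as a cluster may be linked to itself.
      adj : Fin n → Fin n → Bool
      adj u v = not (u == v) ∧ nb (c u) (c v)

      adj-irr : ∀ u → adj u u ≡ false
      adj-irr u = cong (λ b → not b ∧ nb (c u) (c u)) (==-refl u)

      roles≥1 : ∀ u → W u ≡ true → 1 ≤ roles (c u)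
      roles≥1 u h with side true (c u) | side false (c u)
      ... | true | _ = s≤s z≤n
      ... | false | true = s≤s z≤n

      nbCount≥1+d : ∀ u → W u ≡ true → suc d ≤ nbCount (c u)
      nbCount≥1+d u Wu = ≤-trans (≤-trans (≤-reflexive (sym (+-identityʳ (suc d)))) (*-monoˡ-≤ (suc d) (roles≥1 u Wu))) (nbCount≥ u)

      adj-degree : ∀ u → W u ≡ true → d ≤ card (adj u)
      adj-degree u Wu = s≤s⁻¹ (≤-trans (nbCount≥1+d u Wu) (≤-trans (∑-mono (λ v → pt (u == v) (nb (c u) (c v))))
        (≤-reflexive (trans (∑-distrib-+ _ _) (cong (_+ card (adj u)) (∑-δ1 u))))))
        where
        pt : ∀ a b → ⟦ b ⟧ ≤ ⟦ a ⟧ + ⟦ not a ∧ b ⟧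
        pt true b = ≤-trans (⟦⟧≤1 b) ≤-refl
        pt false b = ≤-refl

      nb⊆W : ∀ i → (λ v → nb i (c v)) ⊆ W
      nb⊆W i v h with ∨-elim {valid i (c v)} h
      ... | inj₁ p rewrite proj₂ (valid⇒side i (c v) p) = Bool.∨-zeroʳ _
      ... | inj₂ p rewrite proj₁ (valid⇒side (c v) i p) = refl

      someW : ∃ λ u → W u ≡ true
      someW with ∑-find {f = λ _ → 0} {g = λ a → ⟦ C a ⟧ * size (cluster (sp a))} (subst (_< Cr.weight C) (sym (∑-zero {m + m} (λ _ → refl))) (proj₁ good))
      ... | a , lt with C a in Ca
      ...   | true with card>0 (subst (0 <_) (+-identityʳ _) lt)
      ...     | v , Vv = v , Wv (sp a) refl
        where
        Wv : ∀ x → sp a ≡ x → W v ≡ true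
        Wv (inj₁ i) eq = trans (cong (λ z → side true z ∨ side false (c v)) (trans (==⇒≡ Vv) (cong cluster eq)))
          (cong (_∨ side false (c v)) (trans (cong C (Fin.splitAt⁻¹-↑ˡ {i = a} eq)) Ca))
        Wv (inj₂ i) eq = trans (cong (λ z → side true (c v) ∨ side false z) (trans (==⇒≡ Vv) (cong cluster eq)))
          (trans (cong (side true (c v) ∨_) (trans (cong C (Fin.splitAt⁻¹-↑ʳ {i = a} eq)) Ca)) (Bool.∨-zeroʳ _))

      module _ (exclusive : ∀ x → side true (c x) ≡ true → side false (c x) ≡ true → ⊥) where

        role-flips : ∀ x y → nb (c x) (c y) ≡ true → side true (c y) ≡ not (side true (c x))
        role-flips x y h with ∨-elim {valid (c x) (c y)} h
        ... | inj₁ p = trans (¬true⇒false (λ q → exclusive y q (proj₂ (valid⇒side _ _ p)))) (cong not (sym (proj₁ (valid⇒side _ _ p))))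
        ... | inj₂ p = trans (proj₁ (valid⇒side _ _ p)) (cong not (sym (¬true⇒false (λ q → exclusive x q (proj₂ (valid⇒side _ _ p))))))

        -- Each link flips the role, which cannot happen three times around a triangle.
        nb-disjoint : ∀ u v w → nb (c u) (c v) ≡ true → nb (c u) (c w) ≡ true → nb (c v) (c w) ≡ true → ⊥
        nb-disjoint u v w uv uw vw = clash (side true (c w)) (trans (role-flips u w uw) (trans (sym (role-flips u v uv))
            (trans (sym (Bool.not-involutive _)) (cong not (sym (role-flips v w vw))))))
          where
          clash : ∀ b → b ≢ not b
          clash true ()
          clash false ()

        bipartite-bigW : ∀ u v → W u ≡ true → nb (c u) (c v) ≡ true → 2 * d ≤ card W
        bipartite-bigW u v Wu uv = ≤-trans (*-monoʳ-≤ 2 (n≤1+n d)) (≤-trans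
            (+-mono-≤ (nbCount≥1+d u Wu) (≤-trans (≤-reflexive (+-identityʳ (suc d))) (nbCount≥1+d v (nb⊆W (c u) v uv))))
            (≤-trans (≤-reflexive (sym (∑-distrib-+ _ _)))
              (∑-mono (λ w → pt (nb (c u) (c w)) (nb (c v) (c w)) (W w) (nb-disjoint u v w uv) (nb⊆W (c u) w) (nb⊆W (c v) w)))))
          where
          pt : ∀ a b x → (a ≡ true → b ≡ true → ⊥) → (a ≡ true → x ≡ true) → (b ≡ true → x ≡ true) → ⟦ a ⟧ + ⟦ b ⟧ ≤ ⟦ x ⟧
          pt true true x h _ _ = ⊥-elim (h refl refl)
          pt true false x _ h _ rewrite h refl = ≤-refl
          pt false true x _ _ h rewrite h refl = ≤-refl
          pt false false x _ _ _ = z≤n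

      both-bigW : ∀ u → side true (c u) ≡ true → side false (c u) ≡ true → 2 * d ≤ card W
      both-bigW u p q = ≤-trans (*-monoʳ-≤ 2 (n≤1+n d)) (≤-trans (≤-trans
        (≤-reflexive (cong (_* suc d) (sym (cong₂ (λ a b → ⟦ a ⟧ + ⟦ b ⟧) p q)))) (nbCount≥ u)) (card-mono (nb⊆W (c u))))

      bigW : 2 * d ≤ card W
      bigW = go (Fin.any? (λ u → (side true (c u) Bool.≟ true) ×-dec (side false (c u) Bool.≟ true))) someW
        where
        go : Dec (∃ λ u → side true (c u) ≡ true × side false (c u) ≡ true) → (∃ λ u → W u ≡ true) → 2 * d ≤ card W
        go (yes (u , p , q)) _ = both-bigW u p q
        go (no ¬both) (u , Wu) = bipartite-bigW (λ x p q → ¬both (x , p , q)) u (proj₁ v) Wu (proj₂ v)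
          where
          v : ∃ λ v → nb (c u) (c v) ≡ true
          v = card>0 (≤-trans (s≤s z≤n) (nbCount≥1+d u Wu))

      orient : ∀ P → All (Edge adj) P → ∃ λ Q → length Q ≡ length P
        × All (λ p → valid (c (proj₁ p)) (c (proj₂ p)) ≡ true) Q
        × (∀ w → sumL (λ p → ⟦ proj₁ p == w ⟧ + ⟦ proj₂ p == w ⟧) Q ≡ sumL (covers adj w) P)
      orient [] [] = [] , refl , [] , λ w → refl
      orient ((x , y) ∷ P) (xy ∷ hs) with orient P hs | ∨-elim {valid (c x) (c y)} (proj₂ (∧-elim {not (x == y)} xy))
      ... | Q , len , val , cov | inj₁ h = (x , y) ∷ Q , cong suc len , h ∷ val , λ w → cong (⟦ x == w ⟧ + ⟦ y == w ⟧ +_) (cov w)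
      ... | Q , len , val , cov | inj₂ h = (y , x) ∷ Q , cong suc len , h ∷ val , λ w → cong₂ _+_ (+-comm ⟦ y == w ⟧ ⟦ x == w ⟧) (cov w)

      node : Bool → Fin m → Fin (m + m)
      node true i = i ↑ˡ m
      node false i = m ↑ʳ i

      sgn : Fin m ⊎ Fin m → Bool
      sgn (inj₁ _) = true
      sgn (inj₂ _) = false

      sp-node : ∀ s i → sp (node s i) ≡ (if s then inj₁ i else inj₂ i)
      sp-node true i = Fin.splitAt-↑ˡ m i m
      sp-node false i = Fin.splitAt-↑ʳ m m i

      cl-node : ∀ s i → cluster (sp (node s i)) ≡ i
      cl-node true i = cong cluster (sp-node true i)
      cl-node false i = cong cluster (sp-node false i)

      sgn-node : ∀ s i → sgn (sp (node s i)) ≡ s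
      sgn-node true i = cong sgn (sp-node true i)
      sgn-node false i = cong sgn (sp-node false i)

      node-sp : ∀ a → node (sgn (sp a)) (cluster (sp a)) ≡ a
      node-sp a with sp a in eq
      ... | inj₁ i = Fin.splitAt⁻¹-↑ˡ eq
      ... | inj₂ i = Fin.splitAt⁻¹-↑ʳ {i = a} eq

      side-node : ∀ s i → C (node s i) ≡ side s i
      side-node true i = refl
      side-node false i = refl

      C-side : ∀ a → C a ≡ side (sgn (sp a)) (cluster (sp a))
      C-side a = trans (cong C (sym (node-sp a))) (side-node (sgn (sp a)) (cluster (sp a)))

      nodeAdj : Fin (m + m) → Fin (m + m) → Bool
      nodeAdj a b = does (sgn (sp b) Bool.≟ not (sgn (sp a))) ∧ orientedBy valid (sgn (sp a)) (cluster (sp a)) (cluster (sp b))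

      eN>0⇒ : ∀ a b → C a ≡ true → C b ≡ true → 0 < eN (sp a) (sp b) → nodeAdj b a ≡ true
      eN>0⇒ a b Ca Cb pos = go (sp a) (sp b) (trans (sym (C-side a)) Ca) (trans (sym (C-side b)) Cb) pos
        where
        pos⇒ : ∀ r {x} → 0 < ⟦ r ⟧ * x → r ≡ true
        pos⇒ true _ = refl
        go : ∀ x y → side (sgn x) (cluster x) ≡ true → side (sgn y) (cluster y) ≡ true → 0 < eN x y →
          does (sgn x Bool.≟ not (sgn y)) ∧ orientedBy valid (sgn y) (cluster y) (cluster x) ≡ true
        go (inj₁ i) (inj₂ j) p q pos = ∧-intro (pos⇒ (R i j) pos) (∧-intro p q)
        go (inj₂ j) (inj₁ i) p q pos = ∧-intro (pos⇒ (R i j) pos) (∧-intro q p)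

      module _ (i j : Fin m) (ij : valid i j ≡ true) where

        seed : Fin (m + m) → Bool
        seed a = (node true i == a) ∨ (node false j == a)

        seed-node : ∀ s → seed (node s (choose s i j)) ≡ true
        seed-node true rewrite ==-refl (i ↑ˡ m) = refl
        seed-node false rewrite ==-refl (m ↑ʳ j) = Bool.∨-zeroʳ _

        seed⇒ : ∀ a → seed a ≡ true → ∃ λ s → a ≡ node s (choose s i j)
        seed⇒ a h with ∨-elim {node true i == a} h
        ... | inj₁ e = true , sym (==⇒≡ e)
        ... | inj₂ e = false , sym (==⇒≡ e)

        side-choose : ∀ s → side s (choose s i j) ≡ true
        side-choose true = proj₁ (valid⇒side i j ij)
        side-choose false = proj₂ (valid⇒side i j ij)

        seed⊆C : seed ⊆ C
        seed⊆C a h with seed⇒ a h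
        ... | s , refl = trans (side-node s _) (side-choose s)

        crossing : ∀ S → seed ⊆ S → S ⊆ C → ∀ b → C b ≡ true → S b ≡ false →
          ∃₂ λ x y → S x ≡ true × C y ≡ true × S y ≡ false × nodeAdj y x ≡ true
        crossing S s⊆ ⊆C b Cb Sb with Cr.connected C good min S ⊆C (node true i) (s⊆ _ (seed-node true)) b Cb Sb
        ... | x , y , Sx , Cy , Sy , pos = x , y , Sx , Cy , Sy , eN>0⇒ x y (⊆C x Sx) Cy pos

        open Spanning C seed nodeAdj seed⊆C crossing using (SpanningForest; spanningForest)
        module _ (forest : SpanningForest) where

          open SpanningForest forest

          -- At an end of the pair the walk moves to the other end; elsewhere it follows the forest.
          nextNode : Bool → Fin m → Fin (m + m)
          nextNode s h = if seed (node s h) then node (not s) (choose (not s) i j) else par (node s h)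

          nextNode-seed : ∀ s h → seed (node s h) ≡ true → nextNode s h ≡ node (not s) (choose (not s) i j)
          nextNode-seed s h e rewrite e = refl

          nextNode-par : ∀ s h → seed (node s h) ≡ false → nextNode s h ≡ par (node s h)
          nextNode-par s h e rewrite e = refl

          seed⇒choose : ∀ s h → seed (node s h) ≡ true → h ≡ choose s i j
          seed⇒choose s h e with seed⇒ (node s h) e
          ... | s′ , eq with trans (sym (sgn-node s h)) (trans (cong (sgn ∘ sp) eq) (sgn-node s′ (choose s′ i j)))
          ...   | refl = trans (sym (cl-node s h)) (trans (cong (cluster ∘ sp) eq) (cl-node s (choose s i j)))

          link-choose : ∀ s → orientedBy valid s (choose s i j) (choose (not s) i j) ≡ true
          link-choose true = ij
          link-choose false = ij

          par-split : ∀ s h → side s h ≡ true → seed (node s h) ≡ false →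
            sgn (sp (par (node s h))) ≡ not s × orientedBy valid s h (cluster (sp (par (node s h)))) ≡ true
          par-split s h sh ns with ∧-elim {does (sgn (sp (par (node s h))) Bool.≟ not (sgn (sp (node s h))))} (par-adj (node s h) (trans (side-node s h) sh) ns)
          ... | p , q = trans (true⇒Dec (_ Bool.≟ _) p) (cong not (sgn-node s h)) ,
            subst₂ (λ t x → orientedBy valid t x (cluster (sp (par (node s h)))) ≡ true) (sgn-node s h) (cl-node s h) q

          steeringFrom : Steering side valid i j
          steeringFrom = record
            { next = λ s h → cluster (sp (nextNode s h))
            ; dist = λ s h → rank (node s h)
            ; next-link = next-link
            ; dist≤ = λ s h sh → rank≤ (node s h) (trans (side-node s h) sh)
            ; dist-next = dist-next
            ; dist-0 = dist-0
            ; dist-target = λ s → seed-rank _ (seed-node s) }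
            where
            next-link : ∀ s h → side s h ≡ true → orientedBy valid s h (cluster (sp (nextNode s h))) ≡ true
            next-link s h sh = go (seed (node s h)) refl
              where
              go : ∀ b → seed (node s h) ≡ b → orientedBy valid s h (cluster (sp (nextNode s h))) ≡ true
              go true e = subst₂ (λ x y → orientedBy valid s x y ≡ true) (sym (seed⇒choose s h e))
                (sym (trans (cong (cluster ∘ sp) (nextNode-seed s h e)) (cl-node (not s) _))) (link-choose s)
              go false e = subst (λ y → orientedBy valid s h (cluster (sp y)) ≡ true) (sym (nextNode-par s h e)) (proj₂ (par-split s h sh e))
            dist-next : ∀ s h → side s h ≡ true → rank (node (not s) (cluster (sp (nextNode s h)))) ≤ pred (rank (node s h))
            dist-next s h sh = go (seed (node s h)) refl
              where
              go : ∀ b → seed (node s h) ≡ b → rank (node (not s) (cluster (sp (nextNode s h)))) ≤ pred (rank (node s h))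
              go true e = ≤-trans (≤-reflexive (trans (cong rank (trans (cong (node (not s) ∘ cluster ∘ sp) (nextNode-seed s h e)) (cong (node (not s)) (cl-node (not s) _))))
                (seed-rank _ (seed-node (not s))))) z≤n
              go false e = ≤-reflexive (trans (cong rank (trans (cong (node (not s) ∘ cluster ∘ sp) (nextNode-par s h e))
                  (trans (cong (λ t → node t (cluster (sp (par (node s h))))) (sym (proj₁ (par-split s h sh e)))) (node-sp _))))
                (sym (cong pred (par-rank (node s h) (trans (side-node s h) sh) e))))
            dist-0 : ∀ s h → side s h ≡ true → rank (node s h) ≡ 0 → h ≡ choose s i j
            dist-0 s h sh r0 = go (seed (node s h)) refl
              where
              0≢suc : ∀ {x} → 0 ≢ suc x
              0≢suc ()
              go : ∀ b → seed (node s h) ≡ b → h ≡ choose s i j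
              go true e = seed⇒choose s h e
              go false e = ⊥-elim (0≢suc (trans (sym r0) (par-rank (node s h) (trans (side-node s h) sh) e)))

        steering : Steering side valid i j
        steering = steeringFrom spanningForest

      reducedFrom : Matching adj d → ReducedGraph D c R d
      reducedFrom M with orient (Matching.pairs M) (Matching.areEdges M)
      ... | Q , len , val , cov = record
        { side = side ; valid = valid ; valid⇒R = λ i j h → proj₁ (∧-elim {R i j} h) ; valid⇒side = valid⇒side
        ; steer = steering ; pairs = Q ; size-pairs = trans len (Matching.size M) ; pairs-valid = val
        ; pairs-disjoint = λ w → ≤-trans (≤-reflexive (cov w)) (Matching.disjoint M w) }

      reduced : ReducedGraph D c R d
      reduced = reducedFrom (matching adj adj-irr W d adj-degree bigW)

    reducedGraph : ReducedGraph D c R d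
    reducedGraph with Cr.minimal everything good-all
    ... | C , good , min = WithCore.reduced C good min

  -- Rooted antidirected trees

  length-filter : ∀ {A : Set} (p : A → Bool) {n} (f : Fin n → A) →
    length (filter (λ x → Bool.T? (p x)) (tabulate f)) ≡ ∑ (λ i → ⟦ p (f i) ⟧)
  length-filter p {zero} f = sym (∑-empty _)
  length-filter p {suc n} f with p (f zero) in eq
  ... | true = trans (cong suc (length-filter p (f ∘ suc))) (sym (trans (∑-suc _) (cong (λ b → ⟦ b ⟧ + ∑ (λ i → ⟦ p (f (suc i)) ⟧)) eq)))
  ... | false = trans (length-filter p (f ∘ suc)) (sym (trans (∑-suc _) (cong (λ b → ⟦ b ⟧ + ∑ (λ i → ⟦ p (f (suc i)) ⟧)) eq)))

  length-filter-map : ∀ {A B : Set} (p : B → Bool) (g : A → B) {n} (f : Fin n → A) →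
    length (filter (λ x → Bool.T? (p x)) (map g (tabulate f))) ≡ ∑ (λ i → ⟦ p (g (f i)) ⟧)
  length-filter-map p g {zero} f = sym (∑-empty _)
  length-filter-map p g {suc n} f with p (g (f zero)) in eq
  ... | true = trans (cong suc (length-filter-map p g (f ∘ suc))) (sym (trans (∑-suc _) (cong (λ b → ⟦ b ⟧ + ∑ (λ i → ⟦ p (g (f (suc i))) ⟧)) eq)))
  ... | false = trans (length-filter-map p g (f ∘ suc)) (sym (trans (∑-suc _) (cong (λ b → ⟦ b ⟧ + ∑ (λ i → ⟦ p (g (f (suc i))) ⟧)) eq)))

  length-filter-concatMap : ∀ {A B : Set} (p : B → Bool) (g : A → List B) {n} (f : Fin n → A) →
    length (filter (λ x → Bool.T? (p x)) (concatMap g (tabulate f))) ≡ ∑ (λ i → length (filter (λ x → Bool.T? (p x)) (g (f i))))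
  length-filter-concatMap p g {zero} f = sym (∑-empty _)
  length-filter-concatMap p g {suc n} f = trans (cong length (filter-++ (λ x → Bool.T? (p x)) (g (f zero)) _))
    (trans (length-++ (filter (λ x → Bool.T? (p x)) (g (f zero)))) (trans (cong (length (filter (λ x → Bool.T? (p x)) (g (f zero))) +_) (length-filter-concatMap p g (f ∘ suc))) (sym (∑-suc _))))

  edgeCount≡∑ : ∀ {n} (D : Digraph n) → edgeCount D ≡ ∑ (λ u → ∑ (λ v → ⟦ D u v ⟧))
  edgeCount≡∑ {n} D = trans (length-filter-concatMap (λ p → D (proj₁ p) (proj₂ p)) _ id)
    (∑-cong (λ u → length-filter-map (λ p → D (proj₁ p) (proj₂ p)) (λ v → (u , v)) id))

  any-true : ∀ {A : Set} (p : A → Bool) {n} (f : Fin n → A) i → p (f i) ≡ true → any p (tabulate f) ≡ true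
  any-true p f zero h rewrite h = refl
  any-true p f (suc i) h rewrite any-true p (f ∘ suc) i h = Bool.∨-zeroʳ _

  any-false : ∀ {A : Set} (p : A → Bool) {n} (f : Fin n → A) → (∀ i → p (f i) ≡ false) → any p (tabulate f) ≡ false
  any-false p {zero} f h = refl
  any-false p {suc n} f h rewrite h zero = any-false p (f ∘ suc) (h ∘ suc)

  record RootedTree {N} (T : Digraph N) (root : Fin N) (Δ : ℕ) : Set where
    field
      par : Fin N → Fin N
      rank : Fin N → ℕ
      source : Fin N → Bool
      rank-root : rank root ≡ 0
      rank-par : ∀ v → v ≢ root → rank v ≡ suc (rank (par v))
      source-par : ∀ v → v ≢ root → source v ≡ not (source (par v))
      edge : ∀ u v → T u v ≡ true → source u ≡ true × source v ≡ false × ((v ≢ root × par v ≡ u) ⊎ (u ≢ root × par u ≡ v))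
      children≤ : ∀ u → card (λ v → not (root == v) ∧ (par v == u)) ≤ Δ
      balanced : card source ≡ card (λ v → not (source v))

  module _ {k} (T : Digraph (suc k)) (k>0 : 0 < k) (anti : IsAntidirected T)
    (conn : Connected T) (count : edgeCount T ≡ k) (bal : IsBalanced T) {Δ} (maxdeg : MaxDegree≤ T Δ) where

    private
      N : ℕ
      N = suc k
      root : Fin N
      root = zero

    cross : ∀ (S : Fin N → Bool) {x b} → Walk T x b → S x ≡ true → S b ≡ false →
      ∃₂ λ x y → S x ≡ true × S y ≡ false × uadj T y x ≡ true
    cross S here Sx Sb = ⊥-elim (true≢false Sx Sb)
    cross S {x} {b} (step {v = v} xv w) Sx Sb with S v in Sv
    ... | true = cross S w Sv Sb
    ... | false = x , v , Sx , Sv , trans (Bool.∨-comm (T v x) (T x v)) xv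

    crossing : ∀ S → (root ==_) ⊆ S → S ⊆ (λ _ → true) → ∀ b → true ≡ true → S b ≡ false →
      ∃₂ λ x y → S x ≡ true × true ≡ true × S y ≡ false × uadj T y x ≡ true
    crossing S s⊆ _ b _ Sb with cross S (conn root b) (s⊆ root (==-refl root)) Sb
    ... | x , y , Sx , Sy , yx = x , y , Sx , refl , Sy , yx

    open Spanning {N} (λ _ → true) (root ==_) (uadj T) (λ _ _ → refl) crossing using (SpanningForest; spanningForest)

    σ : Fin N → Bool
    σ = isSource T

    edge⇒σ : ∀ u v → T u v ≡ true → σ u ≡ true × σ v ≡ false
    edge⇒σ u v uv = cong not (any-false (λ w → T w u) id (λ w → ¬true⇒false (λ wu → true≢false uv (anti w u v wu)))) ,
      cong not (any-true (λ w → T w v) id u uv)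

    edge⇒sink : ∀ u v → T u v ≡ true → isSink T u ≡ false × isSink T v ≡ true
    edge⇒sink u v uv = cong not (any-true (λ w → T u w) id v uv) ,
      cong not (any-false (λ w → T v w) id (λ w → anti u v w uv))

    uadj⇒flip : ∀ u v → uadj T u v ≡ true → σ u ≡ not (σ v)
    uadj⇒flip u v h with ∨-elim {T u v} h
    ... | inj₁ p = trans (proj₁ (edge⇒σ u v p)) (cong not (sym (proj₂ (edge⇒σ u v p))))
    ... | inj₂ p = trans (proj₂ (edge⇒σ v u p)) (cong not (sym (proj₁ (edge⇒σ v u p))))

    uadj⇒sink : ∀ u v → uadj T u v ≡ true → isSink T u ≡ not (σ u)
    uadj⇒sink u v h with ∨-elim {T u v} h
    ... | inj₁ p = trans (proj₁ (edge⇒sink u v p)) (cong not (sym (proj₁ (edge⇒σ u v p))))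
    ... | inj₂ p = trans (proj₂ (edge⇒sink v u p)) (cong not (sym (proj₂ (edge⇒σ v u p))))

    -- Rules out isolated vertices, which would be sources and sinks at once, so that the sinks are
    -- exactly the complement of the sources.
    hasNeighbour : ∀ u → ∃ λ v → uadj T u v ≡ true
    hasNeighbour u = go (other k u k>0)
      where
      other : ∀ k (u : Fin (suc k)) → 0 < k → ∃ λ v → u ≢ v
      other (suc k) zero _ = suc zero , λ ()
      other (suc k) (suc u) _ = zero , λ ()
      first : ∀ {v} → Walk T u v → u ≢ v → ∃ λ v → uadj T u v ≡ true
      first here ne = ⊥-elim (ne refl)
      first (step {v = w} h _) _ = w , h
      go : (∃ λ v → u ≢ v) → ∃ λ v → uadj T u v ≡ true
      go (v , ne) = first (conn u v) ne

    balanced-σ : card σ ≡ card (λ v → not (σ v))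
    balanced-σ = trans (sym (length-filter σ id)) (trans (sym bal) (trans (length-filter (isSink T) id)
      (card-cong (λ v → uadj⇒sink v (proj₁ (hasNeighbour v)) (proj₂ (hasNeighbour v))))))

    module _ (forest : SpanningForest) where
      open SpanningForest forest

      nr : Fin N → Bool
      nr v = not (root == v)

      ¬root : ∀ v → v ≢ root → (root == v) ≡ false
      ¬root v ne = ≢⇒== (ne ∘ sym)

      pe : Fin N → Fin N → ℕ
      pe u v = ⟦ nr v ∧ (par v == u) ⟧

      pe⇒ : ∀ u v → nr v ∧ (par v == u) ≡ true → v ≢ root × par v ≡ u
      pe⇒ u v h with ∧-elim {nr v} h
      ... | p , q = (λ e → ==⇒≢ (not-elim p) (sym e)) , ==⇒≡ q

      pe+pe≤1 : ∀ u v → pe u v + pe v u ≤ 1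
      pe+pe≤1 u v = aux (nr v ∧ (par v == u)) (nr u ∧ (par u == v)) (λ p q → cyc (pe⇒ u v p) (pe⇒ v u q))
        where
        aux : ∀ a b → (a ≡ true → b ≡ true → ⊥) → ⟦ a ⟧ + ⟦ b ⟧ ≤ 1
        aux true true h = ⊥-elim (h refl refl)
        aux true false h = ≤-refl
        aux false b h = ⟦⟧≤1 b
        cyc : v ≢ root × par v ≡ u → u ≢ root × par u ≡ v → ⊥
        cyc (v≢ , pv) (u≢ , pu) = <-asym lt₁ lt₂
          where
          lt₁ : rank u < rank v
          lt₁ = ≤-reflexive (sym (trans (par-rank v refl (¬root v v≢)) (cong (suc ∘ rank) pv)))
          lt₂ : rank v < rank u
          lt₂ = ≤-reflexive (sym (trans (par-rank u refl (¬root u u≢)) (cong (suc ∘ rank) pu)))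

      treeEdge : Fin N → Fin N → ℕ
      treeEdge u v = ⟦ T u v ⟧ * (pe u v + pe v u)

      treeEdge≤ : ∀ u v → treeEdge u v ≤ ⟦ T u v ⟧
      treeEdge≤ u v = ≤-trans (*-monoʳ-≤ ⟦ T u v ⟧ (pe+pe≤1 u v)) (≤-reflexive (*-identityʳ _))

      card-nr : card nr ≡ k
      card-nr = +-cancelˡ-≡ 1 _ _ (trans (cong (_+ card nr) (sym (∑-δ1 root)))
        (trans (sym (∑-distrib-+ _ _)) (trans (∑-cong (λ v → ⟦not⟧ (root == v))) (trans (∑-const N 1) (*-identityʳ N)))))

      treeEdges≥k : k ≤ ∑ (λ u → ∑ (λ v → treeEdge u v))
      treeEdges≥k = ≤-trans (≤-reflexive (sym card-nr)) (≤-trans (∑-mono pt) (≤-reflexive (sym total)))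
        where
        expand : ∀ t a b x y → t * (a * x + b * y) ≡ x * (t * a) + y * (t * b)
        expand = solve-∀
        total : ∑ (λ u → ∑ (λ v → treeEdge u v)) ≡ ∑ (λ v → ⟦ T (par v) v ⟧ * ⟦ nr v ⟧ + ⟦ T v (par v) ⟧ * ⟦ nr v ⟧)
        total = trans (∑∑-cong (λ u v → trans (cong₂ (λ x y → ⟦ T u v ⟧ * (x + y)) (⟦∧⟧ (nr v) _) (⟦∧⟧ (nr u) _))
            (expand ⟦ T u v ⟧ ⟦ nr v ⟧ ⟦ nr u ⟧ ⟦ par v == u ⟧ ⟦ par u == v ⟧)))
          (trans (∑∑-+ _ _) (trans (cong₂ _+_ (trans (∑-comm _) (∑-cong (λ v → ∑-δ (par v) (λ u → ⟦ T u v ⟧ * ⟦ nr v ⟧))))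
            (∑-cong (λ u → ∑-δ (par u) (λ v → ⟦ T u v ⟧ * ⟦ nr u ⟧)))) (sym (∑-distrib-+ _ _))))
        cover : ∀ a b → a ∨ b ≡ true → 1 ≤ ⟦ b ⟧ * 1 + ⟦ a ⟧ * 1
        cover true true _ = s≤s z≤n
        cover true false _ = s≤s z≤n
        cover false true _ = s≤s z≤n
        pt : ∀ v → ⟦ nr v ⟧ ≤ ⟦ T (par v) v ⟧ * ⟦ nr v ⟧ + ⟦ T v (par v) ⟧ * ⟦ nr v ⟧
        pt v with root == v in eq
        ... | true = z≤n
        ... | false = cover (T v (par v)) (T (par v) v) (par-adj v refl eq)

      -- The edges to parents already number `k`, which is the number of all edges; a sum that
      -- attains its termwise bound attains it in every term.
      allTreeEdges : ∀ u v → treeEdge u v ≡ ⟦ T u v ⟧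
      allTreeEdges u = ∑-≤⇒≡ (treeEdge≤ u) (≤-reflexive (sym (∑-≤⇒≡ (λ u → ∑-mono (treeEdge≤ u))
        (≤-trans (≤-reflexive (trans (sym (edgeCount≡∑ T)) count)) treeEdges≥k) u)))

      isParent : ∀ u v → T u v ≡ true → (v ≢ root × par v ≡ u) ⊎ (u ≢ root × par u ≡ v)
      isParent u v uv = aux (nr v ∧ (par v == u)) (nr u ∧ (par u == v)) (pe⇒ u v) (pe⇒ v u)
          (trans (sym (+-identityʳ _)) (trans (cong (λ b → ⟦ b ⟧ * (pe u v + pe v u)) (sym uv)) (trans (allTreeEdges u v) (cong ⟦_⟧ uv))))
        where
        aux : ∀ a b {A B : Set} → (a ≡ true → A) → (b ≡ true → B) → ⟦ a ⟧ + ⟦ b ⟧ ≡ 1 → A ⊎ B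
        aux true b f g _ = inj₁ (f refl)
        aux false true f g _ = inj₂ (g refl)

      rootedFrom : RootedTree T root Δ
      rootedFrom = record
        { par = par ; rank = rank ; source = σ
        ; rank-root = seed-rank root refl
        ; rank-par = λ v ne → par-rank v refl (¬root v ne)
        ; source-par = λ v ne → uadj⇒flip v (par v) (par-adj v refl (¬root v ne))
        ; edge = λ u v uv → proj₁ (edge⇒σ u v uv) , proj₂ (edge⇒σ u v uv) , isParent u v uv
        ; children≤ = λ u → ≤-trans (card-mono (child u)) (≤-trans (≤-reflexive (sym (length-filter (uadj T u) id))) (maxdeg u))
        ; balanced = balanced-σ }
        where
        child : ∀ u v → nr v ∧ (par v == u) ≡ true → uadj T u v ≡ true
        child u v h with pe⇒ u v h
        ... | ne , refl = trans (Bool.∨-comm (T (par v) v) _) (par-adj v refl (¬root v ne))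

    rootedTree : RootedTree T root Δ
    rootedTree = rootedFrom spanningForest

  -- Cutting a tree into pieces and packing the pieces

  sumBelow : ℕ → (ℕ → ℕ) → ℕ
  sumBelow zero f = 0
  sumBelow (suc h) f = sumBelow h f + f h

  sumBelow-shift : ∀ h f → sumBelow (suc h) f ≡ f 0 + sumBelow h (f ∘ suc)
  sumBelow-shift zero f = sym (+-identityʳ (f 0))
  sumBelow-shift (suc h) f = trans (cong (_+ f (suc h)) (sumBelow-shift h f)) (+-assoc (f 0) _ _)

  sumBelow-cong : ∀ h {f g : ℕ → ℕ} → (∀ o → o < h → f o ≡ g o) → sumBelow h f ≡ sumBelow h g
  sumBelow-cong zero e = refl
  sumBelow-cong (suc h) e = cong₂ _+_ (sumBelow-cong h (λ o lt → e o (m<n⇒m<1+n lt))) (e h ≤-refl)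

  sumBelow-∑ : ∀ h {n} (f : ℕ → Fin n → ℕ) → sumBelow h (λ o → ∑ (f o)) ≡ ∑ (λ v → sumBelow h (λ o → f o v))
  sumBelow-∑ zero f = sym (∑-zero (λ _ → refl))
  sumBelow-∑ (suc h) f = trans (cong (_+ ∑ (f h)) (sumBelow-∑ h f)) (sym (∑-distrib-+ _ _))

  average : ∀ h f → ∃ λ o → o ≤ h × suc h * f o ≤ sumBelow (suc h) f
  average zero f = 0 , z≤n , ≤-reflexive (+-identityʳ (f 0))
  average (suc h) f with average h f
  ... | o , o≤ , le with f (suc h) ≤? f o
  ...   | yes p = suc h , ≤-refl , ≤-trans (+-monoʳ-≤ (f (suc h)) (≤-trans (*-monoʳ-≤ (suc h) p) le)) (≤-reflexive (+-comm (f (suc h)) _))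
  ...   | no p = o , m≤n⇒m≤1+n o≤ , ≤-trans (+-mono-≤ (<⇒≤ (≰⇒> p)) le) (≤-reflexive (+-comm (f (suc h)) _))

  below : ℕ → ℕ → Bool
  below L y = does (y <? L)

  sumBelow-below : ∀ h L → sumBelow h (λ o → ⟦ below L o ⟧) ≤ L
  sumBelow-below h L = ≤-trans (go h) (m⊓n≤n h L)
    where
    go : ∀ h → sumBelow h (λ o → ⟦ below L o ⟧) ≤ h ⊓ L
    go zero = z≤n
    go (suc h) with below L h in eq
    ... | true = ≤-trans (≤-trans (+-monoˡ-≤ 1 (go h)) (≤-reflexive (trans (cong (_+ 1) (m≤n⇒m⊓n≡m (<⇒≤ lt))) (+-comm h 1)))) (≤-reflexive (sym (m≤n⇒m⊓n≡m lt)))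
      where lt = true⇒Dec (h <? L) eq
    ... | false = ≤-trans (≤-reflexive (+-identityʳ _)) (≤-trans (go h) (⊓-monoˡ-≤ L (n≤1+n h)))

  -- A cyclic counter with values 0 … h.
  module Counter (h : ℕ) where

    advance : ℕ → ℕ
    advance y = if below h y then suc y else 0

    advance-below : ∀ {y} → y < h → advance y ≡ suc y
    advance-below {y} lt rewrite Dec⇒true (y <? h) lt = refl

    advance-top : advance h ≡ 0
    advance-top rewrite ¬true⇒false {below h h} (<-irrefl refl ∘ true⇒Dec (h <? h)) = refl

    advance≤ : ∀ y → advance y ≤ h
    advance≤ y with below h y in eq
    ... | true = true⇒Dec (y <? h) eq
    ... | false = z≤n

    advance≢0 : ∀ y → advance y ≢ 0 → advance y ≡ suc y
    advance≢0 y ne with below h y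
    ... | true = refl
    ... | false = ⊥-elim (ne refl)

    count : ℕ → ℕ → ℕ
    count o zero = o
    count o (suc x) = advance (count o x)

    count≤ : ∀ {o} → o ≤ h → ∀ x → count o x ≤ h
    count≤ le zero = le
    count≤ le (suc x) = advance≤ _

    sum-advance : ∀ f → sumBelow (suc h) (f ∘ advance) ≡ sumBelow (suc h) f
    sum-advance f = trans (cong₂ _+_ (sumBelow-cong h (λ o lt → cong f (advance-below lt))) (cong f advance-top))
      (trans (+-comm _ (f 0)) (sym (sumBelow-shift h f)))

    sum-count : ∀ x f → sumBelow (suc h) (λ o → f (count o x)) ≡ sumBelow (suc h) f
    sum-count zero f = refl
    sum-count (suc x) f = trans (sum-count x (f ∘ advance)) (sum-advance f)

    -- As the offset runs through its `h + 1` values, a vertex passes through every level once and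
    -- thus is below `L` at most `L` times.
    few-below : ∀ {n} (rank : Fin n → ℕ) L →
      ∃ λ o → o ≤ h × suc h * card (λ v → below L (count o (rank v))) ≤ n * L
    few-below {n} rank L with average h (λ o → card (λ v → below L (count o (rank v))))
    ... | o , o≤ , le = o , o≤ , ≤-trans le (≤-trans (≤-reflexive (trans (sumBelow-∑ (suc h) _)
          (∑-cong (λ v → sum-count (rank v) (λ y → ⟦ below L y ⟧))))) (≤-trans (∑-mono (λ v → sumBelow-below (suc h) L)) (≤-reflexive (∑-const n L))))

  module Pieces {N} {T : Digraph N} {root : Fin N} {Δ : ℕ} (tree : RootedTree T root Δ) (h o : ℕ) (o≤h : o ≤ h) where
    open RootedTree tree
    open Counter h

    induction : ∀ (P : Fin N → Set) → P root → (∀ v → v ≢ root → P (par v) → P v) → ∀ v → P v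
    induction P base ind v = go (rank v) v refl
      where
      go : ∀ f v → rank v ≡ f → P v
      go f v eq with v Fin.≟ root
      ... | yes refl = base
      go zero v eq | no ne = ⊥-elim (0≢1+n (trans (sym eq) (rank-par v ne)))
      go (suc f) v eq | no ne = ind v ne (go f (par v) (suc-injective (trans (sym (rank-par v ne)) eq)))

    level : Fin N → ℕ
    level v = count o (rank v)

    level≤h : ∀ v → level v ≤ h
    level≤h v = count≤ o≤h (rank v)

    level-par : ∀ v → v ≢ root → level v ≡ advance (level (par v))
    level-par v ne = cong (count o) (rank-par v ne)

    pieceFuel : ℕ → Fin N → Fin N
    pieceFuel zero v = v
    pieceFuel (suc f) v = if does (level v ≟ 0) then v else pieceFuel f (par v)

    -- A piece is named by its top vertex: the nearest ancestor on level 0, or else the root, whose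
    -- own piece starts on level `o`.
    piece : Fin N → Fin N
    piece v = pieceFuel (rank v) v

    piece-root : piece root ≡ root
    piece-root = cong (λ f → pieceFuel f root) rank-root

    piece-start : ∀ v → level v ≡ 0 → piece v ≡ v
    piece-start v eq = go (rank v)
      where
      go : ∀ f → pieceFuel f v ≡ v
      go zero = refl
      go (suc f) = cong (λ b → if b then v else pieceFuel f (par v)) (Dec⇒true (level v ≟ 0) eq)

    piece-par : ∀ v → v ≢ root → level v ≢ 0 → piece v ≡ piece (par v)
    piece-par v ne lv = trans (cong (λ f → pieceFuel f v) (rank-par v ne)) (aux (does (level v ≟ 0)) refl)
      where
      aux : ∀ b → does (level v ≟ 0) ≡ b → (if b then v else pieceFuel (rank (par v)) (par v)) ≡ piece (par v)
      aux true eq = ⊥-elim (lv (true⇒Dec (level v ≟ 0) eq))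
      aux false eq = refl

    -- The level bounds the depth in the piece; in the piece of the root the two differ by the
    -- offset.
    piece-rank : ∀ v → rank v ≤ rank (piece v) + level v × rank (piece v) ≤ rank v
    piece-rank = induction _ (≤-trans (≤-reflexive rank-root) z≤n , ≤-reflexive (cong rank piece-root)) descend
      where
      descend : ∀ v → v ≢ root → (rank (par v) ≤ rank (piece (par v)) + level (par v) × rank (piece (par v)) ≤ rank (par v)) →
        rank v ≤ rank (piece v) + level v × rank (piece v) ≤ rank v
      descend v ne (ih₁ , ih₂) with level v ≟ 0
      ... | yes l0 = ≤-trans (≤-reflexive (cong rank (sym (piece-start v l0)))) (m≤m+n _ _) , ≤-reflexive (cong rank (piece-start v l0))
      ... | no l≢0 rewrite piece-par v ne l≢0 | rank-par v ne =
        ≤-trans (s≤s ih₁) (≤-reflexive (trans (sym (+-suc (rank (piece (par v))) _)) (cong (rank (piece (par v)) +_) (sym (advance≢0 _ l≢0))))) ,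
        ≤-trans ih₂ (n≤1+n _)

    inPiece : Fin N → ℕ → Fin N → Bool
    inPiece r l v = (r == piece v) ∧ does (rank v ≤? rank r + l)

    inPiece-split : ∀ r l v → inPiece r (suc l) v ≡ true → r ≡ v ⊎ (v ≢ root × inPiece r l (par v) ≡ true)
    inPiece-split r l v h with ∧-elim {r == piece v} h | level v ≟ 0 | v Fin.≟ root
    ... | p , q | yes l0 | _ = inj₁ (trans (==⇒≡ p) (piece-start v l0))
    ... | p , q | no _ | yes refl = inj₁ (trans (==⇒≡ p) piece-root)
    ... | p , q | no l≢0 | no ne = inj₂ (ne , ∧-intro (trans (cong (r ==_) (sym (piece-par v ne l≢0))) p)
        (Dec⇒true (rank (par v) ≤? rank r + l) (s≤s⁻¹ (≤-trans (≤-reflexive (sym (rank-par v ne))) (≤-trans (true⇒Dec (rank v ≤? rank r + suc l) q) (≤-reflexive (+-suc (rank r) l)))))))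

    inPiece-zero : ∀ r v → inPiece r 0 v ≡ true → r ≡ v
    inPiece-zero r v h with ∧-elim {r == piece v} h | level v ≟ 0 | v Fin.≟ root
    ... | p , q | yes l0 | _ = trans (==⇒≡ p) (piece-start v l0)
    ... | p , q | no _ | yes refl = trans (==⇒≡ p) piece-root
    ... | p , q | no l≢0 | no ne = ⊥-elim (<⇒≱ (≤-trans (s≤s (≤-trans (≤-reflexive (cong rank (trans (==⇒≡ p) (piece-par v ne l≢0)))) (proj₂ (piece-rank (par v))))) (≤-reflexive (sym (rank-par v ne))))
        (≤-trans (true⇒Dec (rank v ≤? rank r + 0) q) (≤-reflexive (+-identityʳ (rank r)))))

    card-inPiece : ∀ r l → card (inPiece r l) ≤ suc Δ ^ l
    card-inPiece r zero = ≤-trans (∑-mono (λ v → ⟦⟧-mono {inPiece r 0 v} {r == v} (λ h → trans (cong (r ==_) (sym (inPiece-zero r v h))) (==-refl r)))) (≤-reflexive (∑-δ1 r))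
    card-inPiece r (suc l) = ≤-trans (∑-mono pt) (≤-trans (≤-reflexive (trans (∑-distrib-+ _ _) (cong₂ _+_ (∑-δ1 r) (∑-comm _))))
        (≤-trans (+-monoʳ-≤ 1 (≤-trans (∑-mono (λ u → ≤-trans (≤-reflexive (∑-*ˡ ⟦ inPiece r l u ⟧ _)) (*-monoʳ-≤ ⟦ inPiece r l u ⟧ (children≤ u))))
          (≤-reflexive (∑-*ʳ (λ u → ⟦ inPiece r l u ⟧) Δ))))
        (≤-trans (+-mono-≤ (m^n>0 (suc Δ) l) (*-monoˡ-≤ Δ (card-inPiece r l))) (≤-reflexive (cong (suc Δ ^ l +_) (*-comm (suc Δ ^ l) Δ))))))
      where
      pt : ∀ v → ⟦ inPiece r (suc l) v ⟧ ≤ ⟦ r == v ⟧ + ∑ (λ u → ⟦ inPiece r l u ⟧ * ⟦ not (root == v) ∧ (par v == u) ⟧)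
      pt v with inPiece r (suc l) v in eq
      ... | false = z≤n
      ... | true with inPiece-split r l v eq
      ...   | inj₁ refl rewrite ==-refl r = s≤s z≤n
      ...   | inj₂ (ne , ip) = ≤-trans (≤-trans (≤-reflexive one) (∑-term _ (par v))) (m≤n+m _ ⟦ r == v ⟧)
        where
        one : 1 ≡ ⟦ inPiece r l (par v) ⟧ * ⟦ not (root == v) ∧ (par v == par v) ⟧
        one rewrite ip | ≢⇒== (ne ∘ sym) | ==-refl (par v) = refl

    piece-size : ∀ r → card (λ v → r == piece v) ≤ suc Δ ^ h
    piece-size r = ≤-trans (card-mono (λ v e → ∧-intro e (Dec⇒true (rank v ≤? rank r + h)
      (≤-trans (proj₁ (piece-rank v)) (+-mono-≤ (≤-reflexive (cong rank (sym (==⇒≡ e)))) (level≤h v)))))) (card-inPiece r h)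

  -- Items of two sizes, to be the numbers of sources and of sinks in a piece, and bins with the
  -- same capacity for both. An index that is not the top of a piece will be an item of size zero.
  module Packing {N} (a b : Fin N → ℕ) (s : ℕ) (s>0 : 0 < s) (a≤s : ∀ r → a r ≤ s) (b≤s : ∀ r → b r ≤ s) where

    total : (Fin N → ℕ) → (Fin N → Bool) → ℕ
    total w I = ∑ (λ r → ⟦ I r ⟧ * w r)

    -- Kept for the items not yet packed: then a bin that is full in one size is nearly full in the
    -- other.
    Balanced : (Fin N → Bool) → Set
    Balanced I = total a I ≤ total b I + s × total b I ≤ total a I + s

    _-_ : (Fin N → Bool) → Fin N → Fin N → Bool
    (I - x) r = I r ∧ not (x == r)

    total-remove : ∀ w I x → I x ≡ true → total w I ≡ total w (I - x) + w x
    total-remove w I x Ix = trans (∑-cong pt) (trans (∑-distrib-+ _ _) (cong (total w (I - x) +_) (∑-δ x w)))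
      where
      pt : ∀ r → ⟦ I r ⟧ * w r ≡ ⟦ I r ∧ not (x == r) ⟧ * w r + ⟦ x == r ⟧ * w r
      pt r with x Fin.≟ r
      ... | yes refl rewrite Ix = refl
      ... | no _ rewrite Bool.∧-identityʳ (I r) = sym (+-identityʳ _)

    card-remove : ∀ I x → I x ≡ true → card I ≡ suc (card (I - x))
    card-remove I x Ix = trans (∑-cong (λ r → sym (*-identityʳ _))) (trans (total-remove (λ _ → 1) I x Ix) (trans (+-comm _ 1) (cong suc (∑-cong (λ r → *-identityʳ _)))))

    -- Taking out an item that leans to the heavier side keeps the rest balanced.
    pick : ∀ I r → I r ≡ true → Balanced I → ∃ λ x → I x ≡ true × Balanced (I - x)
    pick I r Ir (A≤ , B≤) with total b I ≤? total a I
    ... | yes B≤A with Fin.any? (λ x → (I x Bool.≟ true) ×-dec (b x ≤? a x))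
    ...   | yes (x , Ix , bx≤ax) = x , Ix ,
            ≤-by 0 (A≤ ⊕ bx≤ax) (trans (cong (λ B → total a (I - x) + (B + s + a x) + 0) eB) (trans (i₁ _ (total b (I - x)) s (a x) (b x)) (cong (λ A → total b (I - x) + s + (A + b x)) (sym eA)))) ,
            ≤-by (b x) (B≤A ⊕ a≤s x) (trans (cong (λ A → total b (I - x) + (A + s) + b x) eA) (trans (i₂ _ (total b (I - x)) s (a x) (b x)) (cong (λ B → total a (I - x) + s + (B + a x)) (sym eB))))
      where
      eA = total-remove a I x Ix
      eB = total-remove b I x Ix
      i₁ : ∀ A′ B′ s ax bx → A′ + (B′ + bx + s + ax) + 0 ≡ B′ + s + (A′ + ax + bx)
      i₁ = solve-∀
      i₂ : ∀ A′ B′ s ax bx → B′ + (A′ + ax + s) + bx ≡ A′ + s + (B′ + bx + ax)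
      i₂ = solve-∀
    ...   | no ¬x = ⊥-elim (<⇒≱ (∑-mono-< (λ x → le x (I x) refl) r (subst (λ t → ⟦ t ⟧ * a r < ⟦ t ⟧ * b r) (sym Ir) (+-monoˡ-< 0 (lt r Ir)))) B≤A)
      where
      lt : ∀ x → I x ≡ true → a x < b x
      lt x Ix = ≰⇒> (λ h → ¬x (x , Ix , h))
      le : ∀ x t → I x ≡ t → ⟦ I x ⟧ * a x ≤ ⟦ I x ⟧ * b x
      le x true Ix = *-monoʳ-≤ ⟦ I x ⟧ (<⇒≤ (lt x Ix))
      le x false Ix rewrite Ix = z≤n
    pick I r Ir (A≤ , B≤) | no A<B with ∑-find (≰⇒> A<B)
    ... | x , lt = x , Ix ,
            ≤-by (a x) (<⇒≤ (≰⇒> A<B) ⊕ b≤s x) (trans (cong (λ A → total a (I - x) + (A + s) + a x) eB) (trans (i₂ _ (total a (I - x)) s (b x) (a x)) (cong (λ B → total b (I - x) + s + (B + b x)) (sym eA)))) ,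
            ≤-by 0 (B≤ ⊕ ax≤bx) (trans (cong (λ B → total b (I - x) + (B + s + b x) + 0) eA) (trans (i₁ _ (total a (I - x)) s (b x) (a x)) (cong (λ A → total a (I - x) + s + (A + a x)) (sym eB))))
      where
      aux : ∀ t → ⟦ t ⟧ * a x < ⟦ t ⟧ * b x → t ≡ true
      aux true _ = refl
      Ix : I x ≡ true
      Ix = aux (I x) lt
      ax≤bx : a x ≤ b x
      ax≤bx = <⇒≤ (subst₂ _<_ (+-identityʳ (a x)) (+-identityʳ (b x)) (subst (λ t → ⟦ t ⟧ * a x < ⟦ t ⟧ * b x) Ix lt))
      eA = total-remove a I x Ix
      eB = total-remove b I x Ix
      i₁ : ∀ A′ B′ s ax bx → A′ + (B′ + bx + s + ax) + 0 ≡ B′ + s + (A′ + ax + bx)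
      i₁ = solve-∀
      i₂ : ∀ A′ B′ s ax bx → B′ + (A′ + ax + s) + bx ≡ A′ + s + (B′ + bx + ax)
      i₂ = solve-∀

    -- `x` and `y` are the loads already in the bin. The final load, `x` plus the part of `I`
    -- outside `rest`, is expressed without subtraction.
    record Filled (κ : ℕ) (I : Fin N → Bool) (x y : ℕ) : Set where
      field
        rest : Fin N → Bool
        rest⊆ : rest ⊆ I
        rest-balanced : Balanced rest
        fits-a : x + total a I ≤ κ + total a rest
        fits-b : y + total b I ≤ κ + total b rest
        full : (∀ r → rest r ≡ false) ⊎ (κ + total a rest < x + total a I + s ⊎ κ + total b rest < y + total b I + s)

    fill : ∀ κ t I x y → card I ≤ t → Balanced I → x ≤ κ → y ≤ κ → Filled κ I x y
    fill κ t I x y fuel bal x≤ y≤ with Fin.any? (λ r → I r Bool.≟ true)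
    ... | no empty = record { rest = I ; rest⊆ = λ _ h → h ; rest-balanced = bal ; fits-a = +-monoˡ-≤ _ x≤ ; fits-b = +-monoˡ-≤ _ y≤
                            ; full = inj₁ (λ r → ¬true⇒false (λ h → empty (r , h))) }
    ... | yes (r , Ir) with x + s ≤? κ | y + s ≤? κ
    ...   | no x> | _ = record { rest = I ; rest⊆ = λ _ h → h ; rest-balanced = bal ; fits-a = +-monoˡ-≤ _ x≤ ; fits-b = +-monoˡ-≤ _ y≤
                        ; full = inj₂ (inj₁ (≤-trans (+-monoˡ-< (total a I) (≰⇒> x>)) (≤-reflexive (rearr x s _)))) }
      where
      rearr : ∀ x s t → x + s + t ≡ x + t + s
      rearr = solve-∀
    ...   | yes _ | no y> = record { rest = I ; rest⊆ = λ _ h → h ; rest-balanced = bal ; fits-a = +-monoˡ-≤ _ x≤ ; fits-b = +-monoˡ-≤ _ y≤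
                        ; full = inj₂ (inj₂ (≤-trans (+-monoˡ-< (total b I) (≰⇒> y>)) (≤-reflexive (rearr y s _)))) }
      where
      rearr : ∀ x s t → x + s + t ≡ x + t + s
      rearr = solve-∀
    fill κ zero I x y fuel bal x≤ y≤ | yes (r , Ir) | yes _ | yes _ = ⊥-elim (<⇒≱ (card-pos r Ir) fuel)
    fill κ (suc t) I x y fuel bal x≤ y≤ | yes (r , Ir) | yes xs≤ | yes ys≤ with pick I r Ir bal
    ... | z , Iz , bal′ = putBack (fill κ t (I - z) (x + a z) (y + b z) (s≤s⁻¹ (≤-trans (≤-reflexive (sym (card-remove I z Iz))) fuel)) bal′
            (≤-trans (+-monoʳ-≤ x (a≤s z)) xs≤) (≤-trans (+-monoʳ-≤ y (b≤s z)) ys≤))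
      where
      move : ∀ w x → x + w z + total w (I - z) ≡ x + total w I
      move w x = trans (rearr x (w z) _) (cong (x +_) (sym (total-remove w I z Iz)))
        where
        rearr : ∀ x u t → x + u + t ≡ x + (t + u)
        rearr = solve-∀
      putBack : Filled κ (I - z) (x + a z) (y + b z) → Filled κ I x y
      putBack F = record { rest = rest ; rest⊆ = λ r h → proj₁ (∧-elim {I r} (rest⊆ r h)) ; rest-balanced = rest-balanced
          ; fits-a = subst (_≤ κ + total a rest) (move a x) fits-a
          ; fits-b = subst (_≤ κ + total b rest) (move b y) fits-b
          ; full = Data.Sum.map₂ (Data.Sum.map (subst (λ q → κ + total a rest < q + s) (move a x)) (subst (λ q → κ + total b rest < q + s) (move b y))) full }
        where open Filled F

    Fits : ∀ {P} → (Fin P → ℕ) → (Fin N → Bool) → (Fin N → Fin P) → (Fin N → ℕ) → Set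
    Fits κ I f w = ∀ p → ∑ (λ r → ⟦ I r ∧ (f r == p) ⟧ * w r) ≤ κ p

    -- A bin that is closed while items remain wastes at most `3 * s` of its room for `a`: one `s`
    -- since another item might not fit, and, if it was `b` that ran full, two more for the
    -- imbalance before and after. The room for `b` thus needs no separate account.
    pack : ∀ P (κ : Fin P → ℕ) I → Balanced I → total a I + s + P * (3 * s) ≤ ∑ κ →
      ∃ λ (f : Fin N → Fin P) → Fits κ I f a × Fits κ I f b
    pack zero κ I bal room = ⊥-elim (<⇒≱ s>0 (≤-trans (≤-trans (m≤n+m s (total a I)) (m≤m+n _ 0)) (≤-trans room (≤-reflexive (∑-empty κ)))))
    pack (suc P) κ I bal room = go full
      where
      F : Filled (κ zero) I 0 0
      F = fill (κ zero) (card I) I 0 0 ≤-refl bal z≤n z≤n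
      open Filled F
      split : ∀ w → total w I ≡ ∑ (λ r → ⟦ I r ∧ not (rest r) ⟧ * w r) + total w rest
      split w = trans (∑-cong (λ r → pt (I r) (rest r) (w r) (rest⊆ r))) (∑-distrib-+ _ _)
        where
        pt : ∀ x y w → (y ≡ true → x ≡ true) → ⟦ x ⟧ * w ≡ ⟦ x ∧ not y ⟧ * w + ⟦ y ⟧ * w
        pt true true w h = refl
        pt true false w h = sym (+-identityʳ _)
        pt false true w h = ⊥-elim (true≢false (h refl) refl)
        pt false false w h = refl
      first : ∀ w → total w I ≤ κ zero + total w rest → ∑ (λ r → ⟦ I r ∧ not (rest r) ⟧ * w r) ≤ κ zero
      first w le = +-cancelʳ-≤ (total w rest) _ _ (≤-trans (≤-reflexive (sym (split w))) le)
      go : (∀ r → rest r ≡ false) ⊎ (κ zero + total a rest < total a I + s ⊎ κ zero + total b rest < total b I + s) →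
        ∃ λ (f : Fin N → Fin (suc P)) → Fits κ I f a × Fits κ I f b
      go (inj₁ none) = (λ _ → zero) , fits a fits-a , fits b fits-b
        where
        fits : ∀ w → total w I ≤ κ zero + total w rest → Fits κ I (λ _ → zero) w
        fits w le zero = ≤-trans (≤-reflexive (∑-cong (λ r → cong (λ t → ⟦ I r ∧ t ⟧ * w r) (sym (cong not (none r)))))) (first w le)
        fits w le (suc p) = ≤-trans (≤-reflexive (∑-zero (λ r → cong (λ t → ⟦ t ⟧ * w r) (Bool.∧-zeroʳ (I r))))) z≤n
      go (inj₂ over) = finish (pack P (κ ∘ suc) rest rest-balanced room′)
        where
        used : κ zero + total a rest ≤ total a I + 3 * s
        used = [ (λ lt → ≤-by (2 * s) (<⇒≤ lt) (i₁ (κ zero + total a rest) (total a I) s))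
               , (λ lt → ≤-by 0 (<⇒≤ lt ⊕ proj₁ rest-balanced ⊕ proj₂ bal) (i₂ (κ zero) (total a rest) (total b rest) (total a I) (total b I) s)) ]′ over
          where
          i₁ : ∀ x A s → x + (A + s) + 2 * s ≡ A + 3 * s + x
          i₁ = solve-∀
          i₂ : ∀ k A′ B′ A B s → k + A′ + (B + s + (B′ + s + (A + s))) + 0 ≡ A + 3 * s + (k + B′ + (A′ + B))
          i₂ = solve-∀
        room′ : total a rest + s + P * (3 * s) ≤ ∑ (κ ∘ suc)
        room′ = ≤-by 0 (used ⊕ subst (total a I + s + suc P * (3 * s) ≤_) (∑-suc κ) room) (i₃ (κ zero) (total a rest) (total a I) s P (∑ (κ ∘ suc)))
          where
          i₃ : ∀ k A′ A s P S → A′ + s + P * (3 * s) + (A + 3 * s + (k + S)) + 0 ≡ S + (k + A′ + (A + s + (1 + P) * (3 * s)))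
          i₃ = solve-∀
        finish : (∃ λ (f : Fin N → Fin P) → Fits (κ ∘ suc) rest f a × Fits (κ ∘ suc) rest f b) → ∃ λ (f : Fin N → Fin (suc P)) → Fits κ I f a × Fits κ I f b
        finish (f , fa , fb) = g , fits a fits-a fa , fits b fits-b fb
          where
          g : Fin N → Fin (suc P)
          g r = if rest r then suc (f r) else zero
          fits : ∀ w → total w I ≤ κ zero + total w rest → Fits (κ ∘ suc) rest f w → Fits κ I g w
          fits w le fw zero = ≤-trans (≤-reflexive (∑-cong (λ r → pt (I r) (rest r) (f r) (w r)))) (first w le)
            where
            pt : ∀ x y z w → ⟦ x ∧ ((if y then suc z else zero) == zero {P}) ⟧ * w ≡ ⟦ x ∧ not y ⟧ * w
            pt x true z w = refl
            pt x false z w = refl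
          fits w le fw (suc p) = ≤-trans (≤-reflexive (∑-cong (λ r → pt (I r) (rest r) (f r) (w r) (rest⊆ r)))) (fw p)
            where
            pt : ∀ x y z w → (y ≡ true → x ≡ true) → ⟦ x ∧ ((if y then suc z else zero) == suc p) ⟧ * w ≡ ⟦ y ∧ (z == p) ⟧ * w
            pt x true z w h rewrite h refl | suc-== z p = refl
            pt x false z w h rewrite Bool.∧-zeroʳ x = refl

  -- Greedy embedding

  _∩_ : ∀ {n} → (Fin n → Bool) → (Fin n → Bool) → Fin n → Bool
  (A ∩ B) v = A v ∧ B v

  -- If every degree from `X` into `Y` were below `card Y / G`, summation would contradict the
  -- density.
  typical : ∀ {n} (E : Fin n → Fin n → Bool) (X Y : Fin n → Bool) (G : ℕ) → 0 < card X → card X * card Y ≤ G * edges E X Y →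
    ∃ λ x → X x ≡ true × card Y ≤ G * card (Y ∩ E x)
  typical E X Y G X>0 dense with Fin.any? (λ x → (X x Bool.≟ true) ×-dec (card Y ≤? G * card (Y ∩ E x)))
  ... | yes h = h
  ... | no ¬h = ⊥-elim (<⇒≱ strict dense)
    where
    deg : ∀ x → ∑ (λ y → ⟦ X x ⟧ * ⟦ Y y ⟧ * ⟦ E x y ⟧) ≡ ⟦ X x ⟧ * card (Y ∩ E x)
    deg x = trans (∑-cong (λ y → trans (*-assoc ⟦ X x ⟧ _ _) (cong (⟦ X x ⟧ *_) (sym (⟦∧⟧ (Y y) (E x y)))))) (∑-*ˡ ⟦ X x ⟧ _)
    lt : ∀ x → X x ≡ true → G * card (Y ∩ E x) < card Y
    lt x Xx = ≰⇒> (λ le → ¬h (x , Xx , le))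
    x₀ = card>0 X>0
    le : ∀ x b → X x ≡ b → G * (⟦ X x ⟧ * card (Y ∩ E x)) ≤ ⟦ X x ⟧ * card Y
    le x true Xx rewrite Xx = ≤-trans (≤-reflexive (cong (G *_) (+-identityʳ _))) (≤-trans (<⇒≤ (lt x Xx)) (≤-reflexive (sym (+-identityʳ _))))
    le x false Xx rewrite Xx = ≤-reflexive (*-zeroʳ G)
    lt₀ : G * (⟦ X (proj₁ x₀) ⟧ * card (Y ∩ E (proj₁ x₀))) < ⟦ X (proj₁ x₀) ⟧ * card Y
    lt₀ rewrite proj₂ x₀ = subst₂ _<_ (cong (G *_) (sym (+-identityʳ _))) (sym (+-identityʳ _)) (lt (proj₁ x₀) (proj₂ x₀))
    strict : G * edges E X Y < card X * card Y
    strict = subst₂ _<_ (trans (∑-*ˡ G _) (cong (G *_) (sym (∑-cong deg)))) (∑-*ʳ (λ x → ⟦ X x ⟧) (card Y))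
      (∑-mono-< (λ x → le x (X x) refl) (proj₁ x₀) lt₀)

  -- The data steering the embedding: vertex v of the tree goes to the cluster τ v and its children to the cluster γ v;
  -- transitional vertices (tr) use the reserve Q and all other vertices avoid it.
  record Layout {n m N : ℕ} (D : Fin n → Fin n → Bool) (c : Fin n → Fin m)
    {T : Digraph N} {root : Fin N} {Δ : ℕ} (tree : RootedTree T root Δ) (ρ G s : ℕ) : Set₁ where
    open RootedTree tree

    V : Fin m → Fin n → Bool
    V i y = c y == i

    field
      piece : Fin N → Fin N
      τ γ : Fin N → Fin m
      tr childTr : Fin N → Bool
      Q : Fin n → Bool

    bulk : Fin m → Fin N → Bool
    bulk i v = not (tr v) ∧ (τ v == i)

    -- Even after all bulk vertices of the cluster are placed, `1/ρ` of it remains free outside the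
    -- reserve.
    Room : Fin m → Set
    Room i = card (V i) + ρ * card (bulk i) ≤ ρ * card (V i ∩ (not ∘ Q))

    field
      piece-root : piece root ≡ root
      piece-split : ∀ v → v ≢ root → piece v ≡ v ⊎ piece v ≡ piece (par v)
      -- Hence a degree into the free set of a piece is only ever called upon within that piece.
      bulk-piece : ∀ v → v ≢ root → tr v ≡ false → piece v ≡ piece (par v)
      tr-par : ∀ v → v ≢ root → tr v ≡ childTr (par v)
      τ-par : ∀ v → v ≢ root → τ v ≡ γ (par v)
      piece-size : ∀ r → card (λ v → r == piece v) ≤ s
      G>0 : 0 < G
      regular : ∀ v X Y → X ⊆ V (τ v) → Y ⊆ V (γ v) →
        card (V (τ v)) ≤ 2 * ρ * G * card X → card (V (γ v)) ≤ 2 * ρ * G * card Y →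
        card X * card Y ≤ G * edges (orientedBy D (source v)) X Y
      Active : Fin m → Set
      τ-active : ∀ v → Active (τ v)
      γ-active : ∀ v → Active (γ v)
      nonempty : ∀ i → Active i → 0 < card (V i)
      few-tr : ∀ i → Active i → 2 * ρ * G * card tr ≤ card (V i)
      small-pieces : ∀ i → Active i → 2 * ρ * G * s ≤ card (V i)
      Q-big : ∀ i → Active i → card (V i) ≤ ρ * card (V i ∩ Q)
      room-γ : ∀ v → childTr v ≡ false → Room (γ v)
      room-root : tr root ≡ false → Room (τ root)

  module Greedy {n m N : ℕ} (D : Fin n → Fin n → Bool) (c : Fin n → Fin m)
    {T : Digraph N} {root : Fin N} {Δ : ℕ} (tree : RootedTree T root Δ) (ρ G s : ℕ) (layout : Layout D c tree ρ G s) where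
    open RootedTree tree
    open Layout layout

    hit : (Fin N → Bool) → (Fin N → Fin n) → Fin n → Bool
    hit done φ y = does (Fin.any? (λ u → (done u Bool.≟ true) ×-dec (φ u Fin.≟ y)))

    hit-true : ∀ done φ u → done u ≡ true → hit done φ (φ u) ≡ true
    hit-true done φ u du = Dec⇒true (Fin.any? _) (u , du , refl)

    hit-count : ∀ done φ (A : Fin n → Bool) → card (A ∩ hit done φ) ≤ card (λ u → done u ∧ A (φ u))
    hit-count done φ A = ≤-trans (∑-mono pt) (≤-reflexive (trans (∑-comm _)
        (∑-cong (λ u → trans (∑-δ (φ u) (λ y → ⟦ done u ∧ A y ⟧)) refl))))
      where
      pt : ∀ y → ⟦ A y ∧ hit done φ y ⟧ ≤ ∑ (λ u → ⟦ φ u == y ⟧ * ⟦ done u ∧ A y ⟧)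
      pt y = go (A y ∧ hit done φ y) refl
        where
        go : ∀ b → A y ∧ hit done φ y ≡ b → ⟦ b ⟧ ≤ ∑ (λ u → ⟦ φ u == y ⟧ * ⟦ done u ∧ A y ⟧)
        go false _ = z≤n
        go true eq with true⇒Dec (Fin.any? (λ u → (done u Bool.≟ true) ×-dec (φ u Fin.≟ y))) (proj₂ (∧-elim {A y} eq))
        ... | u , du , refl = ≤-trans (≤-reflexive (sym (cong₂ (λ p q → ⟦ p ⟧ * ⟦ q ⟧) (==-refl (φ u)) (∧-intro du (proj₁ (∧-elim {A y} eq)))))) (∑-term _ u)

    Adj : Fin N → Fin n → Fin n → Bool
    Adj v = orientedBy D (source v)

    pool : (Fin n → Bool) → Bool → Fin n → Bool
    pool free t = choose t Q free

    record Partial (done : Fin N → Bool) (φ : Fin N → Fin n) : Set where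
      field
        closed : ∀ v → v ≢ root → done v ≡ true → done (par v) ≡ true
        injective : ∀ u v → done u ≡ true → done v ≡ true → φ u ≡ φ v → u ≡ v
        edge-ok : ∀ v → v ≢ root → done v ≡ true → Adj (par v) (φ (par v)) (φ v) ≡ true
        in-cluster : ∀ v → done v ≡ true → c (φ v) ≡ τ v
        in-Q : ∀ v → done v ≡ true → Q (φ v) ≡ tr v
        Q-degree : ∀ v → done v ≡ true → childTr v ≡ true → card (V (γ v) ∩ Q) ≤ G * card ((V (γ v) ∩ Q) ∩ Adj v (φ v))

    -- `free` is frozen when the piece is begun, so degrees into it stay meaningful until the piece
    -- is finished, and `free-used` limits what has been taken from it to the size of the piece.
    record InPiece (r : Fin N) (free : Fin n → Bool) (done : Fin N → Bool) (φ : Fin N → Fin n) : Set where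
      field
        partial : Partial done φ
        free-degree : ∀ v → done v ≡ true → piece v ≡ r → childTr v ≡ false →
          card (V (γ v) ∩ free) ≤ G * card ((V (γ v) ∩ free) ∩ Adj v (φ v))
        free-used : ∀ v → done v ≡ true → free (φ v) ≡ true → piece v ≡ r

    Ready : (Fin N → Bool) → Fin N → Set
    Ready done v = v ≡ root ⊎ done (par v) ≡ true

    Ready? : ∀ done v → Dec (Ready done v)
    Ready? done v = (v Fin.≟ root) ⊎-dec (done (par v) Bool.≟ true)

    record PieceDone (r : Fin N) (done : Fin N → Bool) : Set where
      field
        done⁺ : Fin N → Bool
        φ⁺ : Fin N → Fin n
        grows : done ⊆ done⁺
        partial⁺ : Partial done⁺ φ⁺
        all-piece : ∀ w → piece w ≡ r → done⁺ w ≡ true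
        only-piece : ∀ w → done⁺ w ≡ true → done w ≡ true ⊎ piece w ≡ r

    module _ (r : Fin N) (free : Fin n → Bool) (free-¬Q : ∀ y → free y ≡ true → Q y ≡ false)
      (free-big : ∀ i → Room i → card (V i) ≤ ρ * card (V i ∩ free)) where

      module _ (done : Fin N → Bool) (φ : Fin N → Fin n) (inv : InPiece r free done φ)
        (v : Fin N) (new : done v ≡ false) (v∈r : piece v ≡ r) (ready : Ready done v) where
        open InPiece inv
        open Partial partial

        P : Fin n → Bool
        P = pool free (tr v)

        ok : Fin n → Bool
        ok y = (root == v) ∨ Adj (par v) (φ (par v)) y

        A S : Fin n → Bool
        A = (V (τ v) ∩ P) ∩ ok
        S y = A y ∧ not (hit done φ y)

        pool-big : ∀ t i → Active i → (t ≡ false → Room i) → card (V i) ≤ ρ * card (V i ∩ pool free t)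
        pool-big true i act _ = Q-big i act
        pool-big false i act room = free-big i (room refl)

        ready-par : v ≢ root → done (par v) ≡ true
        ready-par ne = [ (λ e → ⊥-elim (ne e)) , id ]′ ready

        P-big : card (V (τ v)) ≤ ρ * card (V (τ v) ∩ P)
        P-big = pool-big (tr v) (τ v) (τ-active v) (go (v Fin.≟ root))
          where
          go : Dec (v ≡ root) → tr v ≡ false → Room (τ v)
          go (yes refl) = room-root
          go (no ne) e = subst Room (sym (τ-par v ne)) (room-γ (par v) (trans (sym (tr-par v ne)) e))

        A-big : card (V (τ v) ∩ P) ≤ G * card A
        A-big = go (v Fin.≟ root)
          where
          pool-degree : ∀ t → childTr (par v) ≡ t → done (par v) ≡ true → (t ≡ false → piece (par v) ≡ r) →
            card (V (γ (par v)) ∩ pool free t) ≤ G * card ((V (γ (par v)) ∩ pool free t) ∩ Adj (par v) (φ (par v)))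
          pool-degree true e d _ = Q-degree (par v) d e
          pool-degree false e d p = free-degree (par v) d (p refl) e
          go : Dec (v ≡ root) → card (V (τ v) ∩ P) ≤ G * card A
          go (yes refl) = ≤-trans (card-mono (λ y h → ∧-intro h (cong (_∨ Adj (par v) (φ (par v)) y) (==-refl root))))
            (≤-trans (≤-reflexive (sym (+-identityʳ (card A)))) (*-monoˡ-≤ (card A) G>0))
          go (no ne) = ≤-trans (subst (λ i → card (V i ∩ P) ≤ G * card ((V i ∩ P) ∩ Adj (par v) (φ (par v)))) (sym (τ-par v ne))
              (pool-degree (tr v) (sym (tr-par v ne)) (ready-par ne) (λ e → trans (sym (bulk-piece v ne e)) v∈r)))
            (*-monoʳ-≤ G (card-mono (λ y h → let p , q = ∧-elim {(V (τ v) ∩ P) y} h in ∧-intro p (trans (cong ((root == v) ∨_) q) (Bool.∨-zeroʳ (root == v))))))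

        -- Only transitional vertices ever occupy the reserve, and only the current piece occupies
        -- `free`.
        pool-used : ∀ t (B : Fin n → Bool) → (∀ y → B y ≡ true → pool free t y ≡ true) →
          2 * ρ * G * card (λ u → done u ∧ B (φ u)) ≤ card (V (τ v))
        pool-used true B B⊆ = ≤-trans (*-monoʳ-≤ (2 * ρ * G) (card-mono (λ u h → let du , Bu = ∧-elim {done u} h in trans (sym (in-Q u du)) (B⊆ (φ u) Bu))))
          (few-tr (τ v) (τ-active v))
        pool-used false B B⊆ = ≤-trans (*-monoʳ-≤ (2 * ρ * G) (≤-trans (card-mono (λ u h → let du , Bu = ∧-elim {done u} h in
            trans (cong (r ==_) (free-used u du (B⊆ (φ u) Bu))) (==-refl r))) (piece-size r)))
          (small-pieces (τ v) (τ-active v))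

        -- `A` contains at least `1/(ρG)` of the cluster, and the occupied vertices amount to at
        -- most half of this. The remaining `1/(2ρG)` is the size at which regularity is required.
        S-big : card (V (τ v)) ≤ 2 * ρ * G * card S
        S-big = finish (card (V (τ v))) (card (V (τ v) ∩ P)) (card A) (card S) (card (λ u → done u ∧ A (φ u))) P-big A-big
            (≤-trans (card-∖ A (hit done φ)) (+-monoʳ-≤ (card S) (hit-count done φ A)))
            (pool-used (tr v) A (λ y h → proj₂ (∧-elim {V (τ v) y} (proj₁ (∧-elim {(V (τ v) ∩ P) y} h)))))
          where
          finish : ∀ a b x y z → a ≤ ρ * b → b ≤ G * x → x ≤ y + z → 2 * ρ * G * z ≤ a → a ≤ 2 * ρ * G * y
          finish a b x y z h₁ h₂ h₃ h₄ = ≤-by 0 (2 ⊗ h₁ ⊕ (2 * ρ) ⊗ h₂ ⊕ (2 * ρ * G) ⊗ h₃ ⊕ h₄) (ident a b x y z ρ G)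
            where
            ident : ∀ a b x y z ρ G → a + (2 * (ρ * b) + (2 * ρ * (G * x) + (2 * ρ * G * (y + z) + a))) + 0 ≡
              2 * ρ * G * y + (2 * a + (2 * ρ * b + (2 * ρ * G * x + 2 * ρ * G * z)))
            ident = solve-∀

        Y : Fin n → Bool
        Y = V (γ v) ∩ pool free (childTr v)

        Y-big : card (V (γ v)) ≤ 2 * ρ * G * card Y
        Y-big = ≤-trans (pool-big (childTr v) (γ v) (γ-active v) (room-γ v))
          (*-monoˡ-≤ (card Y) (≤-trans (≤-trans (m≤n+m ρ ρ) (≤-reflexive (trans (cong (ρ +_) (sym (+-identityʳ ρ))) (sym (*-identityʳ (2 * ρ)))))) (*-monoʳ-≤ (2 * ρ) G>0)))

        S>0 : 0 < card S
        S>0 = go (card S) refl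
          where
          go : ∀ x → card S ≡ x → 0 < card S
          go zero e = ⊥-elim (<⇒≱ (nonempty (τ v) (τ-active v)) (≤-trans S-big (≤-reflexive (trans (cong (2 * ρ * G *_) e) (*-zeroʳ (2 * ρ * G))))))
          go (suc x) e = subst (0 <_) (sym e) (s≤s z≤n)

        -- The image is chosen for the sake of the future children: it has many neighbours in the
        -- pool `Y` from which they will be taken.
        chosen : ∃ λ x → S x ≡ true × card Y ≤ G * card (Y ∩ Adj v x)
        chosen = typical (Adj v) S Y G S>0 (regular v S Y (λ y h → proj₁ (∧-elim {V (τ v) y} (proj₁ (∧-elim {(V (τ v) ∩ P) y} (proj₁ (∧-elim {A y} h))))))
          (λ y h → proj₁ (∧-elim {V (γ v) y} h)) S-big Y-big)

        module _ (x : Fin n) (Sx : S x ≡ true) (Yx : card Y ≤ G * card (Y ∩ Adj v x)) where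

          Ax : A x ≡ true
          Ax = proj₁ (∧-elim {A x} Sx)

          x-fresh : ∀ u → done u ≡ true → φ u ≢ x
          x-fresh u du refl = true≢false (hit-true done φ u du) (not-elim (proj₂ (∧-elim {A x} Sx)))

          x-cluster : c x ≡ τ v
          x-cluster = ==⇒≡ (proj₁ (∧-elim {V (τ v) x} (proj₁ (∧-elim {(V (τ v) ∩ P) x} Ax))))

          x-pool : P x ≡ true
          x-pool = proj₂ (∧-elim {V (τ v) x} (proj₁ (∧-elim {(V (τ v) ∩ P) x} Ax)))

          x-Q : Q x ≡ tr v
          x-Q = go (tr v) x-pool
            where
            go : ∀ t → pool free t x ≡ true → Q x ≡ t
            go true h = h
            go false h = free-¬Q x h

          x-adj : v ≢ root → Adj (par v) (φ (par v)) x ≡ true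
          x-adj ne with ∨-elim {root == v} (proj₂ (∧-elim {(V (τ v) ∩ P) x} Ax))
          ... | inj₁ e = ⊥-elim (ne (sym (==⇒≡ e)))
          ... | inj₂ h = h

          done′ : Fin N → Bool
          done′ w = done w ∨ (v == w)

          φ′ : Fin N → Fin n
          φ′ w = if v == w then x else φ w

          φ′-new : φ′ v ≡ x
          φ′-new = cong (λ b → if b then x else φ v) (==-refl v)

          φ′-old : ∀ w → done w ≡ true → φ′ w ≡ φ w
          φ′-old w dw = cong (λ b → if b then x else φ w) (≢⇒== {i = v} {w} (λ { refl → true≢false dw new }))

          cases : ∀ w → done′ w ≡ true → (done w ≡ true × φ′ w ≡ φ w) ⊎ v ≡ w
          cases w h with ∨-elim {done w} h
          ... | inj₁ dw = inj₁ (dw , φ′-old w dw)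
          ... | inj₂ e = inj₂ (==⇒≡ e)

          card-done′ : card done′ ≡ suc (card done)
          card-done′ = trans (∑-cong pt) (trans (∑-distrib-+ _ _) (trans (cong (card done +_) (∑-δ1 v)) (+-comm (card done) 1)))
            where
            pt : ∀ w → ⟦ done w ∨ (v == w) ⟧ ≡ ⟦ done w ⟧ + ⟦ v == w ⟧
            pt w with v Fin.≟ w
            ... | yes refl rewrite new = refl
            ... | no _ rewrite Bool.∨-identityʳ (done w) = sym (+-identityʳ _)

          Q-degree-new : ∀ t → childTr v ≡ t → t ≡ true → card (V (γ v) ∩ pool free t) ≤ G * card ((V (γ v) ∩ pool free t) ∩ Adj v x) →
            card (V (γ v) ∩ Q) ≤ G * card ((V (γ v) ∩ Q) ∩ Adj v x)
          Q-degree-new true _ _ h = h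

          free-degree-new : ∀ t → childTr v ≡ t → t ≡ false → card (V (γ v) ∩ pool free t) ≤ G * card ((V (γ v) ∩ pool free t) ∩ Adj v x) →
            card (V (γ v) ∩ free) ≤ G * card ((V (γ v) ∩ free) ∩ Adj v x)
          free-degree-new false _ _ h = h

          placed : InPiece r free done′ φ′
          placed = record
            { partial = record
              { closed = closed′ ; injective = injective′ ; edge-ok = edge-ok′ ; in-cluster = in-cluster′ ; in-Q = in-Q′ ; Q-degree = Q-degree′ }
            ; free-degree = free-degree′ ; free-used = free-used′ }
            where
            keep : ∀ w → done w ≡ true → done′ w ≡ true
            keep w dw = cong (_∨ (v == w)) dw
            closed′ : ∀ w → w ≢ root → done′ w ≡ true → done′ (par w) ≡ true
            closed′ w ne h with cases w h
            ... | inj₁ (dw , _) = keep (par w) (closed w ne dw)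
            ... | inj₂ refl = keep (par w) (ready-par ne)
            injective′ : ∀ u w → done′ u ≡ true → done′ w ≡ true → φ′ u ≡ φ′ w → u ≡ w
            injective′ u w hu hw e with cases u hu | cases w hw
            ... | inj₁ (du , eu) | inj₁ (dw , ew) = injective u w du dw (trans (sym eu) (trans e ew))
            ... | inj₁ (du , eu) | inj₂ refl = ⊥-elim (x-fresh u du (trans (sym eu) (trans e φ′-new)))
            ... | inj₂ refl | inj₁ (dw , ew) = ⊥-elim (x-fresh w dw (trans (sym ew) (trans (sym e) φ′-new)))
            ... | inj₂ refl | inj₂ refl = refl
            edge-ok′ : ∀ w → w ≢ root → done′ w ≡ true → Adj (par w) (φ′ (par w)) (φ′ w) ≡ true
            edge-ok′ w ne h with cases w h
            ... | inj₁ (dw , ew) = subst₂ (λ p q → Adj (par w) p q ≡ true) (sym (φ′-old (par w) (closed w ne dw))) (sym ew) (edge-ok w ne dw)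
            ... | inj₂ refl = subst₂ (λ p q → Adj (par w) p q ≡ true) (sym (φ′-old (par w) (ready-par ne))) (sym φ′-new) (x-adj ne)
            in-cluster′ : ∀ w → done′ w ≡ true → c (φ′ w) ≡ τ w
            in-cluster′ w h with cases w h
            ... | inj₁ (dw , ew) = trans (cong c ew) (in-cluster w dw)
            ... | inj₂ refl = trans (cong c φ′-new) x-cluster
            in-Q′ : ∀ w → done′ w ≡ true → Q (φ′ w) ≡ tr w
            in-Q′ w h with cases w h
            ... | inj₁ (dw , ew) = trans (cong Q ew) (in-Q w dw)
            ... | inj₂ refl = trans (cong Q φ′-new) x-Q
            Q-degree′ : ∀ w → done′ w ≡ true → childTr w ≡ true → card (V (γ w) ∩ Q) ≤ G * card ((V (γ w) ∩ Q) ∩ Adj w (φ′ w))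
            Q-degree′ w h ct with cases w h
            ... | inj₁ (dw , ew) = subst (λ y → card (V (γ w) ∩ Q) ≤ G * card ((V (γ w) ∩ Q) ∩ Adj w y)) (sym ew) (Q-degree w dw ct)
            ... | inj₂ refl = subst (λ y → card (V (γ w) ∩ Q) ≤ G * card ((V (γ w) ∩ Q) ∩ Adj w y)) (sym φ′-new) (Q-degree-new (childTr v) refl ct Yx)
            free-degree′ : ∀ w → done′ w ≡ true → piece w ≡ r → childTr w ≡ false →
              card (V (γ w) ∩ free) ≤ G * card ((V (γ w) ∩ free) ∩ Adj w (φ′ w))
            free-degree′ w h p ct with cases w h
            ... | inj₁ (dw , ew) = subst (λ y → card (V (γ w) ∩ free) ≤ G * card ((V (γ w) ∩ free) ∩ Adj w y)) (sym ew) (free-degree w dw p ct)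
            ... | inj₂ refl = subst (λ y → card (V (γ w) ∩ free) ≤ G * card ((V (γ w) ∩ free) ∩ Adj w y)) (sym φ′-new) (free-degree-new (childTr v) refl ct Yx)
            free-used′ : ∀ w → done′ w ≡ true → free (φ′ w) ≡ true → piece w ≡ r
            free-used′ w h f with cases w h
            ... | inj₁ (dw , ew) = free-used w dw (trans (cong free (sym ew)) f)
            ... | inj₂ refl = v∈r

      -- Climbing from a missing vertex within the piece leads to a missing vertex that is ready, at
      -- the latest at the top.
      complete : ∀ done → Ready done r → (¬ ∃ λ v → done v ≡ false × piece v ≡ r × Ready done v) → ∀ w → piece w ≡ r → done w ≡ true
      complete done r-ready none w = go (rank w) w refl
        where
        go : ∀ f w → rank w ≡ f → piece w ≡ r → done w ≡ true
        go f w eq w∈r = decide (done w) refl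
          where
          notReady : done w ≡ false → ¬ Ready done w
          notReady dw rd = none (w , dw , w∈r , rd)
          climb : ∀ f → rank w ≡ f → done w ≡ false → w ≢ root → (piece w ≡ piece (par w)) → done w ≡ true
          climb zero eq dw ne e = ⊥-elim (0≢1+n (trans (sym eq) (rank-par w ne)))
          climb (suc f) eq dw ne e = ⊥-elim (notReady dw (inj₂ (go f (par w) (suc-injective (trans (sym (rank-par w ne)) eq)) (trans (sym e) w∈r))))
          decide : ∀ b → done w ≡ b → done w ≡ true
          decide true dw = dw
          decide false dw = at-root (w Fin.≟ root)
            where
            at-root : Dec (w ≡ root) → done w ≡ true
            at-root (yes e) = ⊥-elim (notReady dw (inj₁ e))
            at-root (no ne) with piece-split w ne
            ... | inj₁ e = ⊥-elim (notReady dw (subst (Ready done) (trans (sym w∈r) e) r-ready))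
            ... | inj₂ e = climb f eq dw ne e

      embed-piece : ∀ t done φ → N ≤ t + card done → InPiece r free done φ → Ready done r → PieceDone r done
      embed-piece t done φ fuel inv r-ready with Fin.any? (λ v → (done v Bool.≟ false) ×-dec (piece v Fin.≟ r) ×-dec Ready? done v)
      ... | no none = record
        { done⁺ = done ; φ⁺ = φ ; grows = λ _ h → h ; partial⁺ = InPiece.partial inv
        ; all-piece = complete done r-ready none ; only-piece = λ w h → inj₁ h }
      ... | yes (v , new , v∈r , rd) with chosen done φ inv v new v∈r rd
      ...   | x , Sx , Yx = continue t fuel
        where
        cd : card (done′ done φ inv v new v∈r rd x Sx Yx) ≡ suc (card done)
        cd = card-done′ done φ inv v new v∈r rd x Sx Yx
        keep : ∀ w → done w ≡ true → done w ∨ (v == w) ≡ true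
        keep w dw = cong (_∨ (v == w)) dw
        continue : ∀ t → N ≤ t + card done → PieceDone r done
        continue zero fuel = ⊥-elim (<⇒≱ (≤-trans (≤-reflexive (sym cd)) (card≤n _)) fuel)
        continue (suc t) fuel = record
            { done⁺ = done⁺ ; φ⁺ = φ⁺ ; grows = λ w dw → grows w (keep w dw) ; partial⁺ = partial⁺ ; all-piece = all-piece
            ; only-piece = λ w h → [ old w , inj₂ ]′ (only-piece w h) }
          where
          rec : PieceDone r (λ w → done w ∨ (v == w))
          rec = embed-piece t _ _ (≤-trans fuel (≤-reflexive (trans (sym (+-suc t (card done))) (cong (t +_) (sym cd)))))
            (placed done φ inv v new v∈r rd x Sx Yx) (Data.Sum.map₂ (keep (par r)) r-ready)
          open PieceDone rec
          old : ∀ w → done w ∨ (v == w) ≡ true → done w ≡ true ⊎ piece w ≡ r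
          old w h with ∨-elim {done w} h
          ... | inj₁ dw = inj₁ dw
          ... | inj₂ e = inj₂ (trans (cong piece (sym (==⇒≡ e))) v∈r)

    module NextPiece (done : Fin N → Bool) (φ : Fin N → Fin n) (partial : Partial done φ)
      (whole : ∀ v w → done v ≡ true → piece w ≡ piece v → done w ≡ true)
      (r : Fin N) (new : done r ≡ false) (r∈r : piece r ≡ r) where

      open Partial partial

      free : Fin n → Bool
      free y = not (Q y) ∧ not (hit done φ y)

      free-¬Q : ∀ y → free y ≡ true → Q y ≡ false
      free-¬Q y h = not-elim (proj₁ (∧-elim {not (Q y)} h))

      used≤bulk : ∀ i → card ((V i ∩ (not ∘ Q)) ∩ hit done φ) ≤ card (bulk i)
      used≤bulk i = ≤-trans (hit-count done φ (V i ∩ (not ∘ Q))) (card-mono pt)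
        where
        pt : ∀ u → done u ∧ (V i (φ u) ∧ not (Q (φ u))) ≡ true → not (tr u) ∧ (τ u == i) ≡ true
        pt u h = let du , h′ = ∧-elim {done u} h ; vi , nq = ∧-elim {V i (φ u)} h′ in
          ∧-intro (trans (cong not (sym (in-Q u du))) nq) (trans (cong (_== i) (sym (in-cluster u du))) vi)

      -- By `in-cluster` and `in-Q`, whatever is occupied in `V i` outside the reserve is the image
      -- of a bulk vertex assigned to `i`.
      free-big : ∀ i → Room i → card (V i) ≤ ρ * card (V i ∩ free)
      free-big i room = ≤-by 0 (room ⊕ ρ ⊗ ≤-trans (card-∖ (V i ∩ (not ∘ Q)) (hit done φ)) (+-mono-≤ (card-mono assoc) (used≤bulk i)))
          (ident (card (V i)) (card (bulk i)) (card (V i ∩ (not ∘ Q))) (card (V i ∩ free)) ρ)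
        where
        assoc : ∀ y → (V i y ∧ not (Q y)) ∧ not (hit done φ y) ≡ true → V i y ∧ free y ≡ true
        assoc y h = trans (sym (Bool.∧-assoc (V i y) _ _)) h
        ident : ∀ v b w f ρ → v + (ρ * w + ρ * (f + b)) + 0 ≡ ρ * f + (v + ρ * b + ρ * w)
        ident = solve-∀

      none-done : ∀ v → done v ≡ true → piece v ≢ r
      none-done v dv e = true≢false (whole v r dv (trans r∈r (sym e))) new

      start : InPiece r free done φ
      start = record
        { partial = partial
        ; free-degree = λ v dv e _ → ⊥-elim (none-done v dv e)
        ; free-used = λ v dv f → ⊥-elim (true≢false (hit-true done φ v dv) (not-elim (proj₂ (∧-elim {not (Q (φ v))} f)))) }

      next : Ready done r → PieceDone r done
      next rd = embed-piece r free free-¬Q free-big N done φ (m≤m+n N _) start rd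

    topmost : ∀ done v → done v ≡ false → ∃ λ w → done w ≡ false × Ready done w
    topmost done v = go (rank v) v refl
      where
      go : ∀ f v → rank v ≡ f → done v ≡ false → ∃ λ w → done w ≡ false × Ready done w
      go f v eq dv with v Fin.≟ root | done (par v) in dp
      ... | yes e | _ = v , dv , inj₁ e
      ... | no ne | true = v , dv , inj₂ dp
      go zero v eq dv | no ne | false = ⊥-elim (0≢1+n (trans (sym eq) (rank-par v ne)))
      go (suc f) v eq dv | no ne | false = go f (par v) (suc-injective (trans (sym (rank-par v ne)) eq)) dp

    Embedded : Set
    Embedded = ∃ λ (φ : Fin N → Fin n) → (∀ u v → φ u ≡ φ v → u ≡ v) × (∀ v → v ≢ root → Adj (par v) (φ (par v)) (φ v) ≡ true)

    embed-from : ∀ t done φ → N ≤ t + card done → Partial done φ →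
      (∀ v w → done v ≡ true → piece w ≡ piece v → done w ≡ true) → Embedded
    embed-from t done φ fuel partial whole with Fin.any? (λ v → done v Bool.≟ false)
    ... | no all = φ , (λ u v → injective u v (d u) (d v)) , (λ v ne → edge-ok v ne (d v))
      where
      open Partial partial
      d : ∀ v → done v ≡ true
      d v = go (done v) refl
        where
        go : ∀ b → done v ≡ b → done v ≡ true
        go true e = e
        go false e = ⊥-elim (all (v , e))
    ... | yes (v , dv) with topmost done v dv
    ...   | r , new , rd = continue t fuel
      where
      -- Pieces are placed as a whole, so a missing vertex with a placed parent is the top of its
      -- piece.
      own-piece : Dec (r ≡ root) → Ready done r → piece r ≡ r
      own-piece (yes refl) _ = piece-root
      own-piece (no ne) (inj₁ e) = ⊥-elim (ne e)
      own-piece (no ne) (inj₂ dp) = [ id , (λ e → ⊥-elim (true≢false (whole (par r) r dp e) new)) ]′ (piece-split r ne)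
      r∈r : piece r ≡ r
      r∈r = own-piece (r Fin.≟ root) rd
      pd : PieceDone r done
      pd = NextPiece.next done φ partial whole r new r∈r rd
      open PieceDone pd
      whole⁺ : ∀ v w → done⁺ v ≡ true → piece w ≡ piece v → done⁺ w ≡ true
      whole⁺ v w dv e = [ (λ dv₀ → grows w (whole v w dv₀ e)) , (λ v∈r → all-piece w (trans e v∈r)) ]′ (only-piece v dv)
      more : card done < card done⁺
      more = ∑-mono-< (λ w → ⟦⟧-mono (grows w)) r (subst₂ (λ a b → ⟦ a ⟧ < ⟦ b ⟧) (sym new) (sym (all-piece r r∈r)) ≤-refl)
      continue : ∀ t → N ≤ t + card done → Embedded
      continue zero fuel = ⊥-elim (<⇒≱ (≤-trans more (card≤n done⁺)) fuel)
      continue (suc t) fuel = embed-from t done⁺ φ⁺ (≤-trans fuel (≤-trans (≤-reflexive (sym (+-suc t (card done)))) (+-monoʳ-≤ t more))) partial⁺ whole⁺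

    embedded : Embedded
    -- The initial map is a dummy: all conditions concern placed vertices, and none is placed yet.
    embedded = embed-from N (λ _ → false) (λ _ → proj₁ (card>0 (nonempty (τ root) (τ-active root)))) (m≤m+n N _)
      (record { closed = λ _ _ () ; injective = λ _ _ () ; edge-ok = λ _ _ () ; in-cluster = λ _ () ; in-Q = λ _ () ; Q-degree = λ _ () })
      (λ _ _ ())

    contains : Contains D T
    contains with embedded
    ... | φ , inj , adj = φ , (λ {u} {v} → inj u v) , hom
      where
      hom : ∀ u v → T u v ≡ true → D (φ u) (φ v) ≡ true
      hom u v uv with edge u v uv
      ... | su , sv , inj₁ (ne , refl) = subst (λ b → orientedBy D b (φ (par v)) (φ v) ≡ true) su (adj v ne)
      ... | su , sv , inj₂ (ne , refl) = subst (λ b → orientedBy D b (φ (par u)) (φ u) ≡ true) sv (adj u ne)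

  -- Laying out the tree

  m<[1+m/n]*n : ∀ m n .{{_ : NonZero n}} → m < suc (m / n) * n
  m<[1+m/n]*n m n = ≤-trans (≤-reflexive (cong suc (m≡m%n+[m/n]*n m n))) (+-monoˡ-≤ (m / n * n) (m%n<n m n))

  subsetOfSize : ∀ {n} (p : Fin n → Bool) t → t ≤ card p → ∃ λ q → q ⊆ p × card q ≡ t
  subsetOfSize p zero _ = (λ _ → false) , (λ _ ()) , ∑-zero (λ _ → refl)
  subsetOfSize {n} p (suc t) lt with subsetOfSize p t (<⇒≤ lt)
  ... | q , q⊆p , cq with card-find {p = p} {q = q} (subst (_< card p) (sym cq) lt)
  ...   | v , pv , qv = (λ w → q w ∨ (v == w)) , sub , trans (∑-cong pt) (trans (∑-distrib-+ _ _) (trans (cong₂ _+_ cq (∑-δ1 v)) (+-comm t 1)))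
    where
    sub : ∀ w → q w ∨ (v == w) ≡ true → p w ≡ true
    sub w h with ∨-elim {q w} h
    ... | inj₁ qw = q⊆p w qw
    ... | inj₂ e = subst (λ z → p z ≡ true) (==⇒≡ e) pv
    pt : ∀ w → ⟦ q w ∨ (v == w) ⟧ ≡ ⟦ q w ⟧ + ⟦ v == w ⟧
    pt w with v Fin.≟ w
    ... | yes refl rewrite qv = refl
    ... | no _ rewrite Bool.∨-identityʳ (q w) = sym (+-identityʳ _)

  reserve : ∀ {n m} (c : Fin n → Fin m) w .{{_ : NonZero w}} →
    ∃ λ (Q : Fin n → Bool) → ∀ i → card (λ y → (c y == i) ∧ Q y) ≡ card (λ y → c y == i) / w
  reserve {n} {m} c w = (λ y → proj₁ (sub (c y)) y) , λ i → trans (∑-cong (λ y → cong ⟦_⟧ (pt i y))) (proj₂ (proj₂ (sub i)))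
    where
    sub : ∀ i → ∃ λ q → q ⊆ (λ y → c y == i) × card q ≡ card (λ y → c y == i) / w
    sub i = subsetOfSize _ _ (≤-trans (m≤m*n _ w) (m/n*n≤m _ w))
    pt : ∀ i y → (c y == i) ∧ proj₁ (sub (c y)) y ≡ proj₁ (sub i) y
    pt i y with c y Fin.≟ i
    ... | yes refl = refl
    ... | no ne = sym (¬true⇒false (λ h → ne (==⇒≡ (proj₁ (proj₂ (sub i)) y h))))

  ∑-sumL : ∀ {A : Set} {P} (f : A → Fin P) (g : Fin P → ℕ) xs →
    ∑ (λ p → g p * sumL (λ e → ⟦ f e == p ⟧) xs) ≡ sumL (λ e → g (f e)) xs
  ∑-sumL f g [] = ∑-zero (λ p → *-zeroʳ (g p))
  ∑-sumL f g (e ∷ xs) = trans (∑-cong (λ p → trans (*-distribˡ-+ (g p) ⟦ f e == p ⟧ _) (cong (_+ g p * sumL (λ e → ⟦ f e == p ⟧) xs) (*-comm (g p) _))))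
    (trans (∑-distrib-+ _ _) (cong₂ _+_ (∑-δ (f e) g) (∑-sumL f g xs)))

  sumL-const : ∀ {A : Set} (xs : List A) → sumL (λ _ → 1) xs ≡ length xs
  sumL-const [] = refl
  sumL-const (_ ∷ xs) = cong suc (sumL-const xs)

  module Bins {n} (D : Fin n → Fin n → Bool) {m} (c : Fin n → Fin m) (R : Fin m → Fin m → Bool) {d} (RG : ReducedGraph D c R d)
    (w : ℕ) .{{_ : NonZero w}} where
    open ReducedGraph RG

    fst snd : Fin (m * m) → Fin m
    fst p = proj₁ (remQuot {m} m p)
    snd p = proj₂ (remQuot {m} m p)

    bin : Fin n × Fin n → Fin (m * m)
    bin (u , v) = combine (c u) (c v)

    fst-bin : ∀ e → fst (bin e) ≡ c (proj₁ e)
    fst-bin (u , v) = cong proj₁ (Fin.remQuot-combine {m} {m} (c u) (c v))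

    snd-bin : ∀ e → snd (bin e) ≡ c (proj₂ e)
    snd-bin (u , v) = cong proj₂ (Fin.remQuot-combine {m} {m} (c u) (c v))

    -- At least `1/w` of the matched pairs of each bin is withheld, by rounding up; the truncated
    -- subtraction gives capacity 0 to unmatched pairs of clusters.
    x κ : Fin (m * m) → ℕ
    x p = sumL (λ e → ⟦ bin e == p ⟧) pairs
    κ p = x p ∸ suc (x p / w)

    x>0⇒valid : ∀ p → 0 < x p → valid (fst p) (snd p) ≡ true
    x>0⇒valid p = go pairs pairs-valid
      where
      go : ∀ ps → All (λ e → valid (c (proj₁ e)) (c (proj₂ e)) ≡ true) ps → 0 < sumL (λ e → ⟦ bin e == p ⟧) ps → valid (fst p) (snd p) ≡ true
      go (e ∷ ps) (h ∷ hs) pos with bin e Fin.≟ p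
      ... | yes refl = trans (cong₂ valid (fst-bin e) (snd-bin e)) h
      ... | no _ = go ps hs pos

    ∑x : ∑ x ≡ d
    ∑x = trans (∑-cong (λ p → sym (+-identityʳ (x p)))) (trans (∑-sumL bin (λ _ → 1) pairs) (trans (sumL-const pairs) size-pairs))

    ends : Fin m → Fin (m * m) → ℕ
    ends i p = ⟦ fst p == i ⟧ + ⟦ snd p == i ⟧

    -- The matched pairs are disjoint, so their ends in cluster `i` are distinct vertices of it.
    load≤ : ∀ i → ∑ (λ p → ends i p * x p) ≤ card (λ y → c y == i)
    load≤ i = ≤-trans (≤-reflexive (trans (∑-sumL bin (ends i) pairs) (trans (go pairs) refl)))
        (∑-mono (λ y → ≤-trans (*-monoʳ-≤ ⟦ c y == i ⟧ (pairs-disjoint y)) (≤-reflexive (*-identityʳ _))))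
      where
      go : ∀ ps → sumL (λ e → ends i (bin e)) ps ≡ ∑ (λ y → ⟦ c y == i ⟧ * sumL (λ e → ⟦ proj₁ e == y ⟧ + ⟦ proj₂ e == y ⟧) ps)
      go [] = sym (∑-zero (λ y → *-zeroʳ ⟦ c y == i ⟧))
      go ((u , v) ∷ ps) = trans (cong₂ _+_ (cong₂ (λ s t → ⟦ s == i ⟧ + ⟦ t == i ⟧) (fst-bin (u , v)) (snd-bin (u , v))) (go ps))
        (sym (trans (∑-cong (λ y → expand ⟦ c y == i ⟧ ⟦ u == y ⟧ ⟦ v == y ⟧ _)) (trans (∑-distrib-+ _ _)
          (cong (_+ ∑ (λ y → ⟦ c y == i ⟧ * sumL (λ e → ⟦ proj₁ e == y ⟧ + ⟦ proj₂ e == y ⟧) ps))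
            (trans (∑-distrib-+ _ _) (cong₂ _+_ (∑-δ u (λ y → ⟦ c y == i ⟧)) (∑-δ v (λ y → ⟦ c y == i ⟧))))))))
        where
        expand : ∀ s a b t → s * (a + b + t) ≡ (a * s + b * s) + s * t
        expand = solve-∀

    x≤κ : ∀ p → x p ≤ κ p + suc (x p / w)
    x≤κ p = m≤n+m∸n′ (x p) (suc (x p / w))
      where
      m≤n+m∸n′ : ∀ a b → a ≤ a ∸ b + b
      m≤n+m∸n′ a b = ≤-trans (m≤n+m∸n a b) (≤-reflexive (+-comm b (a ∸ b)))

    wκ+x≤wx : ∀ p → w * κ p + x p ≤ w * x p
    wκ+x≤wx p = go (x p)
      where
      go : ∀ y → w * (y ∸ suc (y / w)) + y ≤ w * y
      go y with suc (y / w) ≤? y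
      ... | yes le = ≤-by 0 (<⇒≤ (m<[1+m/n]*n y w)) (trans (ident w (y ∸ suc (y / w)) y (suc (y / w))) (cong (λ z → w * z + y) (m∸n+n≡m le)))
        where
        ident : ∀ w a y b → w * a + y + b * w + 0 ≡ w * (a + b) + y
        ident = solve-∀
      ... | no gt = ≤-trans (≤-reflexive (cong (λ z → w * z + y) (m≤n⇒m∸n≡0 (<⇒≤ (≰⇒> gt))))) (≤-trans (≤-reflexive (cong (_+ y) (*-zeroʳ w))) (m≤n*m y w))

    κ>0⇒valid : ∀ p → 0 < κ p → valid (fst p) (snd p) ≡ true
    κ>0⇒valid p pos = x>0⇒valid p (≤-trans pos (m∸n≤m (x p) (suc (x p / w))))

    -- The bins leave a (1/w)-fraction of every cluster unused.
    capacity≤ : ∀ i → w * ∑ (λ p → ends i p * κ p) + card (λ y → c y == i) ≤ w * card (λ y → c y == i)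
    capacity≤ i = finish w (∑ (λ p → ends i p * κ p)) (∑ (λ p → ends i p * x p)) (card (λ y → c y == i))
        (≤-trans (≤-reflexive (trans (cong (_+ ∑ (λ p → ends i p * x p)) (sym (∑-*ˡ w _))) (sym (∑-distrib-+ _ _))))
          (≤-trans (∑-mono (λ p → ≤-trans (≤-reflexive (ident₀ w (ends i p) (κ p) (x p))) (≤-trans (*-monoʳ-≤ (ends i p) (wκ+x≤wx p)) (≤-reflexive (ident₁ (ends i p) w (x p))))))
            (≤-reflexive (∑-*ˡ w _)))) (load≤ i)
      where
      ident₀ : ∀ w e k x → w * (e * k) + e * x ≡ e * (w * k + x)
      ident₀ = solve-∀
      ident₁ : ∀ e w x → e * (w * x) ≡ w * (e * x)
      ident₁ = solve-∀
      finish : ∀ w .{{_ : NonZero w}} K X V → w * K + X ≤ w * X → X ≤ V → w * K + V ≤ w * V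
      finish (suc w) K X V h₁ h₂ = ≤-by 0 (h₁ ⊕ w ⊗ h₂) (ident₂ w K X V)
        where
        ident₂ : ∀ w K X V → (1 + w) * K + V + ((1 + w) * X + w * V) + 0 ≡ (1 + w) * V + ((1 + w) * K + X + w * X)
        ident₂ = solve-∀

    -- Each of the `m * m` bins loses at most 1 to rounding, and all together lose at most `d / w`
    -- besides.
    ∑κ≥ : w * d ≤ w * ∑ κ + w * (m * m) + d
    ∑κ≥ = ≤-trans (*-monoʳ-≤ w (≤-trans (≤-reflexive (sym ∑x)) (≤-trans (∑-mono x≤κ) (≤-reflexive (trans (∑-distrib-+ _ _)
          (cong (∑ κ +_) (trans (∑-distrib-+ (λ _ → 1) _) (cong (_+ ∑ (λ p → x p / w)) (trans (∑-const (m * m) 1) (*-identityʳ _))))))))))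
        (≤-trans (≤-reflexive (ident w (∑ κ) (m * m) (∑ (λ p → x p / w)))) (+-monoʳ-≤ (w * ∑ κ + w * (m * m))
          (≤-trans (≤-reflexive (trans (*-comm w _) (sym (∑-*ʳ (λ p → x p / w) w)))) (≤-trans (∑-mono (λ p → m/n*n≤m (x p) w)) (≤-reflexive ∑x)))))
      where
      ident : ∀ w k m t → w * (k + (m + t)) ≡ w * k + w * m + w * t
      ident = solve-∀

  module Assembly {n} (D : Fin n → Fin n → Bool) {m} (c : Fin n → Fin m) (R : Fin m → Fin m → Bool) {d}
    (RG : ReducedGraph D c R d) (w G a s : ℕ) .{{_ : NonZero w}} .{{_ : NonZero (2 * w)}}
    (regular : ∀ i j → R i j ≡ true → Regularity.Regular D (2 * (4 * w) * G) G (λ y → c y == i) (λ y → c y == j))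
    (big : ∀ i j → R i j ≡ true → n ≤ a * card (λ y → c y == i) × n ≤ a * card (λ y → c y == j))
    {N} {T : Digraph N} {root : Fin N} {Δ : ℕ} (tree : RootedTree T root Δ) (h o L : ℕ) (o≤h : o ≤ h)
    (n>0 : 0 < n) (d>0 : 0 < d) (G>0 : 0 < G) (L>0 : 0 < L) (2m≤L : m + m ≤ L)
    (s>0 : 0 < s) (s≥ : suc Δ ^ h ≤ s) where

    open ReducedGraph RG
    open RootedTree tree
    open Pieces tree h o o≤h
    open Counter h
    open Bins D c R RG w

    V : Fin m → Fin n → Bool
    V i y = c y == i

    trans? : Fin N → Bool
    trans? v = below L (level v)

    childTrans? : Fin N → Bool
    childTrans? v = below L (advance (level v))

    module _ (few : ∀ i → n ≤ a * card (V i) → 2 * (4 * w) * G * card trans? ≤ card (V i))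
      (small : ∀ i → n ≤ a * card (V i) → 2 * (4 * w) * G * s ≤ card (V i))
      (wide : ∀ i → n ≤ a * card (V i) → 2 * w ≤ card (V i))
      (room : card source + s + m * m * (3 * s) ≤ ∑ κ) where

      α β : Fin N → ℕ
      α r = card (λ v → (r == piece v) ∧ source v)
      β r = card (λ v → (r == piece v) ∧ not (source v))

      part≤s : ∀ r (p : Fin N → Bool) → card (λ v → (r == piece v) ∧ p v) ≤ s
      part≤s r p = ≤-trans (card-mono (λ v e → proj₁ (∧-elim {r == piece v} e))) (≤-trans (piece-size r) s≥)

      ∑-parts : ∀ (g : Fin N → ℕ) (p : Fin N → Bool) → ∑ (λ r → g r * card (λ v → (r == piece v) ∧ p v)) ≡ ∑ (λ v → ⟦ p v ⟧ * g (piece v))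
      ∑-parts g p = trans (∑-cong (λ r → sym (∑-*ˡ (g r) _))) (trans (∑-comm _) (∑-cong (λ v →
          trans (∑-cong (λ r → trans (cong (g r *_) (trans (⟦∧⟧ (r == piece v) (p v)) (cong (λ b → ⟦ b ⟧ * ⟦ p v ⟧) (==-sym r (piece v)))))
            (rearr (g r) ⟦ piece v == r ⟧ ⟦ p v ⟧))) (∑-δ (piece v) (λ r → ⟦ p v ⟧ * g r)))))
        where
        rearr : ∀ g e p → g * (e * p) ≡ e * (p * g)
        rearr = solve-∀

      open Packing α β s s>0 (λ r → part≤s r source) (λ r → part≤s r (not ∘ source)) using (total; pack)

      total-part : ∀ p → total (λ r → card (λ v → (r == piece v) ∧ p v)) (λ _ → true) ≡ card p
      total-part p = trans (∑-parts (λ _ → 1) p) (∑-cong (λ v → *-identityʳ ⟦ p v ⟧))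

      totals-agree : total α (λ _ → true) ≡ total β (λ _ → true)
      totals-agree = trans (total-part source) (trans balanced (sym (total-part (not ∘ source))))

      Load : (Fin N → Fin (m * m)) → (Fin N → Bool) → Set
      Load f p = ∀ b → ∑ (λ r → ⟦ f r == b ⟧ * card (λ v → (r == piece v) ∧ p v)) ≤ κ b

      packing : ∃ λ (f : Fin N → Fin (m * m)) → Load f source × Load f (not ∘ source)
      packing = pack (m * m) κ (λ _ → true)
        (≤-trans (≤-reflexive totals-agree) (m≤m+n _ s) , ≤-trans (≤-reflexive (sym totals-agree)) (m≤m+n _ s))
        (≤-trans (≤-reflexive (cong (λ t → t + s + m * m * (3 * s)) (total-part source))) room)

      module WithPacking (f : Fin N → Fin (m * m)) (load-source : Load f source) (load-sink : Load f (not ∘ source)) where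

        -- `v` itself is packed into the bin of its piece, so this bin has positive capacity and
        -- comes from matched pairs.
        ownPair-valid : ∀ v → valid (fst (f (piece v))) (snd (f (piece v))) ≡ true
        ownPair-valid v = κ>0⇒valid (f (piece v)) (go (source v) refl)
          where
          loaded : ∀ p → p v ≡ true → Load f p → 0 < κ (f (piece v))
          loaded p pv load = ≤-trans (≤-trans (≤-trans (card-pos v (∧-intro (==-refl (piece v)) pv))
              (≤-reflexive (trans (sym (+-identityʳ _)) (cong (λ b → ⟦ b ⟧ * card (λ u → (piece v == piece u) ∧ p u)) (sym (==-refl (f (piece v))))))))
            (∑-term (λ r → ⟦ f r == f (piece v) ⟧ * card (λ u → (r == piece u) ∧ p u)) (piece v))) (load (f (piece v)))
          go : ∀ b → source v ≡ b → 0 < κ (f (piece v))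
          go true e = loaded source e load-source
          go false e = loaded (not ∘ source) (cong not e) load-sink

        -- An index that is not the top of a piece may be assigned to an invalid pair and then
        -- receives an arbitrary valid one; `own` states that a valid assignment is never replaced.
        record Guide (r : Fin N) : Set where
          field
            i j : Fin m
            ij-valid : valid i j ≡ true
            steering : Steering side valid i j
            own : valid (fst (f r)) (snd (f r)) ≡ true → i ≡ fst (f r) × j ≡ snd (f r)

        somePair : ∃₂ λ i j → valid i j ≡ true
        somePair = go pairs (subst (0 <_) (sym size-pairs) d>0) pairs-valid
          where
          go : ∀ ps → 0 < length ps → All (λ e → valid (c (proj₁ e)) (c (proj₂ e)) ≡ true) ps → ∃₂ λ i j → valid i j ≡ true
          go (e ∷ _) _ (h ∷ _) = c (proj₁ e) , c (proj₂ e) , h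

        guide : ∀ r → Guide r
        guide r with valid (fst (f r)) (snd (f r)) Bool.≟ true
        ... | yes h = record { i = _ ; j = _ ; ij-valid = h ; steering = steer _ _ h ; own = λ _ → refl , refl }
        ... | no ¬h = record { i = _ ; j = _ ; ij-valid = proj₂ (proj₂ somePair) ; steering = steer _ _ (proj₂ (proj₂ somePair)) ; own = λ h → ⊥-elim (¬h h) }

        module WithGuides (guide : ∀ r → Guide r) where

          next : Fin N → Bool → Fin m → Fin m
          next r = Steering.next (Guide.steering (guide r))

          dist : Fin N → Bool → Fin m → ℕ
          dist r = Steering.dist (Guide.steering (guide r))

          goal : Fin N → Bool → Fin m
          goal r b = choose b (Guide.i (guide r)) (Guide.j (guide r))

          -- The step to a child follows the rule of the parent's piece. The top of a new piece thus
          -- lands where the old rule leads, and the new rule takes over from there.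
          τFuel : ℕ → Fin N → Fin m
          τFuel zero v = goal root (source root)
          τFuel (suc t) v = next (piece (par v)) (source (par v)) (τFuel t (par v))

          τ γ : Fin N → Fin m
          τ v = τFuel (rank v) v
          γ v = next (piece v) (source v) (τ v)

          τ-root : τ root ≡ goal root (source root)
          τ-root = cong (λ t → τFuel t root) rank-root

          τ-par : ∀ v → v ≢ root → τ v ≡ γ (par v)
          τ-par v ne = cong (λ t → τFuel t v) (rank-par v ne)

          goal-side : ∀ r b → side b (goal r b) ≡ true
          goal-side r true = proj₁ (valid⇒side _ _ (Guide.ij-valid (guide r)))
          goal-side r false = proj₂ (valid⇒side _ _ (Guide.ij-valid (guide r)))

          link-side : ∀ b i j → orientedBy valid b i j ≡ true → side (not b) j ≡ true
          link-side true i j h = proj₂ (valid⇒side i j h)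
          link-side false i j h = proj₁ (valid⇒side j i h)

          τγ-link′ : ∀ v → side (source v) (τ v) ≡ true → orientedBy valid (source v) (τ v) (γ v) ≡ true
          τγ-link′ v = Steering.next-link (Guide.steering (guide (piece v))) (source v) (τ v)

          τ-side : ∀ v → side (source v) (τ v) ≡ true
          τ-side = induction _ (trans (cong (side (source root)) τ-root) (goal-side root (source root)))
            (λ v ne ih → subst₂ (λ b i → side b i ≡ true) (sym (source-par v ne)) (sym (τ-par v ne)) (link-side _ _ _ (τγ-link′ (par v) ih)))

          τγ-link : ∀ v → orientedBy valid (source v) (τ v) (γ v) ≡ true
          τγ-link v = τγ-link′ v (τ-side v)

          dist-γ : ∀ v → dist (piece v) (not (source v)) (γ v) ≤ pred (dist (piece v) (source v) (τ v))
          dist-γ v = Steering.dist-next (Guide.steering (guide (piece v))) (source v) (τ v) (τ-side v)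

          -- At the top of a piece the distance is at most `2m ≤ L`, and each level lowers it by one
          -- until it is 0. The piece of the root may start on a high level, which is why the root
          -- is put at its goal at once.
          dist-level : ∀ v → dist (piece v) (source v) (τ v) ≤ L ∸ level v
          dist-level = induction _
            (≤-trans (≤-reflexive (trans (cong₂ (λ r i → dist r (source root) i) piece-root τ-root) (Steering.dist-target (Guide.steering (guide root)) (source root)))) z≤n)
            (λ v ne ih → go v ne ih (level v ≟ 0))
            where
            go : ∀ v → v ≢ root → dist (piece (par v)) (source (par v)) (τ (par v)) ≤ L ∸ level (par v) → Dec (level v ≡ 0) →
              dist (piece v) (source v) (τ v) ≤ L ∸ level v
            go v ne ih (yes l0) = ≤-trans (≤-trans (Steering.dist≤ (Guide.steering (guide (piece v))) (source v) (τ v) (τ-side v)) 2m≤L) (≤-reflexive (cong (L ∸_) (sym l0)))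
            go v ne ih (no l≢0) = ≤-trans (≤-reflexive (trans (cong₂ (λ r b → dist r b (τ v)) (piece-par v ne l≢0) (source-par v ne)) (cong (dist (piece (par v)) (not (source (par v)))) (τ-par v ne))))
              (≤-trans (dist-γ (par v)) (≤-trans (pred-mono-≤ ih) (≤-reflexive (trans (pred[m∸n]≡m∸[1+n] L (level (par v)))
                (cong (L ∸_) (sym (trans (level-par v ne) (advance≢0 _ (λ e → l≢0 (trans (level-par v ne) e))))))))))

          below-false : ∀ y → below L y ≡ false → L ≤ y
          below-false y e = ≮⇒≥ (false⇒Dec (y <? L) e)

          bulk-τ : ∀ v → trans? v ≡ false → τ v ≡ goal (piece v) (source v)
          bulk-τ v e = Steering.dist-0 (Guide.steering (guide (piece v))) (source v) (τ v) (τ-side v)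
            (n≤0⇒n≡0 (≤-trans (dist-level v) (≤-reflexive (m≤n⇒m∸n≡0 (below-false _ e)))))

          goal-own : ∀ v b → goal (piece v) b ≡ choose b (fst (f (piece v))) (snd (f (piece v)))
          goal-own v b = cong₂ (choose b) (proj₁ (Guide.own (guide (piece v)) (ownPair-valid v))) (proj₂ (Guide.own (guide (piece v)) (ownPair-valid v)))

          bulk : Fin m → Fin N → Bool
          bulk i v = not (trans? v) ∧ (τ v == i)

          -- The bulk sources of a piece lie in the first cluster of its pair and the bulk sinks in
          -- the second, so the loads of the bins at `i` count them.
          bulk-count : ∀ i → card (bulk i) ≤ ∑ (λ p → ends i p * κ p)
          bulk-count i = ≤-trans (∑-mono pt) (≤-trans (≤-reflexive (∑-distrib-+ _ _)) (≤-trans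
              (+-mono-≤ (half source load-source (λ p → ⟦ fst p == i ⟧)) (half (not ∘ source) load-sink (λ p → ⟦ snd p == i ⟧)))
              (≤-reflexive (sym (trans (∑-cong (λ p → *-distribʳ-+ (κ p) ⟦ fst p == i ⟧ _)) (∑-distrib-+ _ _))))))
            where
            half : ∀ p → Load f p → ∀ (g : Fin (m * m) → ℕ) → ∑ (λ v → ⟦ p v ⟧ * g (f (piece v))) ≤ ∑ (λ b → g b * κ b)
            half p load g = ≤-trans (≤-reflexive (trans (sym (∑-parts (g ∘ f) p)) (trans (∑-cong (λ r → sym (trans
                  (∑-cong (λ b → rearr (g b) ⟦ f r == b ⟧ (A r))) (∑-δ (f r) (λ b → g b * A r))))) (trans (∑-comm _) (∑-cong (λ b → ∑-*ˡ (g b) _))))))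
                (∑-mono (λ b → *-monoʳ-≤ (g b) (load b)))
              where
              A : Fin N → ℕ
              A r = card (λ v → (r == piece v) ∧ p v)
              rearr : ∀ g e x → g * (e * x) ≡ e * (g * x)
              rearr = solve-∀
            pt : ∀ v → ⟦ bulk i v ⟧ ≤ ⟦ source v ⟧ * ⟦ fst (f (piece v)) == i ⟧ + ⟦ not (source v) ⟧ * ⟦ snd (f (piece v)) == i ⟧
            pt v = go (trans? v) refl
              where
              cases : ∀ b x y → ⟦ choose b x y == i ⟧ ≡ ⟦ b ⟧ * ⟦ x == i ⟧ + ⟦ not b ⟧ * ⟦ y == i ⟧
              cases true x y = sym (trans (+-identityʳ _) (+-identityʳ _))
              cases false x y = sym (+-identityʳ _)
              go : ∀ t → trans? v ≡ t → ⟦ not t ∧ (τ v == i) ⟧ ≤ ⟦ source v ⟧ * ⟦ fst (f (piece v)) == i ⟧ + ⟦ not (source v) ⟧ * ⟦ snd (f (piece v)) == i ⟧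
              go true e = z≤n
              go false e = ≤-reflexive (trans (cong (λ z → ⟦ z == i ⟧) (trans (bulk-τ v e) (goal-own v (source v)))) (cases (source v) _ _))

          module WithReserve (Q : Fin n → Bool) (Q-size : ∀ i → card (λ y → (c y == i) ∧ Q y) ≡ card (V i) / (2 * w)) where

            -- The bins leave `1/w` of the cluster and the reserve takes at most `1/(2w)`, so that
            -- `1/(2w)` remains, twice the required `1/(4w)`.
            room-everywhere : ∀ i → card (V i) + 4 * w * card (bulk i) ≤ 4 * w * card (λ y → (c y == i) ∧ not (Q y))
            room-everywhere i = ≤-by (card (V i)) (4 ⊗ capacity≤ i ⊕ (4 * w) ⊗ bulk-count i ⊕ (4 * w) ⊗ card-∖ (V i) Q ⊕ 2 ⊗ Q≤)
                (ident w (card (V i)) (card (bulk i)) (∑ (λ p → ends i p * κ p)) (card (λ y → (c y == i) ∧ not (Q y))) (card (λ y → (c y == i) ∧ Q y)))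
              where
              Q≤ : 2 * w * card (λ y → (c y == i) ∧ Q y) ≤ card (V i)
              Q≤ = ≤-trans (≤-reflexive (trans (cong (2 * w *_) (Q-size i)) (*-comm (2 * w) _))) (m/n*n≤m (card (V i)) (2 * w))
              ident : ∀ w v b u x q → v + 4 * w * b + (4 * (w * v) + (4 * w * u + (4 * w * (x + q) + 2 * v))) + v ≡
                4 * w * x + (4 * (w * u + v) + (4 * w * b + (4 * w * v + 2 * (2 * w * q))))
              ident = solve-∀

            Active : Fin m → Set
            Active i = n ≤ a * card (V i)

            link-active : ∀ b i j → orientedBy valid b i j ≡ true → Active i × Active j
            link-active true i j h = big i j (valid⇒R i j h)
            link-active false i j h = let x , y = big j i (valid⇒R j i h) in y , x

            layout : Layout D c tree (4 * w) G s
            layout = record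
              { piece = piece ; τ = τ ; γ = γ ; tr = trans? ; childTr = childTrans? ; Q = Q
              ; piece-root = piece-root
              ; piece-split = λ v ne → split v ne (level v ≟ 0)
              ; bulk-piece = λ v ne e → piece-par v ne (λ l0 → <⇒≱ L>0 (≤-trans (below-false _ e) (≤-reflexive l0)))
              ; tr-par = λ v ne → cong (below L) (level-par v ne)
              ; τ-par = τ-par
              ; piece-size = λ r → ≤-trans (piece-size r) s≥
              ; G>0 = G>0
              ; regular = λ v → reg (source v) (τ v) (γ v) (τγ-link v)
              ; Active = Active
              ; τ-active = λ v → proj₁ (link-active (source v) (τ v) (γ v) (τγ-link v))
              ; γ-active = λ v → proj₂ (link-active (source v) (τ v) (γ v) (τγ-link v))
              ; nonempty = nonempty
              ; few-tr = few
              ; small-pieces = small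
              ; Q-big = Q-big
              ; room-γ = λ v _ → room-everywhere (γ v)
              ; room-root = λ _ → room-everywhere (τ root) }
              where
              split : ∀ v → v ≢ root → Dec (level v ≡ 0) → piece v ≡ v ⊎ piece v ≡ piece (par v)
              split v ne (yes l0) = inj₁ (piece-start v l0)
              split v ne (no l≢0) = inj₂ (piece-par v ne l≢0)
              nonempty : ∀ i → Active i → 0 < card (V i)
              nonempty i act = n≢0⇒n>0 (λ e → <⇒≱ n>0 (≤-trans act (≤-reflexive (trans (cong (a *_) e) (*-zeroʳ a)))))
              reg : ∀ b i j → orientedBy valid b i j ≡ true → ∀ X Y → X ⊆ V i → Y ⊆ V j →
                card (V i) ≤ 2 * (4 * w) * G * card X → card (V j) ≤ 2 * (4 * w) * G * card Y →
                card X * card Y ≤ G * edges (orientedBy D b) X Y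
              reg true i j h X Y X⊆ Y⊆ x y = regular i j (valid⇒R i j h) X Y X⊆ Y⊆ x y
              reg false i j h X Y X⊆ Y⊆ x y = ≤-trans (≤-reflexive (*-comm (card X) (card Y)))
                (≤-trans (regular j i (valid⇒R j i h) Y X Y⊆ X⊆ y x) (*-monoʳ-≤ G (≤-reflexive (trans (∑-comm _)
                  (∑∑-cong (λ u v → cong (_* ⟦ D v u ⟧) (*-comm ⟦ Y v ⟧ ⟦ X u ⟧)))))))
              -- Rounding down at most halves a quotient that is at least 1, which is the reason for
              -- `4 * w` instead of `2 * w`.
              Q-big : ∀ i → Active i → card (V i) ≤ 4 * w * card (λ y → (c y == i) ∧ Q y)
              Q-big i act = ≤-by 0 (<⇒≤ (m<[1+m/n]*n (card (V i)) (2 * w)) ⊕ (2 * w) ⊗ k>0)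
                  (trans (ident (card (V i)) k w) (cong (λ z → 4 * w * z + (card (V i) + 2 * w * 1)) (sym (Q-size i))))
                where
                k : ℕ
                k = card (V i) / (2 * w)
                k>0 : 1 ≤ k
                k>0 = m≥n⇒m/n>0 (wide i act)
                ident : ∀ v k w → v + ((1 + k) * (2 * w) + 2 * w * k) + 0 ≡ 4 * w * k + (v + 2 * w * 1)
                ident = solve-∀

      contains : Contains D T
      contains with packing | reserve c (2 * w)
      ... | f , la , lb | Q , Q-size = Greedy.contains D c tree (4 * w) G s (WithGuides.WithReserve.layout guide Q Q-size)
        where open WithPacking f la lb

  -- Choice of parameters

  n<2^n : ∀ n → n < 2 ^ n
  n<2^n zero = ≤-refl
  n<2^n (suc n) = ≤-trans (+-mono-≤ (m^n>0 2 n) (n<2^n n)) (≤-reflexive (cong (2 ^ n +_) (sym (+-identityʳ (2 ^ n)))))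

  [m*n]^o : ∀ m n o → (m * n) ^ o ≡ m ^ o * n ^ o
  [m*n]^o m n zero = refl
  [m*n]^o m n (suc o) = trans (cong (m * n *_) ([m*n]^o m n o)) (rearr m n (m ^ o) (n ^ o))
    where
    rearr : ∀ a b x y → a * b * (x * y) ≡ a * x * (b * y)
    rearr = solve-∀

  -- With j = ⌊ℓ/e⌋: ℓ + 2 ≤ (e + 2)(j + 1) ≤ (e + 2) 2ʲ, and j e ≤ ℓ
  polynomial≤2^ : ∀ e .{{_ : NonZero e}} ℓ → (2 + ℓ) ^ e ≤ (2 + e) ^ e * 2 ^ ℓ
  polynomial≤2^ e ℓ = ≤-trans (^-monoˡ-≤ e base) (≤-trans (≤-reflexive ([m*n]^o (2 + e) (2 ^ j) e))
      (*-monoʳ-≤ ((2 + e) ^ e) (≤-trans (≤-reflexive (^-*-assoc 2 j e)) (^-monoʳ-≤ 2 (m/n*n≤m ℓ e)))))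
    where
    j : ℕ
    j = ℓ / e
    ident : ∀ j e → 2 + (1 + j) * e + 2 * j ≡ (2 + e) * (1 + j)
    ident = solve-∀
    base : 2 + ℓ ≤ (2 + e) * 2 ^ j
    base = ≤-trans (+-monoʳ-≤ 2 (<⇒≤ (m<[1+m/n]*n ℓ e))) (≤-trans (m≤m+n _ (2 * j)) (≤-trans (≤-reflexive (ident j e)) (*-monoʳ-≤ (2 + e) (n<2^n j))))

  2^⌈log₂⌉≤ : ∀ n → 0 < n → 2 ^ ⌈log₂ n ⌉ ≤ 2 * n
  2^⌈log₂⌉≤ n n>0 = go ⌈log₂ n ⌉ refl
    where
    go : ∀ ℓ → ⌈log₂ n ⌉ ≡ ℓ → 2 ^ ℓ ≤ 2 * n
    go zero _ = ≤-trans n>0 (m≤m+n n _)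
    go (suc ℓ) e = *-monoʳ-≤ 2 {2 ^ ℓ} {n} (≮⇒≥ (λ lt → <⇒≱ (≤-reflexive (sym e)) (≤-trans (⌈log₂⌉-mono-≤ {n} {2 ^ ℓ} (<⇒≤ lt)) (≤-reflexive (⌈log₂2^n⌉≡n ℓ)))))

  -- `polynomial≤2^` is applied with exponent `e + 1`: the surplus factor `2 + ℓ`, where `ℓ` is the
  -- logarithm, exceeds `2 * C * B` once `n` is at least `2 ^ (2 * C * B)`.
  polylog : ∀ B e → ∃ λ n₀ → ∀ n → n₀ ≤ n → B * (2 + ⌈log₂ n ⌉) ^ e ≤ n
  polylog B e = 2 ^ (2 * C * B) , bound
    where
    C : ℕ
    C = (2 + suc e) ^ suc e
    instance
      C≢0 : NonZero (2 * C)
      C≢0 = >-nonZero (≤-trans (m^n>0 (2 + suc e) (suc e)) (m≤m+n C _))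
    bound : ∀ n → 2 ^ (2 * C * B) ≤ n → B * (2 + ⌈log₂ n ⌉) ^ e ≤ n
    bound n big = *-cancelˡ-≤ (2 * C) (≤-trans (≤-reflexive (sym (*-assoc (2 * C) B _)))
        (≤-trans (*-monoˡ-≤ ((2 + ℓ) ^ e) (≤-trans ℓ-big (m≤n+m ℓ 2))) (≤-trans (polynomial≤2^ (suc e) ℓ)
          (≤-trans (*-monoʳ-≤ C (2^⌈log₂⌉≤ n (≤-trans (m^n>0 2 (2 * C * B)) big))) (≤-reflexive (rearr C n))))))
      where
      ℓ : ℕ
      ℓ = ⌈log₂ n ⌉
      ℓ-big : 2 * C * B ≤ ℓ
      ℓ-big = ≤-trans (≤-reflexive (sym (⌈log₂2^n⌉≡n (2 * C * B)))) (⌈log₂⌉-mono-≤ {2 ^ (2 * C * B)} {n} big)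
      rearr : ∀ C n → C * (2 * n) ≡ 2 * C * n
      rearr = solve-∀

  pieceBound≤ : ∀ ℓ c h → suc (ℓ ^ c) ^ h ≤ (2 + ℓ) ^ (suc c * h)
  pieceBound≤ ℓ c h = ≤-trans (^-monoˡ-≤ h base) (≤-reflexive (^-*-assoc (2 + ℓ) (suc c) h))
    where
    base : suc (ℓ ^ c) ≤ (2 + ℓ) ^ suc c
    base = ≤-trans (+-mono-≤ (m^n>0 (2 + ℓ) c) (≤-trans (^-monoˡ-≤ c (m≤n+m ℓ 2)) (m≤m+n _ _))) ≤-refl

  -- Discarding the pairs that touch a cluster with fewer than n/a vertices.
  module Trim {n} (D : Fin n → Fin n → Bool) {m} (c : Fin n → Fin m) (R : Fin m → Fin m → Bool) (G M : ℕ)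
    (G>0 : 0 < G) (M>0 : 0 < M) (m≤M : m ≤ M)
    (lost : G * ∑ (λ u → ∑ (λ v → ⟦ not (R (c u) (c v)) ⟧ * ⟦ D u v ⟧)) ≤ 2 * (n * n)) where

    -- At most `M` clusters are smaller than `n/a`, so together they have at most `n/(2G)` vertices.
    a : ℕ
    a = 2 * M * G

    big : Fin m → Bool
    big i = does (n ≤? a * card (λ y → c y == i))

    R′ : Fin m → Fin m → Bool
    R′ i j = R i j ∧ (big i ∧ big j)

    R′⇒R : ∀ i j → R′ i j ≡ true → R i j ≡ true
    R′⇒R i j h = proj₁ (∧-elim {R i j} h)

    R′⇒big : ∀ i j → R′ i j ≡ true → n ≤ a * card (λ y → c y == i) × n ≤ a * card (λ y → c y == j)
    R′⇒big i j h with ∧-elim {big i} (proj₂ (∧-elim {R i j} h))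
    ... | p , q = true⇒Dec (n ≤? _) p , true⇒Dec (n ≤? _) q

    smallCount : ℕ
    smallCount = card (λ u → not (big (c u)))

    a*smallCount≤ : a * smallCount ≤ M * n
    a*smallCount≤ = ≤-trans (≤-reflexive (trans (cong (a *_) (trans (∑-cong (λ v → sym (∑-δ (c v) (λ i → ⟦ not (big i) ⟧)))) (trans (∑-comm _)
          (∑-cong (λ i → ∑-*ʳ (λ v → ⟦ c v == i ⟧) ⟦ not (big i) ⟧))))) (sym (∑-*ˡ a _))))
        (≤-trans (∑-mono (λ i → pt i (big i) refl)) (≤-trans (≤-reflexive (∑-const m n)) (*-monoˡ-≤ n m≤M)))
      where
      pt : ∀ i b → big i ≡ b → a * (card (λ y → c y == i) * ⟦ not b ⟧) ≤ n
      pt i true _ = ≤-trans (≤-reflexive (trans (cong (a *_) (*-zeroʳ (card (λ y → c y == i)))) (*-zeroʳ a))) z≤n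
      pt i false e = ≤-trans (≤-reflexive (cong (a *_) (*-identityʳ _))) (<⇒≤ (≰⇒> (false⇒Dec (n ≤? _) e)))

    2G*smallCount≤ : 2 * G * smallCount ≤ n
    2G*smallCount≤ = *-cancelˡ-≤ M {{>-nonZero M>0}} (≤-trans (≤-reflexive (rearr M G smallCount)) a*smallCount≤)
      where
      rearr : ∀ M G s → M * (2 * G * s) ≡ 2 * M * G * s
      rearr = solve-∀

    kept dropped : ℕ
    kept = ∑ (λ u → ∑ (λ v → ⟦ R′ (c u) (c v) ⟧ * ⟦ D u v ⟧))
    dropped = ∑ (λ u → ∑ (λ v → ⟦ not (R′ (c u) (c v)) ⟧ * ⟦ D u v ⟧))

    kept+dropped : ∑ (λ u → ∑ (λ v → ⟦ D u v ⟧)) ≡ kept + dropped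
    kept+dropped = trans (∑∑-cong (λ u v → pt (R′ (c u) (c v)) ⟦ D u v ⟧)) (∑∑-+ _ _)
      where
      pt : ∀ b x → x ≡ ⟦ b ⟧ * x + ⟦ not b ⟧ * x
      pt true x = sym (trans (+-identityʳ _) (+-identityʳ x))
      pt false x = sym (+-identityʳ x)

    -- Regularisation loses `2n²/G`; the `n/(2G)` vertices in small clusters, as tails and as heads,
    -- account for another `n²/G`.
    dropped≤ : G * dropped ≤ 3 * (n * n)
    dropped≤ = ≤-by 0 (lost ⊕ n ⊗ 2G*smallCount≤ ⊕ G ⊗ pointwise) (ident G n dropped _ smallCount)
      where
      pt : ∀ r x y d → d ≤ 1 → ⟦ not (r ∧ (x ∧ y)) ⟧ * d ≤ ⟦ not r ⟧ * d + (⟦ not x ⟧ + ⟦ not y ⟧)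
      pt false x y d _ = m≤m+n _ _
      pt true true true d _ = z≤n
      pt true true false d h = ≤-trans (≤-reflexive (+-identityʳ d)) h
      pt true false y d h = ≤-trans (≤-reflexive (+-identityʳ d)) (≤-trans h (m≤m+n 1 _))
      pointwise : dropped ≤ ∑ (λ u → ∑ (λ v → ⟦ not (R (c u) (c v)) ⟧ * ⟦ D u v ⟧)) + (smallCount * n + n * smallCount)
      pointwise = ≤-trans (∑∑-mono (λ u v → pt (R (c u) (c v)) (big (c u)) (big (c v)) ⟦ D u v ⟧ (⟦⟧≤1 (D u v))))
        (≤-reflexive (trans (∑∑-+ _ _) (cong (∑ (λ u → ∑ (λ v → ⟦ not (R (c u) (c v)) ⟧ * ⟦ D u v ⟧)) +_) (trans (∑∑-+ _ _) (cong₂ _+_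
          (trans (∑-cong (λ u → trans (∑-const n _) (*-comm n _))) (∑-*ʳ (λ u → ⟦ not (big (c u)) ⟧) n)) (∑-const n _))))))
      ident : ∀ G n x l s → G * x + (2 * (n * n) + (n * n + G * (l + (s * n + n * s)))) + 0 ≡ 3 * (n * n) + (G * l + (n * (2 * G * s) + G * x))
      ident = solve-∀

  -- The density left after losing 3n²/(12q²) edges is above the threshold (1 + 1/2q) k n
  density : ∀ q .{{_ : NonZero q}} n k′ e e′ e″ → n ≤ q * suc k′ → 4 * q + 3 ≤ k′ → suc q * k′ * n ≤ q * e → e ≡ e′ + e″ →
    12 * q * q * e″ ≤ 3 * (n * n) → (2 * q + 1) * suc k′ * (2 * n) ≤ 4 * q * e′
  density q n k′ e e′ e″ n≤ k-big edges refl loss =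
      ≤-by 0 (4 ⊗ edges ⊕ small ⊕ n ⊗ k-big) (ident q n k′ e′ e″)
    where
    -- The origin of `G = 12q²`: the loss is at most `n²/(4q²)`, and `n ≤ q k`. The bound
    -- `4 * q + 3 ≤ k′` then pays for the difference between `k` and `k - 1`.
    small : 4 * q * e″ ≤ n * suc k′
    small = *-cancelˡ-≤ (3 * q) {{m*n≢0 3 q}} (≤-trans (≤-reflexive (i₁ q e″)) (≤-trans loss (≤-trans (3 ⊗ (n ⊗ n≤)) (≤-reflexive (i₂ q n (suc k′))))))
      where
      i₁ : ∀ q x → 3 * q * (4 * q * x) ≡ 12 * q * q * x
      i₁ = solve-∀
      i₂ : ∀ q n k → 3 * (n * (q * k)) ≡ 3 * q * (n * k)
      i₂ = solve-∀
    ident : ∀ q n k x y → (2 * q + 1) * (1 + k) * (2 * n) + (4 * (q * (x + y)) + (n * (1 + k) + n * k)) + 0 ≡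
      4 * q * x + (4 * ((1 + q) * k * n) + (4 * q * y + n * (4 * q + 3)))
    ident = solve-∀

  -- With w = 8q: the bins have room for (k + 1)/2 sources and X spare places.
  capacity : ∀ p n k d S m² A X → let q = suc p in
    n ≤ q * k → q * q * (16 + 7 * (X + m²)) ≤ n → 8 * q * d ≤ 8 * q * S + 8 * q * m² + d →
    (2 * q + 1) * k ≤ 4 * q * (2 + d) → 2 * A ≤ suc k → A + X ≤ S
  -- Up to rounding, `d` is `(1 + 1/2q) k/2`; withholding `1/(8q)` of it leaves an excess over `k/2`
  -- of `(6q - 1) k/(32q²)`, at least `5k/(32q)`. By the lower bound on `n` this covers `X + m²`,
  -- while the 16 absorbs the rounding in `d` and in `(k + 1)/2`.
  capacity p n k d S m² A X n≤ n≥ h₁ h₂ hA = *-cancelˡ-≤ (32 * (q * q)) (≤-by (p * k + 3 * (q * q) * X + 3 * (q * q) * m² + 8 * q)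
      ((4 * q) ⊗ h₁ ⊕ (7 + 8 * p) ⊗ h₂ ⊕ (16 * (q * q)) ⊗ hA ⊕ 5 ⊗ (≤-trans n≥ n≤)) (ident p k d S m² A X))
    where
    q = suc p
    ident : ∀ p k d S m A X →
      32 * ((1 + p) * (1 + p)) * (A + X) +
      (4 * (1 + p) * (8 * (1 + p) * S + 8 * (1 + p) * m + d) + ((7 + 8 * p) * (4 * (1 + p) * (2 + d)) + (16 * ((1 + p) * (1 + p)) * (1 + k) + 5 * ((1 + p) * k)))) +
      (p * k + 3 * ((1 + p) * (1 + p)) * X + 3 * ((1 + p) * (1 + p)) * m + 8 * (1 + p)) ≡
      32 * ((1 + p) * (1 + p)) * S +
      (4 * (1 + p) * (8 * (1 + p) * d) + ((7 + 8 * p) * ((2 * (1 + p) + 1) * k) + (16 * ((1 + p) * (1 + p)) * (2 * A) + 5 * ((1 + p) * (1 + p) * (16 + 7 * (X + m))))))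
    ident = solve-∀

  module Embedding (p w G M : ℕ) (w≡8q : w ≡ 8 * suc p) (G≡12q² : G ≡ 12 * suc p * suc p) (M>0 : 0 < M)
    (partition : ∀ {n} (D : Fin n → Fin n → Bool) → 0 < n → Regularity.Partition D (2 * (4 * w) * G) G M) (c : ℕ) where

    -- `L` exceeds the length `2m` of the longest walk. The transitional vertices form at most `1/K`
    -- of the tree, which has at most `2n` vertices, hence `K = 2aE`. The summands of `B` make
    -- clusters large compared with the pieces, make the reserves nonempty, and leave spare places
    -- in the bins; there `23 + 28M²` is `16 + 7(1 + 3M² + M²)`.
    q E a L K h B : ℕ
    q = suc p
    E = 2 * (4 * w) * G
    a = 2 * M * G
    L = suc (M + M)
    K = 2 * a * E
    h = pred (L * K)
    B = a * E + a * (2 * w) + q * q * (23 + 28 * (M * M))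

    w>0 : 0 < w
    w>0 = subst (0 <_) (sym w≡8q) (s≤s z≤n)

    G>0 : 0 < G
    G>0 = subst (0 <_) (sym G≡12q²) (s≤s z≤n)

    2w>0 : 0 < 2 * w
    2w>0 = *-mono-≤ {1} {2} (s≤s z≤n) w>0

    a>0 : 0 < a
    a>0 = *-mono-≤ {1} {2 * M} (*-mono-≤ {1} {2} (s≤s z≤n) M>0) G>0

    E>0 : 0 < E
    E>0 = *-mono-≤ {1} {2 * (4 * w)} (*-mono-≤ {1} {2} (s≤s z≤n) (*-mono-≤ {1} {4} (s≤s z≤n) w>0)) G>0

    K>0 : 0 < K
    K>0 = *-mono-≤ {1} {2 * a} (*-mono-≤ {1} {2} (s≤s z≤n) a>0) E>0

    suc-h : suc h ≡ L * K
    suc-h = suc-pred (L * K) {{>-nonZero (*-mono-≤ {1} {L} (s≤s z≤n) K>0)}}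

    n₀ : ℕ
    n₀ = proj₁ (polylog B (suc c * h))

    module _ (n k′ : ℕ) (n≥n₀ : n₀ ≤ n) (n≤qk : n ≤ q * suc k′) (D : Digraph n) (oriented : IsOriented D)
      (edges> : suc q * k′ * n < q * edgeCount D)
      (T : Digraph (suc (suc k′))) (tree : RootedTree T zero (⌈log₂ n ⌉ ^ c)) where

      k s N : ℕ
      k = suc k′
      N = suc k
      s = suc (⌈log₂ n ⌉ ^ c) ^ h

      s>0 : 0 < s
      s>0 = m^n>0 (suc (⌈log₂ n ⌉ ^ c)) h

      Bs≤n : B * s ≤ n
      Bs≤n = ≤-trans (*-monoʳ-≤ B (pieceBound≤ ⌈log₂ n ⌉ c h)) (proj₂ (polylog B (suc c * h)) n n≥n₀)

      aEs≤n : a * E * s ≤ n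
      aEs≤n = ≤-trans (*-monoˡ-≤ s (≤-trans (m≤m+n (a * E) (a * (2 * w))) (m≤m+n (a * E + a * (2 * w)) (q * q * (23 + 28 * (M * M)))))) Bs≤n

      2aw≤n : a * (2 * w) ≤ n
      2aw≤n = ≤-trans (≤-trans (≤-trans (≤-trans (m≤n+m (a * (2 * w)) (a * E)) (m≤m+n (a * E + a * (2 * w)) (q * q * (23 + 28 * (M * M))))) (≤-reflexive (sym (*-identityʳ B)))) (*-monoʳ-≤ B s>0)) Bs≤n

      room≤n : q * q * (23 + 28 * (M * M)) * s ≤ n
      room≤n = ≤-trans (*-monoˡ-≤ s (m≤n+m (q * q * (23 + 28 * (M * M))) (a * E + a * (2 * w)))) Bs≤n

      n>0 : 0 < n
      n>0 = ≤-trans (*-mono-≤ a>0 2w>0) 2aw≤n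

      e≡ : edgeCount D ≡ ∑ (λ u → ∑ (λ v → ⟦ D u v ⟧))
      e≡ = edgeCount≡∑ D

      k≤n : k ≤ n
      k≤n = *-cancelˡ-< q k′ n (*-cancelʳ-< n (q * k′) (q * n) (≤-trans (s≤s (*-monoˡ-≤ n (m≤n+m (q * k′) k′)))
        (≤-trans edges> (≤-trans (*-monoʳ-≤ q (≤-trans (≤-reflexive e≡) (∑∑≤n² D))) (≤-reflexive (sym (*-assoc q n n)))))))

      k-large : q * (23 + 28 * (M * M)) ≤ k
      k-large = *-cancelˡ-≤ q (≤-trans (≤-trans (≤-trans (≤-reflexive (trans (sym (*-assoc q q (23 + 28 * (M * M)))) (sym (*-identityʳ (q * q * (23 + 28 * (M * M))))))) (*-monoʳ-≤ (q * q * (23 + 28 * (M * M))) s>0)) room≤n) n≤qk)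

      k′≥ : 4 * q + 3 ≤ k′
      k′≥ = s≤s⁻¹ (≤-trans (≤-by (19 * p + 15 + (1 + p) * (28 * (M * M))) (≤-refl {0}) (ident p (M * M))) k-large)
        where
        ident : ∀ p M → 1 + (4 * (1 + p) + 3) + 0 + (19 * p + 15 + (1 + p) * (28 * M)) ≡ (1 + p) * (23 + 28 * M) + 0
        ident = solve-∀

      open Regularity.Partition (partition D n>0) using (m; m≤M; regular; lost) renaming (c to colour; R to R₀)
      module Tr = Trim D colour R₀ G M G>0 M>0 m≤M lost
      open Tr using (R′)

      num t d : ℕ
      num = (2 * q + 1) * k
      t = num / (4 * q)
      -- One is subtracted for the vertex itself, which `adj` excludes.
      d = t ∸ 1

      t≥2 : 2 ≤ t
      t≥2 = s≤s⁻¹ (*-cancelʳ-< (4 * q) 2 (suc t) (≤-trans (s≤s (≤-by (18 * p + 8 * p * p + 13) (≤-trans k′≥ (n≤1+n k′) ⊗′ (2 * q + 1)) (ident p k))) (m<[1+m/n]*n num (4 * q))))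
        where
        _⊗′_ : ∀ {x y} → x ≤ y → ∀ z → z * x ≤ z * y
        le ⊗′ z = *-monoʳ-≤ z le
        ident : ∀ p k → 2 * (4 * (1 + p)) + (2 * (1 + p) + 1) * k + (18 * p + 8 * p * p + 13) ≡ (2 * (1 + p) + 1) * k + (2 * (1 + p) + 1) * (4 * (1 + p) + 3)
        ident = solve-∀

      suc-d : suc d ≡ t
      suc-d = m+[n∸m]≡n {1} {t} (≤-trans (s≤s z≤n) t≥2)

      d>0 : 0 < d
      d>0 = s≤s⁻¹ (≤-trans t≥2 (≤-reflexive (sym suc-d)))

      4q[1+d]≤num : 4 * q * suc d ≤ num
      4q[1+d]≤num = ≤-trans (≤-reflexive (trans (cong (4 * q *_) suc-d) (*-comm (4 * q) t))) (m/n*n≤m num (4 * q))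

      num≤ : num ≤ 4 * q * (2 + d)
      num≤ = ≤-trans (<⇒≤ (m<[1+m/n]*n num (4 * q))) (≤-reflexive (trans (*-comm (suc t) (4 * q)) (cong (λ z → 4 * q * suc z) (sym suc-d))))

      dense : num * (2 * n) ≤ 4 * q * Tr.kept
      dense = density q n k′ (edgeCount D) Tr.kept Tr.dropped n≤qk k′≥ (<⇒≤ edges>) (trans e≡ Tr.kept+dropped)
        (subst (λ g → g * Tr.dropped ≤ 3 * (n * n)) G≡12q² Tr.dropped≤)

      RG : ReducedGraph D colour R′ d
      RG = Reduce.reducedGraph D (proj₂ oriented) colour R′ num (4 * q) d n>0 (s≤s z≤n) 4q[1+d]≤num dense

      module WithReduced (RG : ReducedGraph D colour R′ d) (o : ℕ) (o≤h : o ≤ h)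
        (few : suc h * card (λ v → below L (Counter.count h o (RootedTree.rank tree v))) ≤ N * L) where
        open RootedTree tree

        instance
          w≢0 : NonZero w
          w≢0 = >-nonZero w>0
          2w≢0 : NonZero (2 * w)
          2w≢0 = >-nonZero 2w>0

        V : Fin m → Fin n → Bool
        V i y = colour y == i

        transitional : ℕ
        transitional = card (λ v → below L (Counter.count h o (rank v)))

        K*transitional≤ : K * transitional ≤ N
        K*transitional≤ = *-cancelˡ-≤ L (≤-trans (≤-reflexive (trans (sym (*-assoc L K transitional)) (cong (_* transitional) (sym suc-h)))) (≤-trans few (≤-reflexive (*-comm N L))))

        few-transitional : ∀ i → n ≤ a * card (V i) → E * transitional ≤ card (V i)
        few-transitional i act = *-cancelˡ-≤ (2 * a) {{>-nonZero (*-mono-≤ {1} {2} (s≤s z≤n) a>0)}}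
          (≤-trans (≤-reflexive (sym (*-assoc (2 * a) E transitional))) (≤-trans K*transitional≤
            (≤-trans (+-mono-≤ n>0 k≤n) (≤-trans (≤-reflexive (cong (n +_) (sym (+-identityʳ n)))) (≤-trans (*-monoʳ-≤ 2 act) (≤-reflexive (sym (*-assoc 2 a _))))))))

        small : ∀ i → n ≤ a * card (V i) → E * s ≤ card (V i)
        small i act = *-cancelˡ-≤ a {{>-nonZero a>0}} (≤-trans (≤-reflexive (sym (*-assoc a E s))) (≤-trans aEs≤n act))

        wide : ∀ i → n ≤ a * card (V i) → 2 * w ≤ card (V i)
        wide i act = *-cancelˡ-≤ a {{>-nonZero a>0}} (≤-trans 2aw≤n act)

        2*sources : 2 * card source ≤ N
        2*sources = ≤-reflexive (trans (cong (card source +_) (trans (+-identityʳ _) balanced)) (trans (sym (∑-distrib-+ _ _))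
          (trans (∑-cong (λ v → ⟦not⟧ (source v))) (trans (∑-const N 1) (*-identityʳ N)))))

        X : ℕ
        X = s + m * m * (3 * s)

        X-small : q * q * (16 + 7 * (X + m * m)) ≤ n
        X-small = ≤-trans (≤-trans (*-monoʳ-≤ (q * q) inner≤) (≤-reflexive (sym (*-assoc (q * q) (23 + 28 * (M * M)) s)))) room≤n
          where
          m²≤ : m * m ≤ M * M
          m²≤ = *-mono-≤ m≤M m≤M
          ident : ∀ s m M → 16 + 7 * (s + m * (3 * s) + m) + (16 * s + (21 * s * M + (7 * M + 7 * M * s))) + 0 ≡
            (23 + 28 * M) * s + (16 * 1 + (21 * s * m + (7 * m + 7 * M * 1)))
          ident = solve-∀
          inner≤ : 16 + 7 * (X + m * m) ≤ (23 + 28 * (M * M)) * s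
          inner≤ = ≤-by 0 (16 ⊗ s>0 ⊕ (21 * s) ⊗ m²≤ ⊕ 7 ⊗ m²≤ ⊕ (7 * (M * M)) ⊗ s>0) (ident s (m * m) (M * M))

        room : card source + s + m * m * (3 * s) ≤ ∑ (Bins.κ D colour R′ RG w)
        room = ≤-trans (≤-reflexive (+-assoc (card source) s _)) (capacity p n k d (∑ (Bins.κ D colour R′ RG w)) (m * m) (card source) X n≤qk X-small
          (subst (λ z → z * d ≤ z * ∑ (Bins.κ D colour R′ RG w) + z * (m * m) + d) w≡8q (Bins.∑κ≥ D colour R′ RG w)) num≤ 2*sources)

        embed : Contains D T
        embed = Assembly.contains D colour R′ RG w G a s (λ i j r → regular i j (Tr.R′⇒R i j r)) Tr.R′⇒big tree h o L o≤h
          n>0 d>0 G>0 (s≤s z≤n) (≤-trans (+-mono-≤ m≤M m≤M) (n≤1+n _)) s>0 ≤-refl few-transitional small wide room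

      contains : Contains D T
      contains with Counter.few-below h (RootedTree.rank tree) L
      ... | o , o≤h , few = WithReduced.embed RG o o≤h few

  clusterBound>0 : ∀ E G → 0 < clusterBound E G
  clusterBound>0 E G = m≤refineIter (suc (E * E * G)) 1

  balanced-trees : ∀ p c → Σ[ n₀ ∈ ℕ ] (∀ n k → n₀ ≤ n → n ≤ suc p * suc k → (D : Digraph n) → IsOriented D →
    suc (suc p) * k * n < suc p * edgeCount D → (T : Digraph (suc (suc k))) → IsAntidirectedTree (suc k) T → IsBalanced T →
    MaxDegree≤ T (⌈log₂ n ⌉ ^ c) → Contains D T)
  balanced-trees p c = Em.n₀ , λ n k n≥ n≤ D ori e> T (oriT , anti , conn , count) bal deg →
      Em.contains n k n≥ n≤ D ori e> T (rootedTree T (s≤s z≤n) anti conn count bal deg)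
    where
    w G : ℕ
    w = 8 * suc p
    G = 12 * suc p * suc p
    module Em = Embedding p w G (clusterBound (2 * (4 * w) * G) G) refl refl (clusterBound>0 (2 * (4 * w) * G) G)
      (λ D n>0 → Regularity.regularity D (2 * (4 * w) * G) G n>0) c

-- From rational hypotheses to natural numbers

open import Data.Nat using (zero; _<_; s≤s; z≤n) renaming (_+_ to _+ℕ_; _*_ to _*ℕ_)
import Data.Nat.Properties as ℕ
open import Data.Nat.Tactic.RingSolver using (solve-∀)
open import Data.Integer using (+_)
import Data.Integer as ℤ
import Data.Integer.Properties as ℤ
open import Data.Rational using (ℚ; 0ℚ; 1ℚ; _+_; _*_; _-_; _/_) renaming (_<_ to _<ℚ_; _≤_ to _≤ℚ_)
open import Data.Rational using (mkℚ)
import Data.Rational as ℚ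
import Data.Rational.Properties as ℚ
import Data.Rational.Unnormalised as ℚᵘ
import Data.Rational.Unnormalised.Properties as ℚᵘ
open import Data.Product using (_,_; proj₁; proj₂)
open import Data.Empty using (⊥-elim)
open import Relation.Binary.PropositionalEquality using (_≡_; refl; sym; trans; cong; cong₂; subst₂)
open BalancedTrees using (balanced-trees)

toℚᵘ-/1 : ∀ i → ℚ.toℚᵘ (i / 1) ℚᵘ.≃ ℚᵘ.mkℚᵘ i 0
toℚᵘ-/1 i = ℚ.toℚᵘ-fromℚᵘ (ℚᵘ.mkℚᵘ i 0)

+-drop-≤ : ∀ {m n} → + m ℤ.≤ + n → m ≤ n
+-drop-≤ (ℤ.+≤+ h) = h

+-drop-< : ∀ {m n} → + m ℤ.< + n → m < n
+-drop-< (ℤ.+<+ h) = h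

-- The numerator of `η` is at least 1, so `η ≥ 1/q` with `q` its denominator `suc b`.
dense-k : ∀ η a b → ℚ.toℚᵘ η ≡ ℚᵘ.mkℚᵘ (+ suc a) b → ∀ n k → η * (+ n / 1) ≤ℚ + k / 1 → n ≤ suc b *ℕ k
dense-k η a b ηᵘ≡ n k h = ℕ.≤-trans (ℕ.≤-trans (ℕ.m≤m+n n (a *ℕ n)) (+-drop-≤ (subst₂ ℤ._≤_ eq₁ eq₂ (ℚᵘ.drop-*≤* h′)))) (ℕ.≤-reflexive (ℕ.*-comm k (suc b)))
  where
  ηᵘ = ℚᵘ.mkℚᵘ (+ suc a) b
  h′ : (ηᵘ ℚᵘ.* ℚᵘ.mkℚᵘ (+ n) 0) ℚᵘ.≤ ℚᵘ.mkℚᵘ (+ k) 0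
  h′ = ℚᵘ.≤-respʳ-≃ (toℚᵘ-/1 (+ k)) (ℚᵘ.≤-respˡ-≃ (ℚᵘ.≃-trans (ℚ.toℚᵘ-homo-* η (+ n / 1))
    (ℚᵘ.*-cong (ℚᵘ.≃-reflexive ηᵘ≡) (toℚᵘ-/1 (+ n)))) (ℚ.toℚᵘ-mono-≤ h))
  eq₁ : (+ suc a ℤ.* + n) ℤ.* + 1 ≡ + (suc a *ℕ n)
  eq₁ = trans (ℤ.*-identityʳ _) (sym (ℤ.pos-* (suc a) n))
  eq₂ : + k ℤ.* + (suc b *ℕ 1) ≡ + (k *ℕ suc b)
  eq₂ = trans (cong (λ z → + k ℤ.* + z) (ℕ.*-identityʳ (suc b))) (sym (ℤ.pos-* k (suc b)))

units : ∀ b → 1 *ℕ suc b *ℕ 1 *ℕ 1 ≡ suc b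
units = solve-∀

-- Replacing `η` by `1/q` only weakens the bound on the edges. The tree has `suc k` edges here, so
-- that `k - 1` of the theorem becomes a natural number.
dense-e : ∀ η a b → ℚ.toℚᵘ η ≡ ℚᵘ.mkℚᵘ (+ suc a) b → ∀ n k e → (1ℚ + η) * ((+ suc k / 1) - 1ℚ) * (+ n / 1) <ℚ + e / 1 →
  suc (suc b) *ℕ k *ℕ n < suc b *ℕ e
dense-e η a b ηᵘ≡ n k e h = ℕ.≤-<-trans (ℕ.*-monoˡ-≤ n (ℕ.*-monoˡ-≤ k (s≤s (s≤s (ℕ.m≤m+n b a)))))
    (ℕ.<-≤-trans (+-drop-< (subst₂ ℤ._<_ eq₁ eq₂ (ℚᵘ.drop-*<* h′))) (ℕ.≤-reflexive (ℕ.*-comm e (suc b))))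
  where
  ηᵘ = ℚᵘ.mkℚᵘ (+ suc a) b
  kᵘ = ℚᵘ.mkℚᵘ (+ suc k) 0
  X = ((ℚᵘ.1ℚᵘ ℚᵘ.+ ηᵘ) ℚᵘ.* (kᵘ ℚᵘ.- ℚᵘ.1ℚᵘ)) ℚᵘ.* ℚᵘ.mkℚᵘ (+ n) 0
  conv-k : ℚ.toℚᵘ ((+ suc k / 1) - 1ℚ) ℚᵘ.≃ kᵘ ℚᵘ.- ℚᵘ.1ℚᵘ
  conv-k = ℚᵘ.≃-trans (ℚ.toℚᵘ-homo-+ (+ suc k / 1) (ℚ.- 1ℚ)) (ℚᵘ.+-congˡ (ℚᵘ.- ℚᵘ.1ℚᵘ) (toℚᵘ-/1 (+ suc k)))
  conv : ℚ.toℚᵘ ((1ℚ + η) * ((+ suc k / 1) - 1ℚ) * (+ n / 1)) ℚᵘ.≃ X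
  conv = ℚᵘ.≃-trans (ℚ.toℚᵘ-homo-* ((1ℚ + η) * ((+ suc k / 1) - 1ℚ)) (+ n / 1)) (ℚᵘ.*-cong
    (ℚᵘ.≃-trans (ℚ.toℚᵘ-homo-* (1ℚ + η) ((+ suc k / 1) - 1ℚ)) (ℚᵘ.*-cong (ℚᵘ.≃-trans (ℚ.toℚᵘ-homo-+ 1ℚ η) (ℚᵘ.+-congʳ ℚᵘ.1ℚᵘ (ℚᵘ.≃-reflexive ηᵘ≡))) conv-k)) (toℚᵘ-/1 (+ n)))
  h′ : X ℚᵘ.< ℚᵘ.mkℚᵘ (+ e) 0
  h′ = ℚᵘ.<-respʳ-≃ (toℚᵘ-/1 (+ e)) (ℚᵘ.<-respˡ-≃ conv (ℚ.toℚᵘ-mono-< h))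
  eq₁ : ℚᵘ.↥ X ℤ.* + 1 ≡ + (suc (suc b +ℕ a) *ℕ k *ℕ n)
  eq₁ = trans (ℤ.*-identityʳ (ℚᵘ.↥ X)) (trans (cong (ℤ._* + n) (trans (cong₂ ℤ._*_
      (trans (cong₂ ℤ._+_ (ℤ.*-identityˡ (+ suc b)) (ℤ.*-identityʳ (+ suc a))) (cong +_ (ℕ.+-suc (suc b) a)))
      (cong (ℤ._+ ℤ.-1ℤ) (ℤ.*-identityʳ (+ suc k)))) (sym (ℤ.pos-* (suc (suc b +ℕ a)) k)))) (sym (ℤ.pos-* (suc (suc b +ℕ a) *ℕ k) n)))
  eq₂ : + e ℤ.* ℚᵘ.↧ X ≡ + (e *ℕ suc b)
  eq₂ = trans (cong (λ z → + e ℤ.* + z) (units b)) (sym (ℤ.pos-* e (suc b)))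

theorem4 : (η : ℚ) → 0ℚ <ℚ η → η <ℚ 1ℚ → (c : ℕ) →
    Σ[ n₀ ∈ ℕ ] ((n k : ℕ) → n₀ ≤ n → η * (+ n / 1) ≤ℚ + k / 1 →
    (D : Digraph n) → IsOriented D →
    (1ℚ + η) * ((+ k / 1) - 1ℚ) * (+ n / 1) <ℚ + edgeCount D / 1 →
    (T : Digraph (suc k)) → IsAntidirectedTree k T → IsBalanced T →
    MaxDegree≤ T (⌈log₂ n ⌉ ^ c) →
    Contains D T)
theorem4 (mkℚ (+ 0) _ _) (ℚ.*<* (ℤ.+<+ ())) _ c
-- The successor ensures `n > 0`, which rules out `k = 0` because `k ≥ ηn`.
theorem4 (mkℚ (+ suc a) b cop) _ _ c = suc n₀ , embed
  where
  n₀ : ℕ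
  n₀ = proj₁ (balanced-trees b c)
  embed : (n k : ℕ) → suc n₀ ≤ n → mkℚ (+ suc a) b cop * (+ n / 1) ≤ℚ + k / 1 →
    (D : Digraph n) → IsOriented D →
    (1ℚ + mkℚ (+ suc a) b cop) * ((+ k / 1) - 1ℚ) * (+ n / 1) <ℚ + edgeCount D / 1 →
    (T : Digraph (suc k)) → IsAntidirectedTree k T → IsBalanced T →
    MaxDegree≤ T (⌈log₂ n ⌉ ^ c) →
    Contains D T
  embed n zero n≥ dk D ori de T tree bal deg =
    ⊥-elim (ℕ.<⇒≱ (ℕ.≤-trans (s≤s z≤n) n≥) (ℕ.≤-trans (dense-k (mkℚ (+ suc a) b cop) a b refl n 0 dk) (ℕ.≤-reflexive (ℕ.*-zeroʳ (suc b)))))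
  embed n (suc k) n≥ dk D ori de T tree bal deg =
    proj₂ (balanced-trees b c) n k (ℕ.≤-trans (ℕ.n≤1+n n₀) n≥) (dense-k (mkℚ (+ suc a) b cop) a b refl n (suc k) dk) D ori
      (dense-e (mkℚ (+ suc a) b cop) a b refl n k (edgeCount D) de) T tree bal deg
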